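{- Every subset $A\subseteq[n]=\{1,\dots,n\}$ containing no nontrivial solution to the equation $x_1+x_2+2x_3=x_4+3x_5$ (with $x_1,\dots,x_5\in A$) has size $o(\sqrt n)$ as $n\to\infty$. Here a solution is trivial if $(x_1,\dots,x_5)=(x,y,y,x,y)$ or $(y,x,y,x,y)$ for some $x,y\in\mathbb Z$. -}

module Defs where

open import Data.Nat using (ℕ; suc; _+_; _*_)
open import Data.Fin using (Fin; toℕ)
open import Data.Fin.Subset using (Subset; _∈_)
open import Data.Product using (_×_)
open import Data.Sum using (_⊎_)
open import Relation.Binary.PropositionalEquality using (_≡_)

-- Fin n encodes [n] = {1,…,n} via i ↦ toℕ i + 1.
val : ∀ {n} → Fin n → ℕ
val i = suc (toℕ i)

Trivial : ℕ → ℕ → ℕ → ℕ → ℕ → Set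
Trivial x1 x2 x3 x4 x5 =
  (x1 ≡ x4 × x2 ≡ x3 × x5 ≡ x3) ⊎ (x2 ≡ x4 × x1 ≡ x3 × x5 ≡ x3)

SolutionFree : ∀ {n} → Subset n → Set
SolutionFree {n} A =
  (a b c d e : Fin n) → a ∈ A → b ∈ A → c ∈ A → d ∈ A → e ∈ A →
  val a + val b + 2 * val c ≡ val d + 3 * val e →
  Trivial (val a) (val b) (val c) (val d) (val e)

{-# OPTIONS --safe #-}
module Submission where

-- Taking x₃ = x₅ in the equation shows that A is a Sidon set, so its differences form a dense
-- set D in which every nonzero difference is represented once.  Work in ℤ/(6n+1), where 2 and 3
-- are invertible and no sum wraps around.
--
-- Almost periods: for a set s, sampling shows that a positive proportion of the group, independent
-- of its order, consists of shifts any two of which differ by an almost period of the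
-- autocorrelation of s.  Applied to a dense set s, this bounds below the number of solutions of the
-- equation in s: if x₃ and x₅ come from one such class of popular sums x₁ + x₂ - x₄, then
-- 3 x₅ - 2 x₃ = x₅ + 2 (x₅ - x₃) is again popular.
--
-- Transference: let T(t) be the number of solutions of x₁ + x₂ + 2 x₃ - x₄ - 3 x₅ = t in A, with
-- x₂ - x₄ counted as an element of D.  By Cauchy-Schwarz and the Sidon property T changes by at most
-- a small multiple of |A|³ under shifts by almost periods of the autocorrelation of D.  Since
-- T(0) ≤ |A|², smoothing A by a set H of shifts whose differences are such almost periods gives few
-- solutions.  But if |A| ≥ c √n then the smoothed function is large on a set whose density depends
-- on c only, which contradicts the bound for dense sets.

open import Defs
open import Algebra.Bundles using (AbelianGroup; CommutativeMonoid; CommutativeSemigroup)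
import Algebra.Properties.AbelianGroup as AbelianGroupProperties
import Algebra.Properties.CommutativeSemigroup as CommutativeSemigroupProperties
import Algebra.Properties.Monoid.Mult as MonoidMult
open import Algebra.Structures using (IsAbelianGroup)
open import Data.Bool.Base using (true; false)
import Data.Bool.Properties as Bool
open import Data.Empty using (⊥; ⊥-elim)
open import Data.Fin.Base using (Fin; zero; suc; toℕ)
open import Data.Fin.Permutation using (permutation)
open import Data.Fin.Properties using (any?; _≟_; toℕ-fromℕ<; toℕ-injective; toℕ<n)
import Data.Integer as ℤ
import Data.Integer.Properties as ℤₚ
import Data.Integer.Tactic.RingSolver as ℤ-Solver
open import Data.Nat.Base as ℕ using (ℕ; z≤n)
import Data.Nat.Properties as ℕₚ
import Data.Nat.Tactic.RingSolver as ℕ-Solver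
open import Data.Product using (∃; ∃-syntax; _,_; _×_; proj₁; proj₂)
open import Data.Sum using (_⊎_; inj₁; inj₂)
open import Data.Vec.Base as Vec using (Vec; []; _∷_; lookup)
open import Data.Vec.Properties using (lookup⇒[]=)
open import Data.Vec.Relation.Unary.All using (All; []; _∷_)
open import Level using (0ℓ)
open import Relation.Binary.PropositionalEquality
  using (_≡_; _≢_; _≗_; refl; sym; trans; cong; cong₂; subst; subst₂; setoid; isEquivalence; module ≡-Reasoning)
open import Relation.Nullary using (¬_; yes; no; Dec; ¬?)
open import Relation.Nullary.Decidable using (decidable-stable)
open import Algebra.Properties.Semiring.Sum ℤₚ.+-*-semiring
  using (sum-cong-≗; ∑-distrib-+; ∑-comm; sum-permute; *-distribˡ-sum; *-distribʳ-sum)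
  renaming (sum to ∑)

-- The set has density about N^(-1/2), so counting arguments for dense sets do not apply to it
-- directly. Its difference set is dense, and only the factor x₂ - x₄ is ever shifted; the other
-- factors enter through second moments, where the Sidon property replaces the usual loss of a power
-- of |A| by a constant. The equation is translation invariant, 1 + 1 + 2 = 1 + 3. This is why
-- smoothing by H moves the argument of T away from 0 only by differences of elements of H. When
-- |A|² is comparable to the order of the group, T(t) is of order |A|³ on average, whereas the
-- trivial solutions number about |A|². Hence an error of a small multiple of |A|³ is affordable.
-- How small it must be is not circular: the density of the set where the smoothed function is large
-- is bounded below uniformly in H, so the count for dense sets fixes the accuracy before H is
-- chosen. Sampling replaces Fourier analysis, and clearing denominators keeps all estimates in the
-- integers.

module Counting where

  -- Inequalities between integers

  open import Data.Integer
    using (ℤ; +_; -[1+_]; 0ℤ; 1ℤ; _+_; _*_; _-_; -_; _≤_; _<_; ∣_∣; +≤+; -≤+; +<+; _≤?_; nonNegative; positive)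
  open import Data.Integer.Properties hiding (_≟_; _≤?_)
  open ℤ-Solver using (solve-∀)

  -- Stands in for linear arithmetic: an inequality is certified by a nonnegative slack and a ring
  -- identity.
  ≤-slack : ∀ {x y} p → 0ℤ ≤ p → x + p ≡ y → x ≤ y
  ≤-slack {x} p 0≤p refl = subst (_≤ x + p) (+-identityʳ x) (+-monoʳ-≤ x 0≤p)

  0≤+ : ∀ {x y} → 0ℤ ≤ x → 0ℤ ≤ y → 0ℤ ≤ x + y
  0≤+ = +-mono-≤

  *-monoˡ : ∀ c {x y} → 0ℤ ≤ c → x ≤ y → c * x ≤ c * y
  *-monoˡ c 0≤c = *-monoˡ-≤-nonNeg c {{nonNegative 0≤c}}

  *-monoʳ : ∀ c {x y} → 0ℤ ≤ c → x ≤ y → x * c ≤ y * c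
  *-monoʳ c 0≤c = *-monoʳ-≤-nonNeg c {{nonNegative 0≤c}}

  0≤* : ∀ {x y} → 0ℤ ≤ x → 0ℤ ≤ y → 0ℤ ≤ x * y
  0≤* {x} {y} 0≤x 0≤y = subst (_≤ x * y) (*-zeroʳ x) (*-monoˡ x 0≤x 0≤y)

  0<* : ∀ {x y} → 0ℤ < x → 0ℤ < y → 0ℤ < x * y
  0<* {x} {y} 0<x 0<y = subst (_< x * y) (*-zeroʳ x) (*-monoˡ-<-pos x {{positive 0<x}} 0<y)

  *-mono : ∀ {a b c d} → 0ℤ ≤ b → 0ℤ ≤ c → a ≤ b → c ≤ d → a * c ≤ b * d
  *-mono {a} {b} {c} {d} 0≤b 0≤c a≤b c≤d = ≤-trans (*-monoʳ c 0≤c a≤b) (*-monoˡ b 0≤b c≤d)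

  0≤sq : ∀ x → 0ℤ ≤ x * x
  0≤sq (+ n) = 0≤* {+ n} (+≤+ z≤n) (+≤+ z≤n)
  0≤sq (-[1+ n ]) = +≤+ z≤n

  cancelˡ : ∀ c {x y} → 0ℤ < c → c * x ≤ c * y → x ≤ y
  cancelˡ c {x} {y} 0<c = *-cancelˡ-≤-pos x y c {{positive 0<c}}

  sq-cancel-≤ : ∀ {x y} → 0ℤ ≤ y → x * x ≤ y * y → x ≤ y
  sq-cancel-≤ {x} {y} 0≤y h with x ≤? y
  ... | yes p = p
  ... | no ¬p = ⊥-elim (<⇒≱ y²<x² h)
    where
    y<x : y < x
    y<x = ≰⇒> ¬p
    0<x : 0ℤ < x
    0<x = ≤-<-trans 0≤y y<x
    y²<x² : y * y < x * x
    y²<x² = ≤-<-trans (*-monoˡ y 0≤y (<⇒≤ y<x)) (*-monoʳ-<-pos x {{positive 0<x}} y<x)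

  abs : ℤ → ℤ
  abs x = + ∣ x ∣

  0≤abs : ∀ x → 0ℤ ≤ abs x
  0≤abs x = +≤+ z≤n

  x≤abs : ∀ x → x ≤ abs x
  x≤abs (+ n) = ≤-refl
  x≤abs (-[1+ n ]) = -≤+

  abs-sq : ∀ x → abs x * abs x ≡ x * x
  abs-sq (+ n) = refl
  abs-sq (-[1+ n ]) = refl

  abs-+ : ∀ x y → abs (x + y) ≤ abs x + abs y
  abs-+ x y = +≤+ (∣i+j∣≤∣i∣+∣j∣ x y)

  abs-neg : ∀ x → abs (- x) ≡ abs x
  abs-neg x = cong +_ (∣-i∣≡∣i∣ x)

  abs-nonneg : ∀ {x} → 0ℤ ≤ x → abs x ≡ x
  abs-nonneg = 0≤i⇒+∣i∣≡i

  -- Finite sums, Cauchy-Schwarz and averaging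

  ∑-cong : ∀ {n} {f g : Fin n → ℤ} → (∀ x → f x ≡ g x) → ∑ f ≡ ∑ g
  ∑-cong = sum-cong-≗

  ∑-mono : ∀ {n} {f g : Fin n → ℤ} → (∀ x → f x ≤ g x) → ∑ f ≤ ∑ g
  ∑-mono {ℕ.zero} h = ≤-refl
  ∑-mono {ℕ.suc n} h = +-mono-≤ (h zero) (∑-mono (λ x → h (suc x)))

  ∑-const : ∀ n c → ∑ {n} (λ _ → c) ≡ + n * c
  ∑-const ℕ.zero c = sym (*-zeroˡ c)
  ∑-const (ℕ.suc n) c = trans (cong (λ y → c + y) (∑-const n c)) (sym (suc-* (+ n) c))

  ∑-zero : ∀ n → ∑ {n} (λ _ → 0ℤ) ≡ 0ℤ
  ∑-zero n = trans (∑-const n 0ℤ) (*-zeroʳ (+ n))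

  ∑-nonneg : ∀ {n} {f : Fin n → ℤ} → (∀ x → 0ℤ ≤ f x) → 0ℤ ≤ ∑ f
  ∑-nonneg {n} {f} h = subst (_≤ ∑ f) (∑-zero n) (∑-mono h)

  ∑-*ˡ : ∀ {n} c (f : Fin n → ℤ) → ∑ (λ x → c * f x) ≡ c * ∑ f
  ∑-*ˡ c f = sym (*-distribˡ-sum c f)

  ∑-*ʳ : ∀ {n} (f : Fin n → ℤ) c → ∑ (λ x → f x * c) ≡ ∑ f * c
  ∑-*ʳ f c = sym (*-distribʳ-sum c f)

  ∑-neg : ∀ {n} (f : Fin n → ℤ) → ∑ (λ x → - f x) ≡ - ∑ f
  ∑-neg {ℕ.zero} f = refl
  ∑-neg {ℕ.suc n} f = trans (cong (λ y → - f zero + y) (∑-neg (λ x → f (suc x)))) (sym (neg-distrib-+ (f zero) _))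

  ∑-minus : ∀ {n} (f g : Fin n → ℤ) → ∑ (λ x → f x - g x) ≡ ∑ f - ∑ g
  ∑-minus f g = trans (∑-distrib-+ f (λ x → - g x)) (cong (λ y → ∑ f + y) (∑-neg g))

  ∑-product : ∀ {m n} (f : Fin m → ℤ) (g : Fin n → ℤ) → ∑ (λ x → ∑ (λ y → f x * g y)) ≡ ∑ f * ∑ g
  ∑-product f g = trans (∑-cong (λ x → ∑-*ˡ (f x) g)) (∑-*ʳ f (∑ g))

  term≤∑ : ∀ {n} {f : Fin n → ℤ} → (∀ x → 0ℤ ≤ f x) → ∀ x → f x ≤ ∑ f
  term≤∑ {f = f} h zero = ≤-slack _ (∑-nonneg (λ x → h (suc x))) refl
  term≤∑ {f = f} h (suc x) = ≤-trans (term≤∑ (λ y → h (suc y)) x)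
    (≤-slack (f zero) (h zero) (+-comm _ (f zero)))

  ∑-abs : ∀ {n} (f : Fin n → ℤ) → abs (∑ f) ≤ ∑ (λ x → abs (f x))
  ∑-abs {ℕ.zero} f = ≤-refl
  ∑-abs {ℕ.suc n} f = ≤-trans (abs-+ (f zero) _) (+-monoʳ-≤ (abs (f zero)) (∑-abs (λ x → f (suc x))))

  -- Lagrange's identity: the double sum of the squares of `f x * g y - f y * g x` is twice the
  -- difference of the two sides.
  cauchy-schwarz : ∀ {n} (f g : Fin n → ℤ) →
    ∑ (λ x → f x * g x) * ∑ (λ x → f x * g x) ≤ ∑ (λ x → f x * f x) * ∑ (λ x → g x * g x)
  cauchy-schwarz {n} f g = cancelˡ (+ 2) (+<+ (ℕ.s≤s z≤n)) (≤-slack _ square≥0 square-expand)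
    where
    F = ∑ (λ x → f x * f x)
    H = ∑ (λ x → g x * g x)
    C = ∑ (λ x → f x * g x)
    square : ℤ
    square = ∑ {n} (λ x → ∑ {n} (λ y → (f x * g y - f y * g x) * (f x * g y - f y * g x)))
    square≥0 : 0ℤ ≤ square
    square≥0 = ∑-nonneg (λ x → ∑-nonneg (λ y → 0≤sq (f x * g y - f y * g x)))
    expand : ∀ a b c d → (a * d - c * b) * (a * d - c * b)
           ≡ ((a * a) * (d * d) + (b * b) * (c * c)) - + 2 * ((a * b) * (c * d))
    expand = solve-∀
    square≡ : square ≡ (F * H + H * F) - + 2 * (C * C)
    square≡ = begin
      square
        ≡⟨ ∑-cong (λ x → ∑-cong (λ y → expand (f x) (g x) (f y) (g y))) ⟩
      ∑ (λ x → ∑ (λ y → (p x y + q x y) - + 2 * r x y))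
        ≡⟨ ∑-cong (λ x → trans (∑-minus (λ y → p x y + q x y) (λ y → + 2 * r x y))
            (cong₂ _-_ (∑-distrib-+ (p x) (q x)) (∑-*ˡ (+ 2) (r x)))) ⟩
      ∑ (λ x → (∑ (p x) + ∑ (q x)) - + 2 * ∑ (r x))
        ≡⟨ trans (∑-minus (λ x → ∑ (p x) + ∑ (q x)) (λ x → + 2 * ∑ (r x)))
            (cong₂ _-_ (∑-distrib-+ (λ x → ∑ (p x)) (λ x → ∑ (q x))) (∑-*ˡ (+ 2) (λ x → ∑ (r x)))) ⟩
      (∑ (λ x → ∑ (p x)) + ∑ (λ x → ∑ (q x))) - + 2 * ∑ (λ x → ∑ (r x))
        ≡⟨ cong₂ (λ u v → u - + 2 * v)
            (cong₂ _+_ (∑-product (λ x → f x * f x) (λ y → g y * g y))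
                       (∑-product (λ x → g x * g x) (λ y → f y * f y)))
            (∑-product (λ x → f x * g x) (λ y → f y * g y)) ⟩
      (F * H + H * F) - + 2 * (C * C) ∎
      where
      open ≡-Reasoning
      p q r : Fin n → Fin n → ℤ
      p x y = (f x * f x) * (g y * g y)
      q x y = (g x * g x) * (f y * f y)
      r x y = (f x * g x) * (f y * g y)
    square-expand : + 2 * (C * C) + square ≡ + 2 * (F * H)
    square-expand = trans (cong (λ y → + 2 * (C * C) + y) square≡) (ring F H (C * C))
      where
      ring : ∀ F H C → + 2 * C + ((F * H + H * F) - + 2 * C) ≡ + 2 * (F * H)
      ring = solve-∀

  ≤-average : ∀ {n} → 0ℤ < + n → (f : Fin n → ℤ) → ∀ c → ∑ f ≤ + n * c → ∃ λ x → f x ≤ c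
  ≤-average {n} 0<n f c h with any? (λ x → f x ≤? c)
  ... | yes p = p
  ... | no ¬p = ⊥-elim (<⇒≱ above h)
    where
    c<f : ∀ x → 1ℤ + c ≤ f x
    c<f x = i<j⇒suc[i]≤j (≰⇒> (λ q → ¬p (x , q)))
    above : + n * c < ∑ f
    above = <-≤-trans
      (*-monoˡ-<-pos (+ n) {{positive 0<n}} (suc[i]≤j⇒i<j ≤-refl))
      (≤-trans (≤-reflexive (sym (∑-const n (1ℤ + c)))) (∑-mono c<f))

  -- Indicator functions

  indicator : ∀ {p} {P : Set p} → Dec P → ℤ
  indicator (yes _) = 1ℤ
  indicator (no _) = 0ℤ

  ∑-δ : ∀ {n} (f : Fin n → ℤ) c → ∑ (λ x → indicator (x ≟ c) * f x) ≡ f c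
  ∑-δ {ℕ.suc n} f zero =
    trans (cong₂ _+_ (*-identityˡ (f zero)) (trans (∑-cong (λ x → *-zeroˡ (f (suc x)))) (∑-zero n)))
          (+-identityʳ (f zero))
  ∑-δ {ℕ.suc n} f (suc c) =
    trans (cong₂ _+_ (*-zeroˡ (f zero)) (trans (∑-cong term) (∑-δ (λ x → f (suc x)) c)))
          (+-identityˡ (f (suc c)))
    where
    term : ∀ x → indicator (suc x ≟ suc c) * f (suc x) ≡ indicator (x ≟ c) * f (suc x)
    term x with x ≟ c
    ... | yes _ = refl
    ... | no _ = refl

  from-indicator : ∀ {p} {P : Set p} (d : Dec P) → indicator d ≡ 1ℤ → P
  from-indicator (yes p) _ = p
  from-indicator (no _) ()

  Ind : ∀ {n} → (Fin n → ℤ) → Set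
  Ind f = ∀ x → f x ≡ 0ℤ ⊎ f x ≡ 1ℤ

  ind-indicator : ∀ {n p} {P : Fin n → Set p} (P? : ∀ x → Dec (P x)) → Ind (λ x → indicator (P? x))
  ind-indicator P? x with P? x
  ... | yes _ = inj₂ refl
  ... | no _ = inj₁ refl

  0≤bit : ∀ {x} → x ≡ 0ℤ ⊎ x ≡ 1ℤ → 0ℤ ≤ x
  0≤bit (inj₁ refl) = ≤-refl
  0≤bit (inj₂ refl) = +≤+ z≤n

  bit≤1 : ∀ {x} → x ≡ 0ℤ ⊎ x ≡ 1ℤ → x ≤ 1ℤ
  bit≤1 (inj₁ refl) = +≤+ z≤n
  bit≤1 (inj₂ refl) = ≤-refl

  bit-sq : ∀ {x} → x ≡ 0ℤ ⊎ x ≡ 1ℤ → x * x ≡ x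
  bit-sq (inj₁ refl) = refl
  bit-sq (inj₂ refl) = refl

  bit-* : ∀ {x y} → x ≡ 0ℤ ⊎ x ≡ 1ℤ → y ≡ 0ℤ ⊎ y ≡ 1ℤ → x * y ≡ 0ℤ ⊎ x * y ≡ 1ℤ
  bit-* (inj₁ refl) _ = inj₁ refl
  bit-* {y = y} (inj₂ refl) (inj₁ refl) = inj₁ refl
  bit-* (inj₂ refl) (inj₂ refl) = inj₂ refl

  bit-*≡1 : ∀ {x y} → x ≡ 0ℤ ⊎ x ≡ 1ℤ → y ≡ 0ℤ ⊎ y ≡ 1ℤ → x * y ≡ 1ℤ → x ≡ 1ℤ × y ≡ 1ℤ
  bit-*≡1 (inj₁ refl) _ ()
  bit-*≡1 (inj₂ refl) (inj₁ refl) ()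
  bit-*≡1 (inj₂ refl) (inj₂ refl) _ = refl , refl

  ∑-ind≤1 : ∀ {n} {f : Fin n → ℤ} → Ind f → (∀ {x y} → f x ≡ 1ℤ → f y ≡ 1ℤ → x ≡ y) → ∑ f ≤ 1ℤ
  ∑-ind≤1 {n} {f} ind unique with any? (λ x → f x ℤₚ.≟ 1ℤ)
  ... | no ¬p = ≤-trans (≤-reflexive (trans (∑-cong zeros) (∑-zero n))) (+≤+ z≤n)
    where
    zeros : ∀ x → f x ≡ 0ℤ
    zeros x with ind x
    ... | inj₁ e = e
    ... | inj₂ e = ⊥-elim (¬p (x , e))
  ... | yes (c , fc≡1) = ≤-trans (∑-mono below) (≤-reflexive (∑-δ (λ _ → 1ℤ) c))
    where
    below : ∀ x → f x ≤ indicator (x ≟ c) * 1ℤ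
    below x with ind x | x ≟ c
    ... | i | yes _ = bit≤1 i
    ... | inj₁ e | no _ = ≤-reflexive e
    ... | inj₂ e | no x≢c = ⊥-elim (x≢c (unique e fc≡1))

  nonzero-bit : ∀ {x} → x ≡ 0ℤ ⊎ x ≡ 1ℤ → x ≢ 0ℤ → x ≡ 1ℤ
  nonzero-bit (inj₁ e) x≢0 = ⊥-elim (x≢0 e)
  nonzero-bit (inj₂ e) _ = e

  ∑-support : ∀ {n} {f : Fin n → ℤ} → ∑ f ≢ 0ℤ → ∃ λ x → f x ≢ 0ℤ
  ∑-support {n} {f} ∑≢0 = search (any? (λ x → ¬? (f x ℤₚ.≟ 0ℤ)))
    where
    search : Dec (∃ λ x → f x ≢ 0ℤ) → ∃ λ x → f x ≢ 0ℤ
    search (yes p) = p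
    search (no ¬p) = ⊥-elim (∑≢0 (trans (∑-cong zeros) (∑-zero n)))
      where
      zeros : ∀ x → f x ≡ 0ℤ
      zeros x = decidable-stable (f x ℤₚ.≟ 0ℤ) (λ fx≢0 → ¬p (x , fx≢0))

  -- Markov's inequality before summation: where `q` exceeds `c`, it pays for the discarded mass
  -- itself. If the sum of `q` is at most half of the left side, `cancel-half` then shows that half
  -- of the mass survives.
  restrict-markov : ∀ {x q c} → x ≡ 0ℤ ⊎ x ≡ 1ℤ → 0ℤ ≤ q → 0ℤ ≤ c → (d : Dec (q ≤ c)) →
    c * x ≤ c * (x * indicator d) + q
  restrict-markov {x} {q} {c} x01 0≤q 0≤c (yes _) =
    ≤-slack q 0≤q (cong (λ u → c * u + q) (sym (*-identityʳ x)))
  restrict-markov {x} {q} {c} x01 0≤q 0≤c (no q≰c) = begin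
    c * x                  ≤⟨ *-monoˡ c 0≤c (bit≤1 x01) ⟩
    c * 1ℤ                 ≡⟨ *-identityʳ c ⟩
    c                      ≤⟨ <⇒≤ (≰⇒> q≰c) ⟩
    q                      ≡⟨ sym (+-identityˡ q) ⟩
    0ℤ + q                 ≡⟨ cong (_+ q) (sym (trans (cong (c *_) (*-zeroʳ x)) (*-zeroʳ c))) ⟩
    c * (x * 0ℤ) + q       ∎
    where open ≤-Reasoning

  cancel-half : ∀ {c x y} → 0ℤ < c → + 2 * c * x ≤ + 2 * c * y + c * x → x ≤ + 2 * y
  cancel-half {c} {x} {y} 0<c h = cancelˡ c 0<c (≤-trans (≤-reflexive (ring₁ c x))
    (≤-trans (+-monoˡ-≤ (- (c * x)) h) (≤-reflexive (ring₂ c x y))))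
    where
    ring₁ : ∀ c x → c * x ≡ + 2 * c * x + - (c * x)
    ring₁ = solve-∀
    ring₂ : ∀ c x y → + 2 * c * y + c * x + - (c * x) ≡ c * (+ 2 * y)
    ring₂ = solve-∀

  -- Constants and the final numerical contradiction

  fifth : ℤ → ℤ → ℤ
  fifth c x = c * (c * (c * (c * (c * x))))

  -- The number of sample points that makes the shifts ε-almost periods for ε = 1 / suc ℓ.
  samples : ℕ → ℕ
  samples ℓ = 8 ℕ.* (ℕ.suc ℓ ℕ.* ℕ.suc ℓ)

  -- The factor 2 pays for discarding atypical shifts by Markov's inequality, the power of 2 for a
  -- pigeonhole over one bit per sample point.
  period-loss : ℕ → ℕ
  period-loss ℓ = 2 ℕ.* 2 ℕ.^ samples ℓ

  -- The loss in the number of solutions in a set of additive energy at least |G|³ / J.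
  dense-loss : ℕ → ℤ
  dense-loss J = + 16 * (+ J * (+ J * + J)) * (+ period-loss (8 ℕ.* J) * + period-loss (8 ℕ.* J))

  0≤dense-loss : ∀ J → 0ℤ ≤ dense-loss J
  0≤dense-loss J = 0≤* (0≤* {+ 16} (+≤+ z≤n) (0≤* 0≤J (0≤sq (+ J)))) (0≤sq (+ period-loss (8 ℕ.* J)))
    where
    0≤J : 0ℤ ≤ + J
    0≤J = +≤+ z≤n

  0<period-loss : ∀ ℓ → 0ℤ < + period-loss ℓ
  0<period-loss ℓ = +<+ (ℕₚ.*-mono-< {0} {2} {0} (ℕ.s≤s z≤n) (ℕₚ.m^n>0 2 (samples ℓ)))

  -- Here `n`, `m`, `η` are the sizes of the group, of the sparse set and of the set of shifts,
  -- while `S` and `F` are the numbers of solutions in the dense model and in the smoothed function.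
  -- Eliminating `S`, `n` and `F` leaves `l m η ≤ A η l + 4 A m η + A l m²`. Each of the three terms
  -- is at most a quarter of `l m η`: the first as `4 A ≤ m`, the second as `l = 16 A`, the third as
  -- `4 A m ≤ η`.
  module Endgame {n m η F S C κ A l : ℤ} (0<n : 0ℤ < n) (0<m : 0ℤ < m) (0<η : 0ℤ < η) (0<A : 0ℤ < A)
    (0≤C : 0ℤ ≤ C) (0≤F : 0ℤ ≤ F) (l≡16A : l ≡ + 16 * A)
    (dense : n * n * (n * n) ≤ C * S)
    (model : fifth (m * η) S ≤ fifth (+ 2 * n) F)
    (smoothed : l * F ≤ η * (η * η) * (η * η) * (l * (m * m) + + 4 * (m * (m * m))) + l * m * (η * (η * η) * η) * (m * (m * m)))
    (n≤κm² : n ≤ κ * (m * m)) (32Cκ≤A : + 32 * C * κ ≤ A) (4A≤m : + 4 * A ≤ m) (4Am≤η : + 4 * A * m ≤ η) where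

    0<l : 0ℤ < l
    0<l = subst (0ℤ <_) (sym l≡16A) (0<* {+ 16} (+<+ (ℕ.s≤s z≤n)) 0<A)

    0≤fifth : ∀ {c x} → 0ℤ ≤ c → 0ℤ ≤ x → 0ℤ ≤ fifth c x
    0≤fifth 0≤c 0≤x = 0≤* 0≤c (0≤* 0≤c (0≤* 0≤c (0≤* 0≤c (0≤* 0≤c 0≤x))))

    eliminate-S : fifth (m * η) 1ℤ ≤ + 32 * C * n * F
    eliminate-S = cancelˡ (n * n * (n * n)) (0<* (0<* 0<n 0<n) (0<* 0<n 0<n)) (begin
      n * n * (n * n) * fifth (m * η) 1ℤ        ≤⟨ *-monoʳ (fifth (m * η) 1ℤ) (0≤fifth (<⇒≤ (0<* 0<m 0<η)) (+≤+ z≤n)) dense ⟩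
      C * S * fifth (m * η) 1ℤ                  ≡⟨ ring₁ C S (m * η) ⟩
      C * fifth (m * η) S                       ≤⟨ *-monoˡ C 0≤C model ⟩
      C * fifth (+ 2 * n) F                     ≡⟨ ring₂ C n F ⟩
      n * n * (n * n) * (+ 32 * C * n * F)      ∎)
      where
      open ≤-Reasoning
      ring₁ : ∀ c s x → c * s * (x * (x * (x * (x * (x * 1ℤ))))) ≡ c * (x * (x * (x * (x * (x * s)))))
      ring₁ = solve-∀
      ring₂ : ∀ c n f → c * (+ 2 * n * (+ 2 * n * (+ 2 * n * (+ 2 * n * (+ 2 * n * f))))) ≡ n * n * (n * n) * (+ 32 * c * n * f)
      ring₂ = solve-∀

    eliminate-n : l * fifth (m * η) 1ℤ ≤ A * (m * m) * (l * F)
    eliminate-n = begin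
      l * fifth (m * η) 1ℤ                 ≤⟨ *-monoˡ l (<⇒≤ 0<l) eliminate-S ⟩
      l * (+ 32 * C * n * F)               ≡⟨ ring₁ l C n F ⟩
      + 32 * C * (l * F) * n               ≤⟨ *-monoˡ (+ 32 * C * (l * F)) (0≤* (0≤* {+ 32} (+≤+ z≤n) 0≤C) 0≤lF) n≤κm² ⟩
      + 32 * C * (l * F) * (κ * (m * m))   ≡⟨ ring₂ C (l * F) κ (m * m) ⟩
      + 32 * C * κ * (m * m * (l * F))     ≤⟨ *-monoʳ (m * m * (l * F)) (0≤* (0≤sq m) 0≤lF) 32Cκ≤A ⟩
      A * (m * m * (l * F))                ≡⟨ sym (*-assoc A (m * m) (l * F)) ⟩
      A * (m * m) * (l * F)                ∎
      where
      open ≤-Reasoning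
      0≤lF : 0ℤ ≤ l * F
      0≤lF = 0≤* (<⇒≤ 0<l) 0≤F
      ring₁ : ∀ l c n f → l * (+ 32 * c * n * f) ≡ + 32 * c * (l * f) * n
      ring₁ = solve-∀
      ring₂ : ∀ c x k y → + 32 * c * x * (k * y) ≡ + 32 * c * k * (y * x)
      ring₂ = solve-∀

    eliminate-F : l * (m * η) ≤ A * η * l + + 4 * A * m * η + A * l * (m * m)
    eliminate-F = cancelˡ (m * m * (m * m) * (η * η * (η * η)))
      (0<* (0<* (0<* 0<m 0<m) (0<* 0<m 0<m)) (0<* (0<* 0<η 0<η) (0<* 0<η 0<η))) (begin
      m * m * (m * m) * (η * η * (η * η)) * (l * (m * η))
        ≡⟨ ring₁ l m η ⟩
      l * fifth (m * η) 1ℤ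
        ≤⟨ eliminate-n ⟩
      A * (m * m) * (l * F)
        ≤⟨ *-monoˡ (A * (m * m)) (0≤* (<⇒≤ 0<A) (0≤sq m)) smoothed ⟩
      A * (m * m) * (η * (η * η) * (η * η) * (l * (m * m) + + 4 * (m * (m * m))) + l * m * (η * (η * η) * η) * (m * (m * m)))
        ≡⟨ ring₂ A m η l ⟩
      m * m * (m * m) * (η * η * (η * η)) * (A * η * l + + 4 * A * m * η + A * l * (m * m)) ∎)
      where
      open ≤-Reasoning
      ring₁ : ∀ l m η → m * m * (m * m) * (η * η * (η * η)) * (l * (m * η))
        ≡ l * (m * η * (m * η * (m * η * (m * η * (m * η * 1ℤ)))))
      ring₁ = solve-∀
      ring₂ : ∀ A m η l →
        A * (m * m) * (η * (η * η) * (η * η) * (l * (m * m) + + 4 * (m * (m * m))) + l * m * (η * (η * η) * η) * (m * (m * m)))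
        ≡ m * m * (m * m) * (η * η * (η * η)) * (A * η * l + + 4 * A * m * η + A * l * (m * m))
      ring₂ = solve-∀

    impossible : ⊥
    impossible = <⇒≱ (0<* 0<l (0<* 0<m 0<η)) (≤-slack
      -- Four times `eliminate-F` plus the bounds for the first and third terms; the remainder
      -- `16 A m η - l m η` vanishes by the choice of `l`.
      (+ 4 * (A * η * l + + 4 * A * m * η + A * l * (m * m) - l * (m * η)) + l * η * (m - + 4 * A) + l * m * (η - + 4 * A * m))
      (0≤+ (0≤+ (0≤* {+ 4} (+≤+ z≤n) (i≤j⇒0≤j-i eliminate-F))
        (0≤* (0≤* (<⇒≤ 0<l) (<⇒≤ 0<η)) (i≤j⇒0≤j-i 4A≤m)))
        (0≤* (0≤* (<⇒≤ 0<l) (<⇒≤ 0<m)) (i≤j⇒0≤j-i 4Am≤η)))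
      (trans (ring A m η l) (trans (cong (λ x → + 16 * A * m * η - x * m * η) l≡16A) (+-inverseʳ (+ 16 * A * m * η)))))
      where
      ring : ∀ A m η l → l * (m * η)
        + (+ 4 * (A * η * l + + 4 * A * m * η + A * l * (m * m) - l * (m * η)) + l * η * (m - + 4 * A) + l * m * (η - + 4 * A * m))
        ≡ + 16 * A * m * η - l * m * η
      ring = solve-∀

  -- The order of choice is `J`, `A`, `L`, `Θ`. `J` governs the energy of a set of density
  -- `1 / (8 κ)` and depends on `κ` alone; `A` absorbs the resulting loss in the count of solutions;
  -- `L` is the precision of the almost periods that beats `A`; `Θ` is the order of the group from
  -- which on everything works. The three lower bounds on `Θ` yield `4 A ≤ m`, `L m ≤ N` and
  -- `4 A m ≤ η`.
  record Constants (κ : ℕ) : Set where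
    field
      A L J Θ : ℕ
      0<A : 0ℤ < + A
      32Cκ≤A : + 32 * dense-loss J * + κ ≤ + A
      L≡ : + 6 * (+ κ * + κ) * (+ 16 * + A * (+ 16 * + A)) ≡ + L
      J≡ : + (8 ℕ.* κ) * + (8 ℕ.* κ) * (+ (8 ℕ.* κ) * + (8 ℕ.* κ)) ≡ + J
      16κA²<Θ : + 16 * + κ * (+ A * + A) < + Θ
      2L²≤Θ : + 2 * (+ L * + L) ≤ + Θ
      32A²K²≤Θ : + 32 * (+ A * + A) * (+ period-loss L * + period-loss L) ≤ + Θ

  upper-bound₃ : ∀ {x y z} → 0ℤ ≤ x → 0ℤ ≤ y → 0ℤ ≤ z → ∃ λ Θ → x < + Θ × y ≤ + Θ × z ≤ + Θ
  upper-bound₃ {x} {y} {z} 0≤x 0≤y 0≤z = ∣ 1ℤ + x + y + z ∣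
    , subst (x <_) (sym Θ≡) (suc[i]≤j⇒i<j (≤-slack (y + z) (0≤+ 0≤y 0≤z) (sym (+-assoc (1ℤ + x) y z))))
    , subst (y ≤_) (sym Θ≡) (≤-slack (1ℤ + x + z) (0≤+ 0≤1+x 0≤z) (ring₁ x y z))
    , subst (z ≤_) (sym Θ≡) (≤-slack (1ℤ + x + y) (0≤+ 0≤1+x 0≤y) (+-comm z (1ℤ + x + y)))
    where
    0≤1+x : 0ℤ ≤ 1ℤ + x
    0≤1+x = 0≤+ {1ℤ} (+≤+ z≤n) 0≤x
    Θ≡ : + ∣ 1ℤ + x + y + z ∣ ≡ 1ℤ + x + y + z
    Θ≡ = 0≤i⇒+∣i∣≡i (0≤+ (0≤+ 0≤1+x 0≤y) 0≤z)
    ring₁ : ∀ x y z → y + (1ℤ + x + z) ≡ 1ℤ + x + y + z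
    ring₁ = solve-∀

  constants : ∀ κ → Constants κ
  constants κ = choose (∣ + (8 ℕ.* κ) * + (8 ℕ.* κ) * (+ (8 ℕ.* κ) * + (8 ℕ.* κ)) ∣ ,
    sym (0≤i⇒+∣i∣≡i (0≤* (0≤sq (+ (8 ℕ.* κ))) (0≤sq (+ (8 ℕ.* κ))))))
    where
    0≤κ : 0ℤ ≤ + κ
    0≤κ = +≤+ z≤n
    -- Each constant is passed on as a variable with its defining equation, so that the later
    -- choices treat it as opaque.
    choose : (∃ λ J → + (8 ℕ.* κ) * + (8 ℕ.* κ) * (+ (8 ℕ.* κ) * + (8 ℕ.* κ)) ≡ + J) → Constants κ
    choose (J , J≡) = with-A (ℕ.suc ∣ + 32 * dense-loss J * + κ ∣) (+<+ (ℕ.s≤s z≤n))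
      (≤-trans (x≤abs (+ 32 * dense-loss J * + κ)) (+≤+ (ℕₚ.n≤1+n ∣ + 32 * dense-loss J * + κ ∣)))
      where
      with-A : ∀ A → 0ℤ < + A → + 32 * dense-loss J * + κ ≤ + A → Constants κ
      with-A A 0<A 32Cκ≤A = with-L (∣ x ∣ , sym (0≤i⇒+∣i∣≡i (0≤* (0≤* {+ 6} (+≤+ z≤n) (0≤sq (+ κ))) (0≤sq (+ 16 * + A)))))
        where
        x = + 6 * (+ κ * + κ) * (+ 16 * + A * (+ 16 * + A))
        with-L : (∃ λ L → x ≡ + L) → Constants κ
        with-L (L , L≡) = record
          { 0<A = 0<A ; 32Cκ≤A = 32Cκ≤A ; L≡ = L≡ ; J≡ = J≡
          ; Θ = proj₁ bound ; 16κA²<Θ = proj₁ (proj₂ bound)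
          ; 2L²≤Θ = proj₁ (proj₂ (proj₂ bound)) ; 32A²K²≤Θ = proj₂ (proj₂ (proj₂ bound)) }
          where
          bound : ∃ λ Θ → + 16 * + κ * (+ A * + A) < + Θ × + 2 * (+ L * + L) ≤ + Θ
            × + 32 * (+ A * + A) * (+ period-loss L * + period-loss L) ≤ + Θ
          bound = upper-bound₃ (0≤* (0≤* {+ 16} (+≤+ z≤n) 0≤κ) (0≤sq (+ A))) (0≤* {+ 2} (+≤+ z≤n) (0≤sq (+ L)))
            (0≤* (0≤* {+ 32} (+≤+ z≤n) (0≤sq (+ A))) (0≤sq (+ period-loss L)))

  -- Deciding identities in abelian groups

  module AbelianGroupSolver {A : Set} {_⊕_ : A → A → A} {0g : A} {⊖_ : A → A}
    (isAbelianGroup : IsAbelianGroup _≡_ _⊕_ 0g ⊖_) where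

    private
      group : AbelianGroup 0ℓ 0ℓ
      group = record { isAbelianGroup = isAbelianGroup }
    open AbelianGroup group using (commutativeMonoid; commutativeSemigroup; identityˡ; identityʳ; inverseʳ)
    open AbelianGroupProperties group using (⁻¹-∙-comm; ε⁻¹≈ε; ⁻¹-involutive)
    open CommutativeSemigroupProperties commutativeSemigroup using (interchange)
    open MonoidMult (CommutativeMonoid.monoid commutativeMonoid) using (×-homo-+) renaming (_×_ to _·ℕ_)

    private
      infixr 8 _·_
      _·_ : ℤ → A → A
      (+ n) · x = n ·ℕ x
      -[1+ n ] · x = ⊖ (ℕ.suc n ·ℕ x)

      ·-⊖ : ∀ m n x → (m ℤ.⊖ n) · x ≡ (m ·ℕ x) ⊕ (⊖ (n ·ℕ x))
      ·-⊖ m ℕ.zero x = sym (trans (cong ((m ·ℕ x) ⊕_) ε⁻¹≈ε) (identityʳ _))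
      ·-⊖ ℕ.zero (ℕ.suc n) x = sym (identityˡ _)
      ·-⊖ (ℕ.suc m) (ℕ.suc n) x = begin
        (ℕ.suc m ℤ.⊖ ℕ.suc n) · x              ≡⟨ cong (_· x) ([1+m]⊖[1+n]≡m⊖n m n) ⟩
        (m ℤ.⊖ n) · x                          ≡⟨ ·-⊖ m n x ⟩
        mx ⊕ (⊖ nx)                            ≡⟨ sym (identityˡ _) ⟩
        0g ⊕ (mx ⊕ (⊖ nx))                     ≡⟨ cong (_⊕ (mx ⊕ (⊖ nx))) (sym (inverseʳ x)) ⟩
        (x ⊕ (⊖ x)) ⊕ (mx ⊕ (⊖ nx))            ≡⟨ interchange x (⊖ x) mx (⊖ nx) ⟩
        (x ⊕ mx) ⊕ ((⊖ x) ⊕ (⊖ nx))            ≡⟨ cong ((x ⊕ mx) ⊕_) (⁻¹-∙-comm x nx) ⟩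
        (x ⊕ mx) ⊕ (⊖ (x ⊕ nx))                ∎
        where
        open ≡-Reasoning
        mx = m ·ℕ x
        nx = n ·ℕ x

      ·-+ : ∀ i j x → (i + j) · x ≡ (i · x) ⊕ (j · x)
      ·-+ (+ m) (+ n) x = ×-homo-+ x m n
      ·-+ (+ m) -[1+ n ] x = ·-⊖ m (ℕ.suc n) x
      ·-+ -[1+ m ] (+ n) x = trans (·-⊖ n (ℕ.suc m) x) (AbelianGroup.comm group _ _)
      ·-+ -[1+ m ] -[1+ n ] x = trans
        (cong ⊖_ (trans (cong (_·ℕ x) (cong ℕ.suc (sym (ℕₚ.+-suc m n)))) (×-homo-+ x (ℕ.suc m) (ℕ.suc n))))
        (sym (⁻¹-∙-comm _ _))

      ·-neg : ∀ i x → (- i) · x ≡ ⊖ (i · x)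
      ·-neg (+ ℕ.zero) x = sym ε⁻¹≈ε
      ·-neg (+ ℕ.suc n) x = refl
      ·-neg -[1+ n ] x = sym (⁻¹-involutive _)

    infixl 6 _:⊕_ _:⊝_

    data Expr (n : ℕ) : Set where
      var : Fin n → Expr n
      _:⊕_ : Expr n → Expr n → Expr n
      :⊖_ : Expr n → Expr n
      :0 : Expr n

    _:⊝_ : ∀ {n} → Expr n → Expr n → Expr n
    e :⊝ e′ = e :⊕ (:⊖ e′)

    private
      ⟦_⟧ : ∀ {n} → Expr n → Vec A n → A
      ⟦ var i ⟧ ρ = Vec.lookup ρ i
      ⟦ e :⊕ e′ ⟧ ρ = ⟦ e ⟧ ρ ⊕ ⟦ e′ ⟧ ρ
      ⟦ :⊖ e ⟧ ρ = ⊖ ⟦ e ⟧ ρ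
      ⟦ :0 ⟧ ρ = 0g

      combination : ∀ {n} → Vec ℤ n → Vec A n → A
      combination [] [] = 0g
      combination (c ∷ cs) (x ∷ xs) = (c · x) ⊕ combination cs xs

      unit : ∀ {n} → Fin n → Vec ℤ n
      unit zero = 1ℤ ∷ Vec.replicate _ 0ℤ
      unit (suc i) = 0ℤ ∷ unit i

      -- The normal form of an expression. It does not mention the group, so the normal forms of two
      -- equal expressions are closed vectors that `refl` identifies.
      coefficients : ∀ {n} → Expr n → Vec ℤ n
      coefficients (var i) = unit i
      coefficients (e :⊕ e′) = Vec.zipWith _+_ (coefficients e) (coefficients e′)
      coefficients (:⊖ e) = Vec.map -_ (coefficients e)
      coefficients :0 = Vec.replicate _ 0ℤ

      combination-0 : ∀ {n} (ρ : Vec A n) → combination (Vec.replicate _ 0ℤ) ρ ≡ 0g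
      combination-0 [] = refl
      combination-0 (x ∷ ρ) = trans (identityˡ _) (combination-0 ρ)

      combination-unit : ∀ {n} i (ρ : Vec A n) → combination (unit i) ρ ≡ Vec.lookup ρ i
      combination-unit zero (x ∷ ρ) = trans (cong₂ _⊕_ (identityʳ x) (combination-0 ρ)) (identityʳ x)
      combination-unit (suc i) (x ∷ ρ) = trans (identityˡ _) (combination-unit i ρ)

      combination-+ : ∀ {n} (cs ds : Vec ℤ n) ρ →
        combination (Vec.zipWith _+_ cs ds) ρ ≡ combination cs ρ ⊕ combination ds ρ
      combination-+ [] [] [] = sym (identityˡ _)
      combination-+ (c ∷ cs) (d ∷ ds) (x ∷ ρ) =
        trans (cong₂ _⊕_ (·-+ c d x) (combination-+ cs ds ρ)) (interchange _ _ _ _)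

      combination-neg : ∀ {n} (cs : Vec ℤ n) ρ → combination (Vec.map -_ cs) ρ ≡ ⊖ combination cs ρ
      combination-neg [] [] = sym ε⁻¹≈ε
      combination-neg (c ∷ cs) (x ∷ ρ) =
        trans (cong₂ _⊕_ (·-neg c x) (combination-neg cs ρ)) (⁻¹-∙-comm _ _)

      ⟦_⇓⟧ : ∀ {n} → Expr n → Vec A n → A
      ⟦ e ⇓⟧ = combination (coefficients e)

      correct : ∀ {n} (e : Expr n) ρ → ⟦ e ⇓⟧ ρ ≡ ⟦ e ⟧ ρ
      correct (var i) ρ = combination-unit i ρ
      correct (e :⊕ e′) ρ = trans (combination-+ (coefficients e) (coefficients e′) ρ)
        (cong₂ _⊕_ (correct e ρ) (correct e′ ρ))
      correct (:⊖ e) ρ = trans (combination-neg (coefficients e) ρ) (cong ⊖_ (correct e ρ))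
      correct :0 ρ = combination-0 ρ

    open import Relation.Binary.Reflection (setoid A) var ⟦_⟧ ⟦_⇓⟧ correct public
      using (solve; _⊜_)

  -- Convolution on a finite abelian group in which 2 and 3 are invertible

  record Group₆ : Set where
    infixl 6 _⊕_ _⊝_
    infix 8 ⊖_
    field
      order : ℕ
      0<order : 0ℤ < + order
    Carrier : Set
    Carrier = Fin order
    field
      _⊕_ : Carrier → Carrier → Carrier
      0g : Carrier
      ⊖_ : Carrier → Carrier
      isAbelianGroup : IsAbelianGroup _≡_ _⊕_ 0g ⊖_
      -- The inverses of doubling and tripling are what is needed: the indicator of the doubles of a
      -- set is its indicator composed with `half`.
      half : Carrier → Carrier
      double-half : ∀ x → half x ⊕ half x ≡ x
      half-double : ∀ x → half (x ⊕ x) ≡ x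
      third : Carrier → Carrier
      triple-third : ∀ x → third x ⊕ third x ⊕ third x ≡ x
      third-triple : ∀ x → third (x ⊕ x ⊕ x) ≡ x
    _⊝_ : Carrier → Carrier → Carrier
    x ⊝ y = x ⊕ (⊖ y)

  module Convolution (𝔾 : Group₆) where

    open Group₆ 𝔾 public renaming (Carrier to G)
    open AbelianGroupSolver isAbelianGroup public

    N : ℤ
    N = + order

    0<N : 0ℤ < N
    0<N = 0<order

    record Automorphism : Set where
      field
        to from : G → G
        to-from : ∀ x → to (from x) ≡ x
        from-to : ∀ x → from (to x) ≡ x
        to-⊕ : ∀ x y → to (x ⊕ y) ≡ to x ⊕ to y

      to-⊝ : ∀ x y → to (x ⊝ y) ≡ to x ⊝ to y
      to-⊝ x y = begin
        to (x ⊝ y)                   ≡⟨ solve 2 (λ a b → a ⊜ a :⊕ b :⊝ b) refl (to (x ⊝ y)) (to y) ⟩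
        to (x ⊝ y) ⊕ to y ⊝ to y     ≡⟨ cong (_⊝ to y) (sym (to-⊕ (x ⊝ y) y)) ⟩
        to (x ⊝ y ⊕ y) ⊝ to y        ≡⟨ cong (λ u → to u ⊝ to y) (solve 2 (λ a b → a :⊝ b :⊕ b ⊜ a) refl x y) ⟩
        to x ⊝ to y                  ∎
        where open ≡-Reasoning

    negation : Automorphism
    negation = record
      { to = ⊖_ ; from = ⊖_ ; to-from = invol ; from-to = invol
      ; to-⊕ = solve 2 (λ a b → :⊖ (a :⊕ b) ⊜ (:⊖ a) :⊕ (:⊖ b)) refl }
      where
      invol : ∀ x → ⊖ (⊖ x) ≡ x
      invol = solve 1 (λ a → :⊖ (:⊖ a) ⊜ a) refl

    halving : Automorphism
    halving = record
      { to = half ; from = λ x → x ⊕ x ; to-from = half-double ; from-to = double-half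
      ; to-⊕ = λ x y → trans
          (cong half (trans (sym (cong₂ _⊕_ (double-half x) (double-half y)))
            (solve 2 (λ a b → (a :⊕ a) :⊕ (b :⊕ b) ⊜ (a :⊕ b) :⊕ (a :⊕ b)) refl (half x) (half y))))
          (half-double (half x ⊕ half y)) }

    thirding : Automorphism
    thirding = record
      { to = third ; from = λ x → x ⊕ x ⊕ x ; to-from = third-triple ; from-to = triple-third
      ; to-⊕ = λ x y → trans
          (cong third (trans (sym (cong₂ _⊕_ (triple-third x) (triple-third y)))
            (solve 2 (λ a b → (a :⊕ a :⊕ a) :⊕ (b :⊕ b :⊕ b) ⊜ (a :⊕ b) :⊕ (a :⊕ b) :⊕ (a :⊕ b))
              refl (third x) (third y))))
          (third-triple (third x ⊕ third y)) }

    ∑-bijection : ∀ (to from : G → G) → (∀ x → to (from x) ≡ x) → (∀ x → from (to x) ≡ x) →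
      ∀ f → ∑ (λ x → f (to x)) ≡ ∑ f
    ∑-bijection to from to-from from-to f = sym (sum-permute f (permutation to from to-from from-to))

    ∑-shift : ∀ (f : G → ℤ) h → ∑ (λ x → f (x ⊕ h)) ≡ ∑ f
    ∑-shift f h = ∑-bijection (_⊕ h) (_⊝ h)
      (λ x → solve 2 (λ a b → a :⊝ b :⊕ b ⊜ a) refl x h)
      (λ x → solve 2 (λ a b → a :⊕ b :⊝ b ⊜ a) refl x h) f

    ∑-reflect : ∀ (f : G → ℤ) c → ∑ (λ x → f (c ⊝ x)) ≡ ∑ f
    ∑-reflect f c = ∑-bijection (c ⊝_) (c ⊝_) c-c- c-c- f
      where
      c-c- : ∀ x → c ⊝ (c ⊝ x) ≡ x
      c-c- x = solve 2 (λ a b → a :⊝ (a :⊝ b) ⊜ b) refl c x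

    module _ (φ : Automorphism) where
      open Automorphism φ

      ∑-dilate : ∀ (f : G → ℤ) → ∑ (λ x → f (to x)) ≡ ∑ f
      ∑-dilate = ∑-bijection to from to-from from-to

    dilate : Automorphism → (G → ℤ) → G → ℤ
    dilate φ f x = f (Automorphism.to φ x)

    infixl 7 _⋆_

    _⋆_ : (G → ℤ) → (G → ℤ) → G → ℤ
    (f ⋆ g) t = ∑ (λ x → f x * g (t ⊝ x))

    ⋆-cong : ∀ {f f′ g g′} → f ≗ f′ → g ≗ g′ → f ⋆ g ≗ f′ ⋆ g′
    ⋆-cong p q t = ∑-cong (λ x → cong₂ _*_ (p x) (q (t ⊝ x)))

    ⋆-comm : ∀ f g → f ⋆ g ≗ g ⋆ f
    ⋆-comm f g t = trans
      (sym (∑-reflect (λ x → f x * g (t ⊝ x)) t))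
      (∑-cong (λ x → trans
        (cong (λ u → f (t ⊝ x) * g u) (solve 2 (λ a b → a :⊝ (a :⊝ b) ⊜ b) refl t x))
        (*-comm (f (t ⊝ x)) (g x))))

    ⋆-assoc : ∀ f g h → (f ⋆ g) ⋆ h ≗ f ⋆ (g ⋆ h)
    ⋆-assoc f g h t = begin
      ∑ (λ x → ∑ (λ y → f y * g (x ⊝ y)) * h (t ⊝ x))
        ≡⟨ ∑-cong (λ x → sym (∑-*ʳ (λ y → f y * g (x ⊝ y)) (h (t ⊝ x)))) ⟩
      ∑ (λ x → ∑ (λ y → f y * g (x ⊝ y) * h (t ⊝ x)))
        ≡⟨ ∑-comm (λ x y → f y * g (x ⊝ y) * h (t ⊝ x)) ⟩
      ∑ (λ y → ∑ (λ x → f y * g (x ⊝ y) * h (t ⊝ x)))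
        ≡⟨ ∑-cong (λ y → sym (∑-shift (λ x → f y * g (x ⊝ y) * h (t ⊝ x)) y)) ⟩
      ∑ (λ y → ∑ (λ x → f y * g (x ⊕ y ⊝ y) * h (t ⊝ (x ⊕ y))))
        ≡⟨ ∑-cong (λ y → ∑-cong (λ x → trans
             (cong₂ (λ u v → f y * g u * h v)
               (solve 2 (λ a b → a :⊕ b :⊝ b ⊜ a) refl x y)
               (solve 3 (λ a b c → c :⊝ (a :⊕ b) ⊜ c :⊝ b :⊝ a) refl x y t))
             (*-assoc (f y) (g x) (h (t ⊝ y ⊝ x))))) ⟩
      ∑ (λ y → ∑ (λ x → f y * (g x * h (t ⊝ y ⊝ x))))
        ≡⟨ ∑-cong (λ y → ∑-*ˡ (f y) (λ x → g x * h (t ⊝ y ⊝ x))) ⟩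
      ∑ (λ y → f y * ∑ (λ x → g x * h (t ⊝ y ⊝ x))) ∎
      where open ≡-Reasoning

    -- Supplies the interchange law, which makes `auto`, `w` and `v` multiplicative under
    -- convolution.
    ⋆-commutativeSemigroup : CommutativeSemigroup 0ℓ 0ℓ
    ⋆-commutativeSemigroup = record
      { Carrier = G → ℤ ; _≈_ = _≗_ ; _∙_ = _⋆_
      ; isCommutativeSemigroup = record
        { isSemigroup = record
          { isMagma = record
            { isEquivalence = record
              { refl = λ _ → refl ; sym = λ p x → sym (p x) ; trans = λ p q x → trans (p x) (q x) }
            ; ∙-cong = ⋆-cong }
          ; assoc = ⋆-assoc }
        ; comm = ⋆-comm } }

    open CommutativeSemigroupProperties ⋆-commutativeSemigroup public
      using () renaming (interchange to ⋆-interchange)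

    ∑-⋆ : ∀ f g → ∑ (f ⋆ g) ≡ ∑ f * ∑ g
    ∑-⋆ f g = begin
      ∑ (λ t → ∑ (λ x → f x * g (t ⊝ x)))  ≡⟨ ∑-comm (λ t x → f x * g (t ⊝ x)) ⟩
      ∑ (λ x → ∑ (λ t → f x * g (t ⊝ x)))  ≡⟨ ∑-cong (λ x → ∑-shift (λ t → f x * g t) (⊖ x)) ⟩
      ∑ (λ x → ∑ (λ t → f x * g t))        ≡⟨ ∑-product f g ⟩
      ∑ f * ∑ g                            ∎
      where open ≡-Reasoning

    ⋆-dilate : ∀ φ f g → dilate φ (f ⋆ g) ≗ dilate φ f ⋆ dilate φ g
    ⋆-dilate φ f g t = trans
      (sym (∑-dilate φ (λ x → f x * g (to t ⊝ x))))
      (∑-cong (λ x → cong (λ u → f (to x) * g u) (sym (to-⊝ t x))))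
      where open Automorphism φ

    ⋆-nonneg : ∀ {f g} → (∀ x → 0ℤ ≤ f x) → (∀ x → 0ℤ ≤ g x) → ∀ t → 0ℤ ≤ (f ⋆ g) t
    ⋆-nonneg p q t = ∑-nonneg (λ x → 0≤* (p x) (q (t ⊝ x)))

    ⋆-monoʳ : ∀ {f g g′} → (∀ x → 0ℤ ≤ f x) → (∀ x → g x ≤ g′ x) → ∀ t → (f ⋆ g) t ≤ (f ⋆ g′) t
    ⋆-monoʳ {f} p q t = ∑-mono (λ x → *-monoˡ (f x) (p x) (q (t ⊝ x)))

    ⋆-monoˡ : ∀ {f f′ g} → (∀ x → 0ℤ ≤ g x) → (∀ x → f x ≤ f′ x) → ∀ t → (f ⋆ g) t ≤ (f′ ⋆ g) t
    ⋆-monoˡ {g = g} p q t = ∑-mono (λ x → *-monoʳ (g (t ⊝ x)) (p (t ⊝ x)) (q x))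

    ⋆-mono : ∀ {f f′ g g′} → (∀ x → 0ℤ ≤ f x) → (∀ x → 0ℤ ≤ g x) →
      (∀ x → f x ≤ f′ x) → (∀ x → g x ≤ g′ x) → ∀ t → (f ⋆ g) t ≤ (f′ ⋆ g′) t
    ⋆-mono 0≤f 0≤g f≤f′ g≤g′ t =
      ≤-trans (⋆-monoˡ 0≤g f≤f′ t) (⋆-monoʳ (λ x → ≤-trans (0≤f x) (f≤f′ x)) g≤g′ t)

    ⋆-≤ : ∀ {f g c} → (∀ x → 0ℤ ≤ f x) → (∀ x → g x ≤ c) → ∀ t → (f ⋆ g) t ≤ ∑ f * c
    ⋆-≤ {f} {g} {c} 0≤f g≤c t =
      ≤-trans (∑-mono (λ x → *-monoˡ (f x) (0≤f x) (g≤c (t ⊝ x)))) (≤-reflexive (∑-*ʳ f c))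

    ⋆-*ʳ : ∀ c f g → f ⋆ (λ x → c * g x) ≗ λ t → c * (f ⋆ g) t
    ⋆-*ʳ c f g t = trans (∑-cong (λ x → ring (f x) c (g (t ⊝ x)))) (∑-*ˡ c (λ x → f x * g (t ⊝ x)))
      where
      ring : ∀ a c b → a * (c * b) ≡ c * (a * b)
      ring = solve-∀

    ⋆-*ˡ : ∀ c f g → (λ x → c * f x) ⋆ g ≗ λ t → c * (f ⋆ g) t
    ⋆-*ˡ c f g t = trans (∑-cong (λ x → *-assoc c (f x) (g (t ⊝ x)))) (∑-*ˡ c (λ x → f x * g (t ⊝ x)))

    ⋆-minusʳ : ∀ f g h → f ⋆ (λ x → g x - h x) ≗ λ t → (f ⋆ g) t - (f ⋆ h) t
    ⋆-minusʳ f g h t = trans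
      (∑-cong (λ x → ring (f x) (g (t ⊝ x)) (h (t ⊝ x))))
      (∑-minus (λ x → f x * g (t ⊝ x)) (λ x → f x * h (t ⊝ x)))
      where
      ring : ∀ a b c → a * (b - c) ≡ a * b - a * c
      ring = solve-∀

    shift : G → (G → ℤ) → G → ℤ
    shift h f x = f (x ⊕ h)

    ⋆-shiftʳ : ∀ h f g → f ⋆ shift h g ≗ shift h (f ⋆ g)
    ⋆-shiftʳ h f g t = ∑-cong (λ x → cong (λ u → f x * g u)
      (solve 3 (λ a b c → a :⊝ b :⊕ c ⊜ a :⊕ c :⊝ b) refl t x h))

    reverse : (G → ℤ) → G → ℤ
    reverse = dilate negation

    -- The autocorrelation: for an indicator it counts representations as a difference.
    auto : (G → ℤ) → G → ℤ
    auto f = f ⋆ reverse f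

    auto-expand : ∀ f t → auto f t ≡ ∑ (λ x → f x * f (x ⊝ t))
    auto-expand f t = ∑-cong (λ x → cong (λ u → f x * f u)
      (solve 2 (λ a b → :⊖ (b :⊝ a) ⊜ a :⊝ b) refl x t))

    -- Almost periods

    module Sampling (f : G → G → G → ℤ) where

      total : G → G → ℤ
      total p t = ∑ (f p t)

      -- The error of the sampled sum against `M` times the mean, scaled by `N` to stay integral.
      deviation : ∀ {M} → Vec G M → G → G → ℤ
      deviation [] p t = 0ℤ
      deviation (v ∷ vs) p t = deviation vs p t + (N * f p t v - total p t)

      variance : ∀ {M} → Vec G M → ℤ
      variance vs = ∑ (λ p → ∑ (λ t → deviation vs p t * deviation vs p t))

      -- The numbers `N * f p t v - total p t` sum to zero over `v`, so the cross term with `E`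
      -- disappears and variances add. The slack is `N` times the square of `total p t`.
      ∑-squares : ∀ E p t →
        ∑ (λ v → (E + (N * f p t v - total p t)) * (E + (N * f p t v - total p t)))
        ≤ N * (E * E) + N * N * ∑ (λ v → f p t v * f p t v)
      ∑-squares E p t = ≤-slack (N * (R * R)) (0≤* {N} (+≤+ z≤n) (0≤sq R)) (begin
        ∑ (λ v → (E + (N * f p t v - R)) * (E + (N * f p t v - R))) + N * (R * R)
          ≡⟨ cong (λ u → u + N * (R * R)) (trans (∑-cong (λ v → expand E N (f p t v) R))
              (trans (∑-distrib-+ (λ v → (E - R) * (E - R) + b * f p t v) (λ v → N * N * (f p t v * f p t v)))
                (cong₂ _+_ (trans (∑-distrib-+ (λ _ → (E - R) * (E - R)) (λ v → b * f p t v))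
                                  (cong₂ _+_ (∑-const order ((E - R) * (E - R))) (∑-*ˡ b (f p t))))
                           (∑-*ˡ (N * N) (λ v → f p t v * f p t v))))) ⟩
        N * ((E - R) * (E - R)) + b * R + N * N * F + N * (R * R)
          ≡⟨ collect E N R F ⟩
        N * (E * E) + N * N * F ∎)
        where
        open ≡-Reasoning
        R = total p t
        F = ∑ (λ v → f p t v * f p t v)
        b = + 2 * N * (E - R)
        expand : ∀ E N x R → (E + (N * x - R)) * (E + (N * x - R))
          ≡ (E - R) * (E - R) + + 2 * N * (E - R) * x + N * N * (x * x)
        expand = solve-∀
        collect : ∀ E N R F → N * ((E - R) * (E - R)) + + 2 * N * (E - R) * R + N * N * F + N * (R * R)
          ≡ N * (E * E) + N * N * F
        collect = solve-∀

      -- The second moment method without probability: some choice of the next sample point is no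
      -- worse than the average one.
      sample-step : ∀ {M B} → ∑ (λ p → ∑ (λ t → ∑ (λ v → f p t v * f p t v))) ≤ B →
        ∀ (vs : Vec G M) → ∃ λ v → variance (v ∷ vs) ≤ variance vs + N * B
      sample-step {B = B} bound vs = ≤-average 0<N (λ v → variance (v ∷ vs)) (variance vs + N * B) (begin
        ∑ (λ v → ∑ (λ p → ∑ (λ t → sq p t v)))
          ≡⟨ trans (∑-comm (λ v p → ∑ (λ t → sq p t v))) (∑-cong (λ p → ∑-comm (λ v t → sq p t v))) ⟩
        ∑ (λ p → ∑ (λ t → ∑ (λ v → sq p t v)))
          ≤⟨ ∑-mono (λ p → ∑-mono (λ t → ∑-squares (deviation vs p t) p t)) ⟩
        ∑ (λ p → ∑ (λ t → N * d p t + N * N * F p t))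
          ≡⟨ trans (∑-cong (λ p → trans (∑-distrib-+ (λ t → N * d p t) (λ t → N * N * F p t))
                     (cong₂ _+_ (∑-*ˡ N (d p)) (∑-*ˡ (N * N) (F p)))))
              (trans (∑-distrib-+ (λ p → N * ∑ (d p)) (λ p → N * N * ∑ (F p)))
                     (cong₂ _+_ (∑-*ˡ N (λ p → ∑ (d p))) (∑-*ˡ (N * N) (λ p → ∑ (F p))))) ⟩
        N * variance vs + N * N * ∑ (λ p → ∑ (F p))
          ≤⟨ +-monoʳ-≤ (N * variance vs) (*-monoˡ (N * N) (0≤sq N) bound) ⟩
        N * variance vs + N * N * B
          ≡⟨ collect N (variance vs) B ⟩
        N * (variance vs + N * B) ∎)
        where
        open ≤-Reasoning
        sq : G → G → G → ℤ
        sq p t v = (deviation vs p t + (N * f p t v - total p t)) * (deviation vs p t + (N * f p t v - total p t))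
        d F : G → G → ℤ
        d p t = deviation vs p t * deviation vs p t
        F p t = ∑ (λ v → f p t v * f p t v)
        collect : ∀ N V B → N * V + N * N * B ≡ N * (V + N * B)
        collect = solve-∀

      sample : ∀ {B} → ∑ (λ p → ∑ (λ t → ∑ (λ v → f p t v * f p t v))) ≤ B →
        ∀ M → ∃ λ (vs : Vec G M) → variance vs ≤ + M * (N * B)
      sample {B} bound ℕ.zero = [] , (begin
        ∑ {order} (λ p → ∑ {order} (λ t → 0ℤ))       ≡⟨ ∑-cong {order} (λ p → ∑-zero order) ⟩
        ∑ {order} (λ p → 0ℤ)                         ≡⟨ ∑-zero order ⟩
        0ℤ                                           ≡⟨ sym (*-zeroˡ (N * B)) ⟩
        0ℤ * (N * B)                                 ∎)
        where open ≤-Reasoning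
      sample {B} bound (ℕ.suc M) = proj₁ next ∷ proj₁ previous , (begin
        variance (proj₁ next ∷ proj₁ previous)       ≤⟨ proj₂ next ⟩
        variance (proj₁ previous) + N * B            ≤⟨ +-monoˡ-≤ (N * B) (proj₂ previous) ⟩
        + M * (N * B) + N * B                        ≡⟨ +-comm (+ M * (N * B)) (N * B) ⟩
        N * B + + M * (N * B)                        ≡⟨ sym (suc-* (+ M) (N * B)) ⟩
        + ℕ.suc M * (N * B)                          ∎)
        where
        open ≤-Reasoning
        previous = sample bound M
        next = sample-step bound (proj₁ previous)

      -- Either side is `N` times the sum of `f` over the sample.
      deviation-agree : ∀ {M} (vs : Vec G M) {p p′} t → All (λ v → f p t v ≡ f p′ t v) vs →
        deviation vs p t + + M * total p t ≡ deviation vs p′ t + + M * total p′ t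
      deviation-agree [] {p} {p′} t [] = trans (cong (λ u → 0ℤ + u) (*-zeroˡ (total p t)))
        (cong (λ u → 0ℤ + u) (sym (*-zeroˡ (total p′ t))))
      deviation-agree {ℕ.suc M} (v ∷ vs) {p} {p′} t (e ∷ es) = begin
        deviation vs p t + (N * f p t v - total p t) + + ℕ.suc M * total p t
          ≡⟨ cong (λ u → deviation vs p t + (N * f p t v - total p t) + u) (suc-* (+ M) (total p t)) ⟩
        deviation vs p t + (N * f p t v - total p t) + (total p t + + M * total p t)
          ≡⟨ cancel (deviation vs p t) (N * f p t v) (total p t) (+ M) ⟩
        deviation vs p t + + M * total p t + N * f p t v
          ≡⟨ cong₂ (λ u w → u + N * w) (deviation-agree vs t es) e ⟩
        deviation vs p′ t + + M * total p′ t + N * f p′ t v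
          ≡⟨ sym (cancel (deviation vs p′ t) (N * f p′ t v) (total p′ t) (+ M)) ⟩
        deviation vs p′ t + (N * f p′ t v - total p′ t) + (total p′ t + + M * total p′ t)
          ≡⟨ cong (λ u → deviation vs p′ t + (N * f p′ t v - total p′ t) + u) (sym (suc-* (+ M) (total p′ t))) ⟩
        deviation vs p′ t + (N * f p′ t v - total p′ t) + + ℕ.suc M * total p′ t ∎
        where
        open ≡-Reasoning
        cancel : ∀ d n r m → d + (n - r) + (r + m * r) ≡ d + m * r + n
        cancel = solve-∀

    _⊆_ : (G → ℤ) → (G → ℤ) → Set
    P ⊆ X = ∀ {x} → P x ≡ 1ℤ → X x ≡ 1ℤ

    ind-restrict : ∀ {X g : G → ℤ} → Ind X → Ind g → Ind (λ x → X x * g x)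
    ind-restrict X01 g01 x = bit-* (X01 x) (g01 x)

    ind-complement : ∀ {g : G → ℤ} → Ind g → Ind (λ x → 1ℤ - g x)
    ind-complement {g} g01 x with g01 x
    ... | inj₁ e = inj₂ (cong (λ u → 1ℤ - u) e)
    ... | inj₂ e = inj₁ (cong (λ u → 1ℤ - u) e)

    agreeing-half : ∀ {X g : G → ℤ} → Ind X → Ind g →
      ∃ λ P → Ind P × P ⊆ X × ∑ X ≤ + 2 * ∑ P × (∀ {p p′} → P p ≡ 1ℤ → P p′ ≡ 1ℤ → g p ≡ g p′)
    agreeing-half {X} {g} X01 g01 = choose (≤-total (∑ X₀) (∑ X₁))
      where
      X₁ X₀ : G → ℤ
      X₁ x = X x * g x
      X₀ x = X x * (1ℤ - g x)
      split : ∑ X ≡ ∑ X₀ + ∑ X₁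
      split = trans (∑-cong (λ x → ring (X x) (g x))) (∑-distrib-+ X₀ X₁)
        where
        ring : ∀ a b → a ≡ a * (1ℤ - b) + a * b
        ring = solve-∀
      double : ∀ a → a + a ≡ + 2 * a
      double = solve-∀
      g≡1 : ∀ {p} → X₁ p ≡ 1ℤ → g p ≡ 1ℤ
      g≡1 {p} e = proj₂ (bit-*≡1 (X01 p) (g01 p) e)
      g≡0 : ∀ {p} → X₀ p ≡ 1ℤ → g p ≡ 0ℤ
      g≡0 {p} e with g01 p
      ... | inj₁ e′ = e′
      ... | inj₂ e′ with trans (sym (trans (cong (λ u → X p * (1ℤ - u)) e′) (*-zeroʳ (X p)))) e
      ...   | ()
      choose : ∑ X₀ ≤ ∑ X₁ ⊎ ∑ X₁ ≤ ∑ X₀ →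
        ∃ λ P → Ind P × P ⊆ X × ∑ X ≤ + 2 * ∑ P × (∀ {p p′} → P p ≡ 1ℤ → P p′ ≡ 1ℤ → g p ≡ g p′)
      choose (inj₁ h) = X₁ , ind-restrict X01 g01
        , (λ {x} e → proj₁ (bit-*≡1 (X01 x) (g01 x) e))
        , ≤-trans (≤-reflexive split) (≤-trans (+-monoˡ-≤ (∑ X₁) h) (≤-reflexive (double (∑ X₁))))
        , λ e e′ → trans (g≡1 e) (sym (g≡1 e′))
      choose (inj₂ h) = X₀ , ind-restrict X01 (ind-complement g01)
        , (λ {x} e → proj₁ (bit-*≡1 (X01 x) (ind-complement g01 x) e))
        , ≤-trans (≤-reflexive split) (≤-trans (+-monoʳ-≤ (∑ X₀) h) (≤-reflexive (double (∑ X₀))))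
        , λ e e′ → trans (g≡0 e) (sym (g≡0 e′))

    pigeonhole : ∀ {M} (b : G → G → ℤ) → (∀ v → Ind (b v)) → (vs : Vec G M) → ∀ {X : G → ℤ} → Ind X →
      ∃ λ P → Ind P × P ⊆ X × ∑ X ≤ + (2 ℕ.^ M) * ∑ P ×
        (∀ {p p′} → P p ≡ 1ℤ → P p′ ≡ 1ℤ → All (λ v → b v p ≡ b v p′) vs)
    pigeonhole b b01 [] {X} X01 = X , X01 , (λ e → e) , ≤-reflexive (sym (*-identityˡ (∑ X))) , λ _ _ → []
    pigeonhole {ℕ.suc M} b b01 (v ∷ vs) {X} X01 with agreeing-half X01 (b01 v)
    ... | Y , Y01 , Y⊆X , Y-large , Y-agree with pigeonhole b b01 vs Y01
    ...   | P , P01 , P⊆Y , P-large , P-agree =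
      P , P01 , (λ e → Y⊆X (P⊆Y e)) , large , λ e e′ → Y-agree (P⊆Y e) (P⊆Y e′) ∷ P-agree e e′
      where
      open ≤-Reasoning
      large : ∑ X ≤ + (2 ℕ.^ ℕ.suc M) * ∑ P
      large = begin
        ∑ X                            ≤⟨ Y-large ⟩
        + 2 * ∑ Y                      ≤⟨ *-monoˡ (+ 2) (+≤+ z≤n) P-large ⟩
        + 2 * (+ (2 ℕ.^ M) * ∑ P)      ≡⟨ sym (*-assoc (+ 2) (+ (2 ℕ.^ M)) (∑ P)) ⟩
        + 2 * + (2 ℕ.^ M) * ∑ P        ≡⟨ cong (_* ∑ P) (sym (pos-* 2 (2 ℕ.^ M))) ⟩
        + (2 ℕ.^ ℕ.suc M) * ∑ P        ∎

    -- The L¹ distance between the autocorrelation and its translate. Its natural scale for an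
    -- indicator is `N * N`, and an almost period makes it a small fraction of that.
    auto-distance : (G → ℤ) → G → ℤ
    auto-distance s h = ∑ (λ t → abs (auto s (t ⊕ h) - auto s t))

    -- A sample point `v` sees the shift `p` only through the bit `s (v ⊕ p)`, for all `t` at once.
    -- So `M` points sort the shifts into `2 ^ M` classes, and within a class the sampled estimates
    -- of `auto s (t ⊕ p)` coincide for every `t`.
    module AlmostPeriods (M : ℕ) (L : ℤ) (0<M : 0ℤ < + M) (M≡8L² : + M ≡ + 8 * (L * L))
      {s X : G → ℤ} (s01 : Ind s) (X01 : Ind X) where

      -- The factor `X p` makes the second moment proportional to `∑ X`, so that half of `X` is
      -- typical however small `X` is.
      f : G → G → G → ℤ
      f p t v = X p * (s (v ⊕ p) * s (v ⊝ t))
      open Sampling f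

      0<MN³ : 0ℤ < + M * (N * (N * N))
      0<MN³ = 0<* 0<M (0<* 0<N (0<* 0<N 0<N))

      energy : ∑ (λ p → ∑ (λ t → ∑ (λ v → f p t v * f p t v))) ≤ N * (N * ∑ X)
      energy = ≤-trans (∑-mono (λ p → ∑-mono (λ t → ∑-mono (λ v → f²≤X p t v)))) (≤-reflexive (begin
        ∑ (λ p → ∑ {order} (λ t → ∑ {order} (λ v → X p)))
          ≡⟨ ∑-cong (λ p → trans (∑-cong {order} (λ t → ∑-const order (X p))) (∑-const order (N * X p))) ⟩
        ∑ (λ p → N * (N * X p))
          ≡⟨ trans (∑-*ˡ N (λ p → N * X p)) (cong (N *_) (∑-*ˡ N X)) ⟩
        N * (N * ∑ X) ∎))
        where
        open ≡-Reasoning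
        f²≤X : ∀ p t v → f p t v * f p t v ≤ X p
        f²≤X p t v = subst (_≤ X p) (sym (bit-sq (bit-* (X01 p) ss)))
          (≤-trans (*-monoˡ (X p) (0≤bit (X01 p)) (bit≤1 ss)) (≤-reflexive (*-identityʳ (X p))))
          where ss = bit-* (s01 (v ⊕ p)) (s01 (v ⊝ t))

      vs : Vec G M
      vs = proj₁ (sample energy M)
      vs-small : variance vs ≤ + M * (N * (N * (N * ∑ X)))
      vs-small = proj₂ (sample energy M)

      Q : G → ℤ
      Q p = ∑ (λ t → deviation vs p t * deviation vs p t)
      -- Twice the bound that `vs-small` gives for the average of `Q` per element of `X`.
      threshold : ℤ
      threshold = + 2 * (+ M * (N * (N * N)))
      typical : ∀ p → Dec (Q p ≤ threshold)
      typical p = Q p ≤? threshold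
      Y : G → ℤ
      Y p = X p * indicator (typical p)
      Y01 : Ind Y
      Y01 = ind-restrict X01 (ind-indicator typical)

      markov : ∀ p → threshold * X p ≤ threshold * Y p + Q p
      markov p = restrict-markov (X01 p) (∑-nonneg (λ t → 0≤sq (deviation vs p t)))
        (0≤* {+ 2} (+≤+ z≤n) (<⇒≤ 0<MN³)) (typical p)

      Y-large : ∑ X ≤ + 2 * ∑ Y
      Y-large = cancel-half 0<MN³ (begin
        threshold * ∑ X                                            ≡⟨ sym (∑-*ˡ threshold X) ⟩
        ∑ (λ p → threshold * X p)                                  ≤⟨ ∑-mono markov ⟩
        ∑ (λ p → threshold * Y p + Q p)                            ≡⟨ ∑-distrib-+ (λ p → threshold * Y p) Q ⟩
        ∑ (λ p → threshold * Y p) + ∑ Q                            ≡⟨ cong (_+ ∑ Q) (∑-*ˡ threshold Y) ⟩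
        threshold * ∑ Y + ∑ Q                                      ≤⟨ +-monoʳ-≤ (threshold * ∑ Y) vs-small ⟩
        threshold * ∑ Y + + M * (N * (N * (N * ∑ X)))              ≡⟨ cong (λ u → threshold * ∑ Y + u) (ring (+ M) N (∑ X)) ⟩
        threshold * ∑ Y + + M * (N * (N * N)) * ∑ X                ∎)
        where
        open ≤-Reasoning
        ring : ∀ m n x → m * (n * (n * (n * x))) ≡ m * (n * (n * n)) * x
        ring = solve-∀

      pigeon = pigeonhole (λ v p → s (v ⊕ p)) (λ v p → s01 (v ⊕ p)) vs Y01
      P : G → ℤ
      P = proj₁ pigeon
      P01 : Ind P
      P01 = proj₁ (proj₂ pigeon)
      P⊆Y : P ⊆ Y
      P⊆Y = proj₁ (proj₂ (proj₂ pigeon))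
      agree : ∀ {p p′} → P p ≡ 1ℤ → P p′ ≡ 1ℤ → All (λ v → s (v ⊕ p) ≡ s (v ⊕ p′)) vs
      agree = proj₂ (proj₂ (proj₂ (proj₂ pigeon)))

      P⊆X : P ⊆ X
      P⊆X {x} e = proj₁ (bit-*≡1 (X01 x) (ind-indicator typical x) (P⊆Y e))

      P-typical : ∀ {p} → P p ≡ 1ℤ → Q p ≤ threshold
      P-typical {p} e = from-indicator (typical p) (proj₂ (bit-*≡1 (X01 p) (ind-indicator typical p) (P⊆Y e)))

      total-auto : ∀ {p} t → P p ≡ 1ℤ → total p t ≡ auto s (t ⊕ p)
      total-auto {p} t e = begin
        ∑ (λ v → X p * (s (v ⊕ p) * s (v ⊝ t)))
          ≡⟨ ∑-cong (λ v → trans (cong (_* (s (v ⊕ p) * s (v ⊝ t))) (P⊆X e)) (*-identityˡ _)) ⟩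
        ∑ (λ v → s (v ⊕ p) * s (v ⊝ t))
          ≡⟨ sym (∑-shift (λ v → s (v ⊕ p) * s (v ⊝ t)) (⊖ p)) ⟩
        ∑ (λ v → s (v ⊝ p ⊕ p) * s (v ⊝ p ⊝ t))
          ≡⟨ ∑-cong (λ v → cong₂ (λ a b → s a * s b)
              (solve 2 (λ v p → v :⊝ p :⊕ p ⊜ v) refl v p)
              (solve 3 (λ v p t → v :⊝ p :⊝ t ⊜ v :⊝ (t :⊕ p)) refl v p t)) ⟩
        ∑ (λ v → s v * s (v ⊝ (t ⊕ p)))
          ≡⟨ sym (auto-expand s (t ⊕ p)) ⟩
        auto s (t ⊕ p) ∎
        where open ≡-Reasoning

      module _ {p p′} (e : P p ≡ 1ℤ) (e′ : P p′ ≡ 1ℤ) where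
        private
          δ : G → ℤ
          δ t = auto s (t ⊕ p) - auto s (t ⊕ p′)

        -- Within a class the sampled sums cancel, so the true values differ only by a difference of
        -- deviations.
        M*δ : ∀ t → + M * δ t ≡ deviation vs p′ t - deviation vs p t
        M*δ t = trans
          (cong₂ (λ a b → + M * (a - b)) (sym (total-auto t e)) (sym (total-auto t e′)))
          (rearrange (deviation vs p t) (deviation vs p′ t) (+ M) (total p t) (total p′ t)
            (deviation-agree vs t (same-f (agree e e′))))
          where
          same-f : ∀ {k} {us : Vec G k} → All (λ v → s (v ⊕ p) ≡ s (v ⊕ p′)) us → All (λ v → f p t v ≡ f p′ t v) us
          same-f [] = []
          same-f {us = v ∷ _} (a ∷ as) =
            cong₂ (λ x y → x * (y * s (v ⊝ t))) (trans (P⊆X e) (sym (P⊆X e′))) a ∷ same-f as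
          rearrange : ∀ d d′ m r r′ → d + m * r ≡ d′ + m * r′ → m * (r - r′) ≡ d′ - d
          rearrange d d′ m r r′ h = trans (ring₁ d m r r′) (trans (cong (λ u → u - d - m * r′) h) (ring₂ d d′ m r′))
            where
            ring₁ : ∀ d m r r′ → m * (r - r′) ≡ d + m * r - d - m * r′
            ring₁ = solve-∀
            ring₂ : ∀ d d′ m r′ → d′ + m * r′ - d - m * r′ ≡ d′ - d
            ring₂ = solve-∀

        -- Two typical deviations give `M² ∑ δ² ≤ 8 M N³`, and `M = 8 L²`.
        L²∑δ² : L * L * ∑ (λ t → δ t * δ t) ≤ N * (N * N)
        L²∑δ² = cancelˡ (+ 8) (+<+ (ℕ.s≤s z≤n)) (subst (_≤ + 8 * (N * (N * N)))
          (trans (cong (_* ∑ (λ t → δ t * δ t)) M≡8L²) (*-assoc (+ 8) (L * L) _))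
          (cancelˡ (+ M) 0<M (begin
            + M * (+ M * ∑ (λ t → δ t * δ t))
              ≡⟨ trans (sym (*-assoc (+ M) (+ M) _)) (sym (∑-*ˡ (+ M * + M) (λ t → δ t * δ t))) ⟩
            ∑ (λ t → + M * + M * (δ t * δ t))
              ≡⟨ ∑-cong (λ t → trans (regroup (+ M) (δ t)) (cong (λ u → u * u) (M*δ t))) ⟩
            ∑ (λ t → (d′ t - d t) * (d′ t - d t))
              ≤⟨ ∑-mono (λ t → ≤-slack _ (0≤sq (d′ t + d t)) (parallelogram (d t) (d′ t))) ⟩
            ∑ (λ t → + 2 * (d t * d t) + + 2 * (d′ t * d′ t))
              ≡⟨ trans (∑-distrib-+ (λ t → + 2 * (d t * d t)) (λ t → + 2 * (d′ t * d′ t)))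
                   (cong₂ _+_ (∑-*ˡ (+ 2) (λ t → d t * d t)) (∑-*ˡ (+ 2) (λ t → d′ t * d′ t))) ⟩
            + 2 * Q p + + 2 * Q p′
              ≤⟨ +-mono-≤ (*-monoˡ (+ 2) (+≤+ z≤n) (P-typical e)) (*-monoˡ (+ 2) (+≤+ z≤n) (P-typical e′)) ⟩
            + 2 * threshold + + 2 * threshold
              ≡⟨ collect (+ M) N ⟩
            + M * (+ 8 * (N * (N * N))) ∎)))
          where
          open ≤-Reasoning
          d d′ : G → ℤ
          d = deviation vs p
          d′ = deviation vs p′
          regroup : ∀ m x → m * m * (x * x) ≡ m * x * (m * x)
          regroup = solve-∀
          parallelogram : ∀ x y → (y - x) * (y - x) + (y + x) * (y + x) ≡ + 2 * (x * x) + + 2 * (y * y)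
          parallelogram = solve-∀
          collect : ∀ m n → + 2 * (+ 2 * (m * (n * (n * n)))) + + 2 * (+ 2 * (m * (n * (n * n)))) ≡ m * (+ 8 * (n * (n * n)))
          collect = solve-∀

        ∑∣δ∣ : ∑ (λ t → abs (δ t)) ≡ auto-distance s (p ⊝ p′)
        ∑∣δ∣ = trans
          (∑-cong (λ t → cong (λ u → abs (auto s u - auto s (t ⊕ p′)))
            (solve 3 (λ t p p′ → t :⊕ p ⊜ t :⊕ p′ :⊕ (p :⊝ p′)) refl t p p′)))
          (∑-shift (λ t → abs (auto s (t ⊕ (p ⊝ p′)) - auto s t)) p′)

        L∑∣δ∣ : L * ∑ (λ t → abs (δ t)) ≤ N * N
        L∑∣δ∣ = sq-cancel-≤ (0≤sq N) (begin
          L * S * (L * S)                                   ≡⟨ regroup L S ⟩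
          L * L * (S * S)                                   ≤⟨ *-monoˡ (L * L) (0≤sq L) S²≤ ⟩
          L * L * (N * ∑ (λ t → δ t * δ t))                 ≡⟨ swap (L * L) N _ ⟩
          N * (L * L * ∑ (λ t → δ t * δ t))                 ≤⟨ *-monoˡ N (+≤+ z≤n) L²∑δ² ⟩
          N * (N * (N * N))                                 ≡⟨ sym (*-assoc N N (N * N)) ⟩
          N * N * (N * N)                                   ∎)
          where
          open ≤-Reasoning
          S = ∑ (λ t → abs (δ t))
          regroup : ∀ a b → a * b * (a * b) ≡ a * a * (b * b)
          regroup = solve-∀
          swap : ∀ a b c → a * (b * c) ≡ b * (a * c)
          swap = solve-∀
          S²≤ : S * S ≤ N * ∑ (λ t → δ t * δ t)
          S²≤ = subst₂ _≤_
            (cong (λ u → u * u) (∑-cong (λ t → *-identityˡ (abs (δ t)))))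
            (cong₂ _*_ (trans (∑-const order 1ℤ) (*-identityʳ N)) (∑-cong (λ t → abs-sq (δ t))))
            (cauchy-schwarz (λ _ → 1ℤ) (λ t → abs (δ t)))

      P-large : ∑ X ≤ + (2 ℕ.* 2 ℕ.^ M) * ∑ P
      P-large = begin
        ∑ X                    ≤⟨ Y-large ⟩
        + 2 * ∑ Y                ≤⟨ *-monoˡ (+ 2) (+≤+ z≤n) (proj₁ (proj₂ (proj₂ (proj₂ pigeon)))) ⟩
        + 2 * (+ (2 ℕ.^ M) * ∑ P)      ≡⟨ sym (*-assoc (+ 2) (+ (2 ℕ.^ M)) (∑ P)) ⟩
        + 2 * + (2 ℕ.^ M) * ∑ P        ≡⟨ cong (_* ∑ P) (sym (pos-* 2 (2 ℕ.^ M))) ⟩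
        + (2 ℕ.* 2 ℕ.^ M) * ∑ P      ∎
        where open ≤-Reasoning

      result : ∃ λ P → Ind P × P ⊆ X × ∑ X ≤ + (2 ℕ.* 2 ℕ.^ M) * ∑ P ×
        (∀ {p p′} → P p ≡ 1ℤ → P p′ ≡ 1ℤ → L * auto-distance s (p ⊝ p′) ≤ N * N)
      result = P , P01 , P⊆X , P-large , λ e e′ → subst (λ u → L * u ≤ N * N) (∑∣δ∣ e e′) (L∑∣δ∣ e e′)

    -- The set `X` is arbitrary because there are two uses: inside the popular elements of a dense
    -- set, and in the whole group.
    almost-periods : ∀ ℓ {s X : G → ℤ} → Ind s → Ind X →
      ∃ λ P → Ind P × P ⊆ X × ∑ X ≤ + period-loss ℓ * ∑ P ×
        (∀ {p p′} → P p ≡ 1ℤ → P p′ ≡ 1ℤ → + ℕ.suc ℓ * auto-distance s (p ⊝ p′) ≤ N * N)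
    almost-periods ℓ = AlmostPeriods.result (samples ℓ) (+ ℕ.suc ℓ) (+<+ (ℕ.s≤s z≤n))
      (trans (pos-* 8 (ℕ.suc ℓ ℕ.* ℕ.suc ℓ)) (cong (+ 8 *_) (pos-* (ℕ.suc ℓ) (ℕ.suc ℓ))))

    -- Solutions in dense sets

    -- w f counts x₁ + x₂ - x₄ and v f counts 2 x₃ - 3 x₅, so that solutions f counts
    -- the solutions of x₁ + x₂ + 2 x₃ = x₄ + 3 x₅ with weight f.
    w v : (G → ℤ) → G → ℤ
    w f = f ⋆ auto f
    v f = dilate halving f ⋆ dilate thirding (reverse f)

    solutions : (G → ℤ) → ℤ
    solutions f = (w f ⋆ v f) 0g

    ∑-reverse : ∀ f → ∑ (reverse f) ≡ ∑ f
    ∑-reverse = ∑-dilate negation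

    ∑-auto : ∀ f → ∑ (auto f) ≡ ∑ f * ∑ f
    ∑-auto f = trans (∑-⋆ f (reverse f)) (cong (λ u → ∑ f * u) (∑-reverse f))

    ∑-v : ∀ f → ∑ (v f) ≡ ∑ f * ∑ f
    ∑-v f = trans (∑-⋆ (dilate halving f) (dilate thirding (reverse f)))
      (cong₂ _*_ (∑-dilate halving f) (trans (∑-dilate thirding (reverse f)) (∑-reverse f)))

    -- Both sides are the additive energy: they count quadruples with `x₁ - x₂ = x₃ - x₄`, weighted
    -- by `f`.
    energy-auto : ∀ f → ∑ (λ x → f x * w f x) ≡ ∑ (λ t → auto f t * auto f t)
    energy-auto f = begin
      ∑ (λ x → f x * (f ⋆ auto f) x)
        ≡⟨ ∑-cong (λ x → cong (λ u → f x * u) (⋆-comm f (auto f) x)) ⟩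
      ∑ (λ x → f x * ∑ (λ t → auto f t * f (x ⊝ t)))
        ≡⟨ ∑-cong (λ x → sym (∑-*ˡ (f x) (λ t → auto f t * f (x ⊝ t)))) ⟩
      ∑ (λ x → ∑ (λ t → f x * (auto f t * f (x ⊝ t))))
        ≡⟨ ∑-comm (λ x t → f x * (auto f t * f (x ⊝ t))) ⟩
      ∑ (λ t → ∑ (λ x → f x * (auto f t * f (x ⊝ t))))
        ≡⟨ ∑-cong (λ t → trans (∑-cong (λ x → swap (f x) (auto f t) (f (x ⊝ t))))
                                (∑-*ˡ (auto f t) (λ x → f x * f (x ⊝ t)))) ⟩
      ∑ (λ t → auto f t * ∑ (λ x → f x * f (x ⊝ t)))
        ≡⟨ ∑-cong (λ t → cong (λ u → auto f t * u) (sym (auto-expand f t))) ⟩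
      ∑ (λ t → auto f t * auto f t) ∎
      where
      open ≡-Reasoning
      swap : ∀ a b c → a * (b * c) ≡ b * (a * c)
      swap = solve-∀

    ∑²≤N∑² : ∀ (f : G → ℤ) → ∑ f * ∑ f ≤ N * ∑ (λ x → f x * f x)
    ∑²≤N∑² f = subst₂ _≤_
      (cong (λ u → u * u) (∑-cong (λ x → *-identityˡ (f x))))
      (cong (_* ∑ (λ x → f x * f x)) (trans (∑-const order 1ℤ) (*-identityʳ N)))
      (cauchy-schwarz (λ _ → 1ℤ) f)

    ∑-ind≤N : ∀ {s : G → ℤ} → Ind s → ∑ s ≤ N
    ∑-ind≤N s01 = ≤-trans (∑-mono (λ x → bit≤1 (s01 x))) (≤-reflexive (trans (∑-const order 1ℤ) (*-identityʳ N)))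

    ind-reverse : ∀ {s : G → ℤ} → Ind s → Ind (reverse s)
    ind-reverse s01 x = s01 (⊖ x)

    0≤auto : ∀ {s} → Ind s → ∀ t → 0ℤ ≤ auto s t
    0≤auto s01 = ⋆-nonneg (λ x → 0≤bit (s01 x)) (λ x → 0≤bit (s01 (⊖ x)))

    0≤w : ∀ {s} → Ind s → ∀ t → 0ℤ ≤ w s t
    0≤w s01 = ⋆-nonneg (λ x → 0≤bit (s01 x)) (0≤auto s01)

    auto≤N : ∀ {s} → Ind s → ∀ t → auto s t ≤ N
    auto≤N {s} s01 t = ≤-trans (⋆-≤ (λ x → 0≤bit (s01 x)) (λ x → bit≤1 (s01 (⊖ x))) t)
      (≤-trans (≤-reflexive (*-identityʳ (∑ s))) (∑-ind≤N s01))

    w≤N² : ∀ {s} → Ind s → ∀ t → w s t ≤ N * N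
    w≤N² {s} s01 t = ≤-trans (⋆-≤ (λ x → 0≤bit (s01 x)) (auto≤N s01) t)
      (*-monoʳ N (<⇒≤ 0<N) (∑-ind≤N s01))

    -- The shift can be moved onto the factor `auto s`, and the weights `s x` are at most 1, so the
    -- L¹ change of `auto s` bounds the change of `w s` at each point.
    w-shift : ∀ {s} → Ind s → ∀ h t → w s t ≤ w s (t ⊕ h) + auto-distance s h
    w-shift {s} s01 h t = ≤-trans (≤-reflexive (add-sub (w s t) (w s (t ⊕ h)))) (+-monoʳ-≤ (w s (t ⊕ h)) (begin
      w s t - w s (t ⊕ h)
        ≡⟨ cong (λ u → w s t - u) (sym (⋆-shiftʳ h s (auto s) t)) ⟩
      (s ⋆ auto s) t - (s ⋆ shift h (auto s)) t
        ≡⟨ sym (⋆-minusʳ s (auto s) (shift h (auto s)) t) ⟩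
      ∑ (λ x → s x * (auto s (t ⊝ x) - auto s (t ⊝ x ⊕ h)))
        ≤⟨ ∑-mono (λ x → term (s x) (s01 x) (auto s (t ⊝ x)) (auto s (t ⊝ x ⊕ h))) ⟩
      ∑ (λ x → abs (auto s (t ⊝ x ⊕ h) - auto s (t ⊝ x)))
        ≡⟨ ∑-reflect (λ y → abs (auto s (y ⊕ h) - auto s y)) t ⟩
      auto-distance s h ∎))
      where
      open ≤-Reasoning
      add-sub : ∀ a b → a ≡ b + (a - b)
      add-sub = solve-∀
      flip : ∀ a b → a - b ≡ - (b - a)
      flip = solve-∀
      term : ∀ x → x ≡ 0ℤ ⊎ x ≡ 1ℤ → ∀ a b → x * (a - b) ≤ abs (b - a)
      term x (inj₁ refl) a b = 0≤abs (b - a)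
      term x (inj₂ refl) a b = begin
        1ℤ * (a - b)       ≡⟨ trans (*-identityˡ (a - b)) (flip a b) ⟩
        - (b - a)          ≤⟨ x≤abs (- (b - a)) ⟩
        abs (- (b - a))    ≡⟨ abs-neg (b - a) ⟩
        abs (b - a)        ∎

    -- Cauchy-Schwarz for `auto s`, whose sum is the square of `∑ s`.
    energy-large : ∀ j {s : G → ℤ} → N ≤ + j * ∑ s →
      N * (N * N) ≤ + j * + j * (+ j * + j) * ∑ (λ x → s x * w s x)
    energy-large j {s} dense = combine {N} {+ j} {∑ s} {∑ (λ x → s x * w s x)} (<⇒≤ 0<N) 0<N (+≤+ z≤n) dense
      (subst₂ (λ a b → a * a ≤ N * b) (∑-auto s) (sym (energy-auto s)) (∑²≤N∑² (auto s)))
      where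
      combine : ∀ {n j σ e} → 0ℤ ≤ n → 0ℤ < n → 0ℤ ≤ j → n ≤ j * σ → σ * σ * (σ * σ) ≤ n * e →
        n * (n * n) ≤ j * j * (j * j) * e
      combine {n} {j} {σ} {e} 0≤n 0<n 0≤j h₁ h₂ = cancelˡ n 0<n (begin
        n * (n * (n * n))                          ≡⟨ sym (*-assoc n n (n * n)) ⟩
        n * n * (n * n)                            ≤⟨ *-mono (0≤sq (j * σ)) (0≤sq n) n²≤ n²≤ ⟩
        j * σ * (j * σ) * (j * σ * (j * σ))        ≡⟨ ring₁ j σ ⟩
        j * j * (j * j) * (σ * σ * (σ * σ))        ≤⟨ *-monoˡ _ (0≤* (0≤sq j) (0≤sq j)) h₂ ⟩
        j * j * (j * j) * (n * e)                  ≡⟨ ring₂ (j * j * (j * j)) n e ⟩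
        n * (j * j * (j * j) * e)                  ∎)
        where
        open ≤-Reasoning
        n²≤ : n * n ≤ j * σ * (j * σ)
        n²≤ = *-mono (≤-trans 0≤n h₁) 0≤n h₁ h₁
        ring₁ : ∀ j σ → j * σ * (j * σ) * (j * σ * (j * σ)) ≡ j * j * (j * j) * (σ * σ * (σ * σ))
        ring₁ = solve-∀
        ring₂ : ∀ a n e → a * (n * e) ≡ n * (a * e)
        ring₂ = solve-∀

    module DenseSolutions (J : ℕ) {s : G → ℤ} (s01 : Ind s)
      (energy : N * (N * N) ≤ + J * ∑ (λ x → s x * w s x)) where

      0≤J : 0ℤ ≤ + J
      0≤J = +≤+ z≤n
      0≤2J : 0ℤ ≤ + 2 * + J
      0≤2J = 0≤* {+ 2} (+≤+ z≤n) 0≤J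
      K : ℤ
      K = + period-loss (8 ℕ.* J)

      -- By `energy` the sum of `w s` over `s` is at least `N³ / J`, and `w s` is at most `N²`.
      -- Points below the threshold `N² / (2 J)` contribute at most half, so at least `N / (2 J)`
      -- points of `s` are popular.
      popular : ∀ x → Dec (N * N ≤ + 2 * + J * w s x)
      popular x = N * N ≤? + 2 * + J * w s x
      S′ : G → ℤ
      S′ x = s x * indicator (popular x)
      S′01 : Ind S′
      S′01 = ind-restrict s01 (ind-indicator popular)

      restrict : ∀ {x ω n² c} → x ≡ 0ℤ ⊎ x ≡ 1ℤ → 0ℤ ≤ ω → ω ≤ n² → 0ℤ ≤ c → (d : Dec (n² ≤ c * ω)) →
        c * (x * ω) ≤ c * n² * (x * indicator d) + n²
      restrict {x} {ω} {n²} {c} (inj₁ refl) 0≤ω ω≤n² 0≤c d =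
        ≤-slack n² (≤-trans 0≤ω ω≤n²) (ring c n² ω (indicator d))
        where
        ring : ∀ c n ω i → c * (0ℤ * ω) + n ≡ c * n * (0ℤ * i) + n
        ring = solve-∀
      restrict {x} {ω} {n²} {c} (inj₂ refl) 0≤ω ω≤n² 0≤c (yes _) =
        ≤-slack (c * (n² - ω) + n²) (0≤+ (0≤* 0≤c (i≤j⇒0≤j-i ω≤n²)) (≤-trans 0≤ω ω≤n²)) (ring c n² ω)
        where
        ring : ∀ c n ω → c * (1ℤ * ω) + (c * (n - ω) + n) ≡ c * n * (1ℤ * 1ℤ) + n
        ring = solve-∀
      restrict {x} {ω} {n²} {c} (inj₂ refl) 0≤ω ω≤n² 0≤c (no ¬p) =
        ≤-slack (n² - c * ω) (i≤j⇒0≤j-i (<⇒≤ (≰⇒> ¬p))) (ring c n² ω)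
        where
        ring : ∀ c n ω → c * (1ℤ * ω) + (n - c * ω) ≡ c * n * (1ℤ * 0ℤ) + n
        ring = solve-∀

      S′-large : N ≤ + 2 * + J * ∑ S′
      S′-large = cancel {N} {+ J} {∑ (λ x → s x * w s x)} {∑ S′} (0<* 0<N 0<N) energy (begin
        + 2 * + J * ∑ (λ x → s x * w s x)
          ≡⟨ sym (∑-*ˡ (+ 2 * + J) (λ x → s x * w s x)) ⟩
        ∑ (λ x → + 2 * + J * (s x * w s x))
          ≤⟨ ∑-mono (λ x → restrict (s01 x) (0≤w s01 x) (w≤N² s01 x) 0≤2J (popular x)) ⟩
        ∑ (λ x → + 2 * + J * (N * N) * S′ x + N * N)
          ≡⟨ trans (∑-distrib-+ (λ x → + 2 * + J * (N * N) * S′ x) (λ _ → N * N))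
               (cong₂ _+_ (∑-*ˡ (+ 2 * + J * (N * N)) S′) (∑-const order (N * N))) ⟩
        + 2 * + J * (N * N) * ∑ S′ + N * (N * N) ∎)
        where
        open ≤-Reasoning
        cancel : ∀ {n j e y} → 0ℤ < n * n → n * (n * n) ≤ j * e → + 2 * j * e ≤ + 2 * j * (n * n) * y + n * (n * n) → n ≤ + 2 * j * y
        cancel {n} {j} {e} {y} 0<n² h₁ h₂ = cancelˡ (n * n) 0<n² (≤-slack
          (+ 2 * (j * e - n * (n * n)) + (+ 2 * j * (n * n) * y + n * (n * n) - + 2 * j * e))
          (0≤+ (0≤* {+ 2} (+≤+ z≤n) (i≤j⇒0≤j-i h₁)) (i≤j⇒0≤j-i h₂)) (ring n j e y))
          where
          ring : ∀ n j e y → n * n * n + (+ 2 * (j * e - n * (n * n)) + (+ 2 * j * (n * n) * y + n * (n * n) - + 2 * j * e))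
            ≡ n * n * (+ 2 * j * y)
          ring = solve-∀

      class : ∃ λ P → Ind P × P ⊆ S′ × ∑ S′ ≤ K * ∑ P ×
        (∀ {p p′} → P p ≡ 1ℤ → P p′ ≡ 1ℤ → + ℕ.suc (8 ℕ.* J) * auto-distance s (p ⊝ p′) ≤ N * N)
      -- Going from `y` to `y + 2 (y - x)` takes two shifts, each costing at most `N² / (8 J)`;
      -- together they use up half of the popularity `N² / (2 J)`.
      class = almost-periods (8 ℕ.* J) s01 S′01

      P : G → ℤ
      P = proj₁ class
      P01 : Ind P
      P01 = proj₁ (proj₂ class)
      P⊆S′ : P ⊆ S′
      P⊆S′ = proj₁ (proj₂ (proj₂ class))
      P⊆s : P ⊆ s
      P⊆s {x} e = proj₁ (bit-*≡1 (s01 x) (ind-indicator popular x) (P⊆S′ e))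

      P-large : N ≤ + 2 * + J * (K * ∑ P)
      P-large = ≤-trans S′-large (*-monoˡ (+ 2 * + J) 0≤2J (proj₁ (proj₂ (proj₂ (proj₂ class)))))

      8J*distance : ∀ {p p′} → P p ≡ 1ℤ → P p′ ≡ 1ℤ → + 8 * + J * auto-distance s (p ⊝ p′) ≤ N * N
      8J*distance {p} {p′} e e′ = ≤-trans
        (*-monoʳ (auto-distance s (p ⊝ p′)) (∑-nonneg (λ t → 0≤abs (auto s (t ⊕ (p ⊝ p′)) - auto s t)))
          (≤-trans (≤-reflexive (sym (pos-* 8 J))) (+≤+ (ℕₚ.n≤1+n (8 ℕ.* J)))))
        (proj₂ (proj₂ (proj₂ (proj₂ class))) e e′)

      w-large : ∀ {x y} → P x ≡ 1ℤ → P y ≡ 1ℤ → N * N ≤ + 4 * + J * w s (y ⊕ (y ⊝ x) ⊕ (y ⊝ x))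
      w-large {x} {y} ex ey = combine
        (from-indicator (popular y) (proj₂ (bit-*≡1 (s01 y) (ind-indicator popular y) (P⊆S′ ey))))
        (w-shift s01 (y ⊝ x) y) (w-shift s01 (y ⊝ x) (y ⊕ (y ⊝ x))) (8J*distance ey ex) 0≤J
        where
        combine : ∀ {n² j a b c d} → n² ≤ + 2 * j * a → a ≤ b + d → b ≤ c + d → + 8 * j * d ≤ n² → 0ℤ ≤ j →
          n² ≤ + 4 * j * c
        combine {n²} {j} {a} {b} {c} {d} h₁ h₂ h₃ h₄ 0≤j = cancelˡ (+ 2) (+<+ (ℕ.s≤s z≤n)) (≤-slack
          (+ 4 * (+ 2 * j * a - n²) + + 8 * (j * (b + d - a)) + + 8 * (j * (c + d - b)) + + 2 * (n² - + 8 * j * d))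
          (0≤+ (0≤+ (0≤+ (0≤* {+ 4} (+≤+ z≤n) (i≤j⇒0≤j-i h₁)) (0≤* {+ 8} (+≤+ z≤n) (0≤* 0≤j (i≤j⇒0≤j-i h₂))))
            (0≤* {+ 8} (+≤+ z≤n) (0≤* 0≤j (i≤j⇒0≤j-i h₃)))) (0≤* {+ 2} (+≤+ z≤n) (i≤j⇒0≤j-i h₄)))
          (ring n² j a b c d))
          where
          ring : ∀ n j a b c d → + 2 * n + (+ 4 * (+ 2 * j * a - n) + + 8 * (j * (b + d - a)) + + 8 * (j * (c + d - b)) + + 2 * (n - + 8 * j * d))
            ≡ + 2 * (+ 4 * j * c)
          ring = solve-∀

      solution-term : ∀ {p q s t ω c n²} → p ≡ 0ℤ ⊎ p ≡ 1ℤ → q ≡ 0ℤ ⊎ q ≡ 1ℤ → 0ℤ ≤ s → 0ℤ ≤ t → 0ℤ ≤ ω → 0ℤ ≤ c →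
        (p ≡ 1ℤ → q ≡ 1ℤ → s ≡ 1ℤ × t ≡ 1ℤ × n² ≤ c * ω) → n² * (p * q) ≤ c * (ω * (s * t))
      solution-term {n² = n²} (inj₁ refl) q01 0≤s 0≤t 0≤ω 0≤c h =
        ≤-trans (≤-reflexive (*-zeroʳ n²)) (0≤* 0≤c (0≤* 0≤ω (0≤* 0≤s 0≤t)))
      solution-term {n² = n²} (inj₂ refl) (inj₁ refl) 0≤s 0≤t 0≤ω 0≤c h =
        ≤-trans (≤-reflexive (*-zeroʳ n²)) (0≤* 0≤c (0≤* 0≤ω (0≤* 0≤s 0≤t)))
      solution-term {ω = ω} {c} {n²} (inj₂ refl) (inj₂ refl) 0≤s 0≤t 0≤ω 0≤c h with h refl refl
      ... | refl , refl , n²≤ = ≤-trans (≤-reflexive (*-identityʳ n²))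
              (≤-trans n²≤ (≤-reflexive (cong (c *_) (sym (*-identityʳ ω)))))

      solutions-through-P : N * N * (∑ P * ∑ P) ≤ + 4 * + J * solutions s
      solutions-through-P = begin
        N * N * (∑ P * ∑ P)
          ≡⟨ cong (λ u → N * N * u) (trans (sym (∑-v P)) (sym (∑-reflect (v P) 0g))) ⟩
        N * N * ∑ (λ t → v P (0g ⊝ t))
          ≡⟨ sym (∑-*ˡ (N * N) (λ t → v P (0g ⊝ t))) ⟩
        ∑ (λ t → N * N * v P (0g ⊝ t))
          ≤⟨ ∑-mono termwise ⟩
        ∑ (λ t → + 4 * + J * (w s t * v s (0g ⊝ t)))
          ≡⟨ ∑-*ˡ (+ 4 * + J) (λ t → w s t * v s (0g ⊝ t)) ⟩
        + 4 * + J * solutions s ∎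
        where
        open ≤-Reasoning
        termwise : ∀ t → N * N * v P (0g ⊝ t) ≤ + 4 * + J * (w s t * v s (0g ⊝ t))
        termwise t = begin
          N * N * v P (0g ⊝ t)
            ≡⟨ sym (∑-*ˡ (N * N) (λ g → P (x g) * P (y g))) ⟩
          ∑ (λ g → N * N * (P (x g) * P (y g)))
            ≤⟨ ∑-mono (λ g → solution-term (P01 (x g)) (P01 (y g)) (0≤bit (s01 (x g))) (0≤bit (s01 (y g)))
                 (0≤w s01 t) (0≤* {+ 4} (+≤+ z≤n) 0≤J)
                 (λ e e′ → P⊆s e , P⊆s e′ , subst (λ u → N * N ≤ + 4 * + J * w s u) (point g) (w-large e e′))) ⟩
          ∑ (λ g → + 4 * + J * (w s t * (s (x g) * s (y g))))
            ≡⟨ trans (∑-*ˡ (+ 4 * + J) (λ g → w s t * (s (x g) * s (y g))))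
                 (cong (λ u → + 4 * + J * u) (∑-*ˡ (w s t) (λ g → s (x g) * s (y g)))) ⟩
          + 4 * + J * (w s t * v s (0g ⊝ t)) ∎
          where
          x y : G → G
          x g = half g
          y g = ⊖ third (0g ⊝ t ⊝ g)
          point : ∀ g → y g ⊕ (y g ⊝ x g) ⊕ (y g ⊝ x g) ≡ t
          point g = trans
            (solve 2 (λ z x → (:⊖ z) :⊕ ((:⊖ z) :⊝ x) :⊕ ((:⊖ z) :⊝ x) ⊜ :⊖ (z :⊕ z :⊕ z) :⊝ (x :⊕ x)) refl (third (0g ⊝ t ⊝ g)) (half g))
            (trans (cong₂ (λ a b → ⊖ a ⊝ b) (triple-third (0g ⊝ t ⊝ g)) (double-half g))
              (solve 2 (λ t g → :⊖ (:0 :⊝ t :⊝ g) :⊝ g ⊜ t) refl t g))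

      -- Squaring `P-large` costs `4 J² K²`, and `solutions-through-P` another `4 J`; this is the
      -- origin of `dense-loss`.
      dense-solutions : N * N * (N * N) ≤ dense-loss J * solutions s
      dense-solutions = combine {N} {+ J} {K} {∑ P} {solutions s} 0≤J (<⇒≤ 0<N) P-large solutions-through-P
        where
        combine : ∀ {n j k p σ} → 0ℤ ≤ j → 0ℤ ≤ n → n ≤ + 2 * j * (k * p) → n * n * (p * p) ≤ + 4 * j * σ →
          n * n * (n * n) ≤ + 16 * (j * (j * j)) * (k * k) * σ
        combine {n} {j} {k} {p} {σ} 0≤j 0≤n h₁ h₂ = begin
          n * n * (n * n)                                            ≤⟨ *-monoˡ (n * n) (0≤sq n) n²≤ ⟩
          n * n * (+ 2 * j * (k * p) * (+ 2 * j * (k * p)))          ≡⟨ ring₁ n j k p ⟩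
          + 4 * (j * j * (k * k)) * (n * n * (p * p))                ≤⟨ *-monoˡ _ (0≤* {+ 4} (+≤+ z≤n) (0≤* (0≤sq j) (0≤sq k))) h₂ ⟩
          + 4 * (j * j * (k * k)) * (+ 4 * j * σ)                    ≡⟨ ring₂ j k σ ⟩
          + 16 * (j * (j * j)) * (k * k) * σ                         ∎
          where
          open ≤-Reasoning
          n²≤ : n * n ≤ + 2 * j * (k * p) * (+ 2 * j * (k * p))
          n²≤ = *-mono (≤-trans 0≤n h₁) 0≤n h₁ h₁
          ring₁ : ∀ n j k p → n * n * (+ 2 * j * (k * p) * (+ 2 * j * (k * p))) ≡ + 4 * (j * j * (k * k)) * (n * n * (p * p))
          ring₁ = solve-∀
          ring₂ : ∀ j k σ → + 4 * (j * j * (k * k)) * (+ 4 * j * σ) ≡ + 16 * (j * (j * j)) * (k * k) * σ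
          ring₂ = solve-∀

    -- Sidon sets

    Sidon : (G → ℤ) → Set
    Sidon f = ∀ t → t ≢ 0g → auto f t ≤ 1ℤ

    ∑-squares-auto : ∀ f → ∑ (λ x → f x * f x) ≡ auto f 0g
    ∑-squares-auto f = sym (trans (auto-expand f 0g)
      (∑-cong (λ x → cong (λ u → f x * f u) (solve 1 (λ a → a :⊝ :0 ⊜ a) refl x))))

    auto-⋆ : ∀ f g → auto (f ⋆ g) ≗ auto f ⋆ auto g
    auto-⋆ f g t = trans (⋆-cong {f ⋆ g} (λ _ → refl) (⋆-dilate negation f g) t)
      (⋆-interchange f g (reverse f) (reverse g) t)

    ind-squares : ∀ {s : G → ℤ} → Ind s → ∑ (λ x → s x * s x) ≡ ∑ s
    ind-squares s01 = ∑-cong (λ x → bit-sq (s01 x))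

    -- The sum of squares is the value at `0g` of `auto f ⋆ auto g`, and `auto f` is `∑ f` at `0g`
    -- and at most 1 elsewhere. Young's inequality would have the square of `∑ f` as the factor of
    -- the first term.
    sidon-⋆ : ∀ {f} g → Ind f → Sidon f →
      ∑ (λ x → (f ⋆ g) x * (f ⋆ g) x) ≤ ∑ f * ∑ (λ x → g x * g x) + ∑ (λ x → abs (auto g x))
    sidon-⋆ {f} g f01 f-sidon = begin
      ∑ (λ x → (f ⋆ g) x * (f ⋆ g) x)
        ≡⟨ trans (∑-squares-auto (f ⋆ g)) (auto-⋆ f g 0g) ⟩
      ∑ (λ u → auto f u * auto g (0g ⊝ u))
        ≤⟨ ∑-mono termwise ⟩
      ∑ (λ u → indicator (u ≟ 0g) * (∑ f * Δ) + abs (auto g (0g ⊝ u)))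
        ≡⟨ trans (∑-distrib-+ (λ u → indicator (u ≟ 0g) * (∑ f * Δ)) (λ u → abs (auto g (0g ⊝ u))))
             (cong₂ _+_ (∑-δ (λ _ → ∑ f * Δ) 0g) (∑-reflect (λ u → abs (auto g u)) 0g)) ⟩
      ∑ f * Δ + ∑ (λ x → abs (auto g x)) ∎
      where
      open ≤-Reasoning
      Δ = ∑ (λ x → g x * g x)
      small : ∀ {x} y c → 0ℤ ≤ x → x ≤ 1ℤ → x * y ≤ 0ℤ * c + abs y
      small {x} y c 0≤x x≤1 = begin
        x * y              ≤⟨ *-monoˡ x 0≤x (x≤abs y) ⟩
        x * abs y          ≤⟨ *-monoʳ (abs y) (0≤abs y) x≤1 ⟩
        1ℤ * abs y         ≡⟨ *-identityˡ (abs y) ⟩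
        abs y              ≡⟨ sym (trans (cong (_+ abs y) (*-zeroˡ c)) (+-identityˡ (abs y))) ⟩
        0ℤ * c + abs y     ∎
      termwise : ∀ u → auto f u * auto g (0g ⊝ u) ≤ indicator (u ≟ 0g) * (∑ f * Δ) + abs (auto g (0g ⊝ u))
      termwise u with u ≟ 0g
      ... | no u≢0 = small (auto g (0g ⊝ u)) (∑ f * Δ) (0≤auto f01 u) (f-sidon u u≢0)
      ... | yes refl = ≤-slack (abs (auto g (0g ⊝ 0g))) (0≤abs (auto g (0g ⊝ 0g))) (cong (_+ abs (auto g (0g ⊝ 0g)))
          (trans (cong₂ _*_ (trans (sym (∑-squares-auto f)) (ind-squares f01))
            (trans (cong (auto g) (solve 0 (:0 :⊝ :0 ⊜ :0) refl)) (sym (∑-squares-auto g))))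
            (sym (*-identityˡ (∑ f * Δ)))))

    sidon-⋆-ind : ∀ {f g} → Ind f → Sidon f → Ind g →
      ∑ (λ x → (f ⋆ g) x * (f ⋆ g) x) ≤ ∑ f * ∑ g + ∑ g * ∑ g
    sidon-⋆-ind {f} {g} f01 f-sidon g01 = ≤-trans (sidon-⋆ g f01 f-sidon) (≤-reflexive
      (cong₂ (λ a b → ∑ f * a + b) (ind-squares g01)
        (trans (∑-cong (λ x → abs-nonneg (0≤auto g01 x))) (∑-auto g))))

    automorphism-0 : ∀ φ → Automorphism.to φ 0g ≡ 0g
    automorphism-0 φ = trans (cong to (solve 0 (:0 ⊜ :0 :⊝ :0) refl)) (trans (to-⊝ 0g 0g)
      (solve 1 (λ a → a :⊝ a ⊜ :0) refl (to 0g)))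
      where open Automorphism φ

    automorphism-⊖ : ∀ φ x → Automorphism.to φ (⊖ x) ≡ ⊖ Automorphism.to φ x
    automorphism-⊖ φ x = trans (cong to (solve 1 (λ a → :⊖ a ⊜ :0 :⊝ a) refl x)) (trans (to-⊝ 0g x)
      (trans (cong (_⊝ to x) (automorphism-0 φ)) (solve 1 (λ a → :0 :⊝ a ⊜ :⊖ a) refl (to x))))
      where open Automorphism φ

    auto-dilate : ∀ φ f → auto (dilate φ f) ≗ dilate φ (auto f)
    auto-dilate φ f t = trans
      (⋆-cong {dilate φ f} (λ _ → refl) (λ x → cong f (automorphism-⊖ φ x)) t)
      (sym (⋆-dilate φ f (reverse f) t))

    sidon-dilate : ∀ φ {f} → Sidon f → Sidon (dilate φ f)
    sidon-dilate φ {f} f-sidon t t≢0 = subst (_≤ 1ℤ) (sym (auto-dilate φ f t))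
      (f-sidon (to t) (λ e → t≢0 (trans (sym (from-to t)) (trans (cong from (trans e (sym (automorphism-0 φ)))) (from-to 0g)))))
      where open Automorphism φ

    ⋆-cauchy-schwarz : ∀ f g t → (f ⋆ g) t * (f ⋆ g) t ≤ ∑ (λ x → f x * f x) * ∑ (λ x → g x * g x)
    ⋆-cauchy-schwarz f g t = subst (λ u → (f ⋆ g) t * (f ⋆ g) t ≤ ∑ (λ x → f x * f x) * u)
      (∑-reflect (λ x → g x * g x) t) (cauchy-schwarz f (λ x → g (t ⊝ x)))

    difference : G → (G → ℤ) → G → ℤ
    difference h f t = f (t ⊕ h) - f t

    -- The autocorrelation of a first difference is a second difference of the autocorrelation, up
    -- to sign. Therefore almost periods of `auto f`, which are what sampling provides, suffice for
    -- applying `sidon-⋆` to `difference h f`; `h` need not be an almost period of `f`.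
    auto-difference : ∀ h f u → auto (difference h f) u
      ≡ (auto f u - auto f (u ⊕ h)) + (auto f u - auto f (u ⊝ h))
    auto-difference h f u = begin
      auto (difference h f) u
        ≡⟨ auto-expand (difference h f) u ⟩
      ∑ (λ t → (f (t ⊕ h) - f t) * (f (t ⊝ u ⊕ h) - f (t ⊝ u)))
        ≡⟨ ∑-cong (λ t → expand (f (t ⊕ h)) (f t) (f (t ⊝ u ⊕ h)) (f (t ⊝ u))) ⟩
      ∑ (λ t → (A t - B t) + (C t - E t))
        ≡⟨ trans (∑-distrib-+ (λ t → A t - B t) (λ t → C t - E t)) (cong₂ _+_ (∑-minus A B) (∑-minus C E)) ⟩
      (∑ A - ∑ B) + (∑ C - ∑ E)
        ≡⟨ cong₂ _+_ (cong₂ _-_ ∑A ∑B) (cong₂ _-_ ∑C ∑E) ⟩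
      (auto f u - auto f (u ⊕ h)) + (auto f u - auto f (u ⊝ h)) ∎
      where
      open ≡-Reasoning
      expand : ∀ a b c d → (a - b) * (c - d) ≡ (a * c - a * d) + (b * d - b * c)
      expand = solve-∀
      A B C E : G → ℤ
      A t = f (t ⊕ h) * f (t ⊝ u ⊕ h)
      B t = f (t ⊕ h) * f (t ⊝ u)
      C t = f t * f (t ⊝ u)
      E t = f t * f (t ⊝ u ⊕ h)
      ∑C : ∑ C ≡ auto f u
      ∑C = sym (auto-expand f u)
      ∑A : ∑ A ≡ auto f u
      ∑A = trans (∑-cong (λ t → cong (λ z → f (t ⊕ h) * f z) (solve 3 (λ t u h → t :⊝ u :⊕ h ⊜ t :⊕ h :⊝ u) refl t u h)))
        (trans (∑-shift C h) ∑C)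
      ∑B : ∑ B ≡ auto f (u ⊕ h)
      ∑B = trans (∑-cong (λ t → cong (λ z → f (t ⊕ h) * f z) (solve 3 (λ t u h → t :⊝ u ⊜ t :⊕ h :⊝ (u :⊕ h)) refl t u h)))
        (trans (∑-shift (λ t → f t * f (t ⊝ (u ⊕ h))) h) (sym (auto-expand f (u ⊕ h))))
      ∑E : ∑ E ≡ auto f (u ⊝ h)
      ∑E = trans (∑-cong (λ t → cong (λ z → f t * f z) (solve 3 (λ t u h → t :⊝ u :⊕ h ⊜ t :⊝ (u :⊝ h)) refl t u h)))
        (sym (auto-expand f (u ⊝ h)))

    ∑-auto-difference : ∀ h f → ∑ (λ u → abs (auto (difference h f) u)) ≤ + 2 * auto-distance f h
    ∑-auto-difference h f = begin
      ∑ (λ u → abs (auto (difference h f) u))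
        ≤⟨ ∑-mono (λ u → ≤-trans (≤-reflexive (cong abs (auto-difference h f u)))
             (abs-+ (auto f u - auto f (u ⊕ h)) (auto f u - auto f (u ⊝ h)))) ⟩
      ∑ (λ u → abs (auto f u - auto f (u ⊕ h)) + abs (auto f u - auto f (u ⊝ h)))
        ≡⟨ ∑-distrib-+ (λ u → abs (auto f u - auto f (u ⊕ h))) (λ u → abs (auto f u - auto f (u ⊝ h))) ⟩
      ∑ (λ u → abs (auto f u - auto f (u ⊕ h))) + ∑ (λ u → abs (auto f u - auto f (u ⊝ h)))
        ≡⟨ cong₂ _+_ (∑-cong (λ u → abs-swap (auto f u) (auto f (u ⊕ h)))) backwards ⟩
      auto-distance f h + auto-distance f h
        ≡⟨ double (auto-distance f h) ⟩
      + 2 * auto-distance f h ∎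
      where
      open ≤-Reasoning
      double : ∀ a → a + a ≡ + 2 * a
      double = solve-∀
      flip : ∀ a b → a - b ≡ - (b - a)
      flip = solve-∀
      abs-swap : ∀ a b → abs (a - b) ≡ abs (b - a)
      abs-swap a b = trans (cong abs (flip a b)) (abs-neg (b - a))
      backwards : ∑ (λ u → abs (auto f u - auto f (u ⊝ h))) ≡ auto-distance f h
      backwards = trans (sym (∑-shift (λ u → abs (auto f u - auto f (u ⊝ h))) h))
        (∑-cong (λ u → cong (λ z → abs (auto f (u ⊕ h) - auto f z)) (solve 2 (λ u h → u :⊕ h :⊝ h ⊜ u) refl u h)))

    ∑-difference² : ∀ h {f} → Ind f → ∑ (λ t → difference h f t * difference h f t) ≤ N
    ∑-difference² h {f} f01 = ≤-trans (∑-mono (λ t → bound (f01 (t ⊕ h)) (f01 t)))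
      (≤-reflexive (trans (∑-const order 1ℤ) (*-identityʳ N)))
      where
      bound : ∀ {x y} → x ≡ 0ℤ ⊎ x ≡ 1ℤ → y ≡ 0ℤ ⊎ y ≡ 1ℤ → (x - y) * (x - y) ≤ 1ℤ
      bound (inj₁ refl) (inj₁ refl) = +≤+ z≤n
      bound (inj₁ refl) (inj₂ refl) = ≤-refl
      bound (inj₂ refl) (inj₁ refl) = ≤-refl
      bound (inj₂ refl) (inj₂ refl) = +≤+ z≤n

    ⋆-support : ∀ f g t → (f ⋆ g) t ≢ 0ℤ → ∃ λ x → f x ≢ 0ℤ × g (t ⊝ x) ≢ 0ℤ
    ⋆-support f g t h = proj₁ found
      , (λ e → proj₂ found (trans (cong (_* g (t ⊝ x)) e) (*-zeroˡ (g (t ⊝ x)))))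
      , (λ e → proj₂ found (trans (cong (f x *_) e) (*-zeroʳ (f x))))
      where
      found = ∑-support h
      x = proj₁ found

    ⋆-plusˡ : ∀ f f′ g → (λ x → f x + f′ x) ⋆ g ≗ λ t → (f ⋆ g) t + (f′ ⋆ g) t
    ⋆-plusˡ f f′ g t = trans (∑-cong (λ x → *-distribʳ-+ (g (t ⊝ x)) (f x) (f′ x)))
      (∑-distrib-+ (λ x → f x * g (t ⊝ x)) (λ x → f′ x * g (t ⊝ x)))

    ind-dilate : ∀ φ {s} → Ind s → Ind (dilate φ s)
    ind-dilate φ s01 x = s01 (Automorphism.to φ x)

    0≤v : ∀ {f} → (∀ x → 0ℤ ≤ f x) → ∀ t → 0ℤ ≤ v f t
    0≤v {f} 0≤f = ⋆-nonneg {dilate halving f} {dilate thirding (reverse f)} (λ x → 0≤f (half x)) (λ x → 0≤f (⊖ third x))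

    w-⋆ : ∀ f g → w (f ⋆ g) ≗ w f ⋆ w g
    w-⋆ f g t = trans (⋆-cong {f ⋆ g} (λ _ → refl) (auto-⋆ f g) t) (⋆-interchange f g (auto f) (auto g) t)

    v-⋆ : ∀ f g → v (f ⋆ g) ≗ v f ⋆ v g
    v-⋆ f g t = trans
      (⋆-cong (⋆-dilate halving f g)
        (λ x → trans (⋆-dilate negation f g (third x)) (⋆-dilate thirding (reverse f) (reverse g) x)) t)
      (⋆-interchange (dilate halving f) (dilate halving g) (dilate thirding (reverse f)) (dilate thirding (reverse g)) t)

    -- An element weighted by `f ⋆ g` is a sum of one weighted by `f` and one weighted by `g`. The
    -- equation is linear: if its form takes the value `s` on the parts from `g`, it takes the value
    -- `- s` on the parts from `f`.
    solutions-⋆ : ∀ f g → solutions (f ⋆ g) ≡ ∑ (λ s → (w g ⋆ v g) s * (w f ⋆ v f) (0g ⊝ s))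
    solutions-⋆ f g = trans (⋆-cong (w-⋆ f g) (v-⋆ f g) 0g)
      (trans (⋆-interchange (w f) (w g) (v f) (v g) 0g) (⋆-comm (w f ⋆ v f) (w g ⋆ v g) 0g))

    ∑-w : ∀ f → ∑ (w f) ≡ ∑ f * (∑ f * ∑ f)
    ∑-w f = trans (∑-⋆ f (auto f)) (cong (λ u → ∑ f * u) (∑-auto f))

    -- Replaces `auto a` by a function with values 0 and 1, as the pigeonhole over bits requires.
    -- For a Sidon set the two agree except at `0g`, where `auto a` equals `∑ a`.
    differences : (G → ℤ) → G → ℤ
    differences a t = indicator (1ℤ ≤? auto a t)

    module Transfer {a : G → ℤ} (a01 : Ind a) (a-sidon : Sidon a) where

      m : ℤ
      m = ∑ a
      0≤a : ∀ x → 0ℤ ≤ a x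
      0≤a x = 0≤bit (a01 x)
      0≤m : 0ℤ ≤ m
      0≤m = ∑-nonneg 0≤a

      D : G → ℤ
      D = differences a
      D01 : Ind D
      D01 = ind-indicator (λ t → 1ℤ ≤? auto a t)

      T : G → ℤ
      T = (a ⋆ D) ⋆ v a

      auto≤D : ∀ t → auto a t ≤ D t + indicator (t ≟ 0g) * m
      auto≤D t = cases (1ℤ ≤? auto a t) (t ≟ 0g) 0≤m
        (λ e → ≤-reflexive (trans (cong (auto a) e) (trans (sym (∑-squares-auto a)) (ind-squares a01))))
        (a-sidon t)
        where
        cases : ∀ {x m} {P : Set} (d : Dec (1ℤ ≤ x)) (e : Dec P) → 0ℤ ≤ m → (P → x ≤ m) → (¬ P → x ≤ 1ℤ) →
          x ≤ indicator d + indicator e * m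
        cases {x} {m} d (yes p) 0≤m x≤m _ = ≤-trans (x≤m p) (≤-slack (indicator d) (0≤bit (ind-indicator {1} (λ _ → d) zero))
          (trans (+-comm m (indicator d)) (cong (λ u → indicator d + u) (sym (*-identityˡ m)))))
        cases {x} {m} (yes _) (no ¬p) 0≤m _ x≤1 = ≤-trans (x≤1 ¬p) (≤-reflexive (sym (trans (cong (λ u → 1ℤ + u) (*-zeroˡ m)) (+-identityʳ 1ℤ))))
        cases {x} {m} (no 1≰x) (no ¬p) 0≤m _ x≤1 = ≤-trans (i<j⇒i≤pred[j] (≰⇒> 1≰x))
          (≤-reflexive (sym (trans (cong (λ u → 0ℤ + u) (*-zeroˡ m)) (+-identityʳ 0ℤ))))

      m²≤m+N : m * m ≤ m + N
      m²≤m+N = begin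
        m * m
          ≡⟨ sym (∑-auto a) ⟩
        ∑ (auto a)
          ≤⟨ ∑-mono auto≤D ⟩
        ∑ (λ t → D t + indicator (t ≟ 0g) * m)
          ≡⟨ trans (∑-distrib-+ D (λ t → indicator (t ≟ 0g) * m)) (cong (λ u → ∑ D + u) (∑-δ (λ _ → m) 0g)) ⟩
        ∑ D + m
          ≤⟨ +-monoˡ-≤ m (∑-ind≤N D01) ⟩
        N + m
          ≡⟨ +-comm N m ⟩
        m + N ∎
        where open ≤-Reasoning

      v-energy : ∑ (λ x → v a x * v a x) ≤ + 2 * (m * m)
      v-energy = begin
        ∑ (λ x → v a x * v a x)
          ≤⟨ sidon-⋆-ind (ind-dilate halving a01) (sidon-dilate halving {a} a-sidon) (ind-dilate thirding (ind-reverse a01)) ⟩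
        ∑ (dilate halving a) * ∑ (dilate thirding (reverse a)) + ∑ (dilate thirding (reverse a)) * ∑ (dilate thirding (reverse a))
          ≡⟨ cong₂ (λ x y → x * y + y * y) (∑-dilate halving a) (trans (∑-dilate thirding (reverse a)) (∑-reverse a)) ⟩
        m * m + m * m
          ≡⟨ double (m * m) ⟩
        + 2 * (m * m) ∎
        where
        open ≤-Reasoning
        double : ∀ x → x + x ≡ + 2 * x
        double = solve-∀

      -- The shift is moved onto `D`, and the change of `T` becomes a convolution of `v a` with
      -- `a ⋆ difference h D`. Both are convolutions with a Sidon set, so Cauchy-Schwarz combined
      -- with `sidon-⋆` is efficient.
      T-difference : ∀ h s → (T (s ⊕ h) - T s) * (T (s ⊕ h) - T s)
        ≤ + 2 * (m * m) * (m * N + + 2 * auto-distance D h)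
      T-difference h s = begin
        (T (s ⊕ h) - T s) * (T (s ⊕ h) - T s)
          ≡⟨ cong (λ u → u * u) T-diff ⟩
        (v a ⋆ V) s * (v a ⋆ V) s
          ≤⟨ ⋆-cauchy-schwarz (v a) V s ⟩
        ∑ (λ x → v a x * v a x) * ∑ (λ x → V x * V x)
          ≤⟨ *-mono {∑ (λ x → v a x * v a x)} {+ 2 * (m * m)} (0≤* {+ 2} (+≤+ z≤n) (0≤sq m)) (∑-nonneg (λ x → 0≤sq (V x))) v-energy V-energy ⟩
        + 2 * (m * m) * (m * N + + 2 * auto-distance D h) ∎
        where
        open ≤-Reasoning
        V : G → ℤ
        V = a ⋆ difference h D
        T-diff : T (s ⊕ h) - T s ≡ (v a ⋆ V) s
        T-diff = trans
          (cong₂ _-_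
            (trans (⋆-comm (a ⋆ D) (v a) (s ⊕ h)) (sym (⋆-shiftʳ h (v a) (a ⋆ D) s)))
            (⋆-comm (a ⋆ D) (v a) s))
          (trans (sym (⋆-minusʳ (v a) (shift h (a ⋆ D)) (a ⋆ D) s))
            (⋆-cong {v a} (λ _ → refl)
              (λ x → trans (cong (λ u → u - (a ⋆ D) x) (sym (⋆-shiftʳ h a D x))) (sym (⋆-minusʳ a (shift h D) D x))) s))
        V-energy : ∑ (λ x → V x * V x) ≤ m * N + + 2 * auto-distance D h
        V-energy = ≤-trans (sidon-⋆ (difference h D) a01 a-sidon)
          (+-mono-≤ (*-monoˡ m 0≤m (∑-difference² h D01)) (∑-auto-difference h D))

      -- Passing from `auto a` to `D` is wrong only at the difference `0g`, that is for `x₂ = x₄`;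
      -- there `x₂` contributes a factor `m` and drops out of the equation.
      w⋆v≤ : ∀ u → (w a ⋆ v a) u ≤ T u + m * (a ⋆ v a) u
      w⋆v≤ u = ≤-trans (⋆-monoˡ (0≤v 0≤a) w≤ u) (≤-reflexive
        (trans (⋆-plusˡ (a ⋆ D) (λ x → m * a x) (v a) u) (cong (λ z → T u + z) (⋆-*ˡ m a (v a) u))))
        where
        w≤ : ∀ t → w a t ≤ (a ⋆ D) t + m * a t
        w≤ t = begin
          (a ⋆ auto a) t
            ≡⟨ ⋆-comm a (auto a) t ⟩
          (auto a ⋆ a) t
            ≤⟨ ⋆-monoˡ 0≤a auto≤D t ⟩
          ((λ x → D x + indicator (x ≟ 0g) * m) ⋆ a) t
            ≡⟨ ⋆-plusˡ D (λ x → indicator (x ≟ 0g) * m) a t ⟩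
          (D ⋆ a) t + ∑ (λ x → indicator (x ≟ 0g) * m * a (t ⊝ x))
            ≡⟨ cong₂ _+_ (⋆-comm D a t) (trans (∑-cong (λ x → *-assoc (indicator (x ≟ 0g)) m (a (t ⊝ x))))
                 (trans (∑-δ (λ x → m * a (t ⊝ x)) 0g) (cong (λ z → m * a z) (solve 1 (λ t → t :⊝ :0 ⊜ t) refl t)))) ⟩
          (a ⋆ D) t + m * a t ∎
          where open ≤-Reasoning

      -- By `free` a contributing tuple has `x₃ = x₅`, and then the element of `D` must be
      -- `x₃ - x₁`. So `x₁` and `x₃` determine everything.
      T-zero : (∀ {x y z} → a x ≡ 1ℤ → a y ≡ 1ℤ → a z ≡ 1ℤ → D (z ⊕ z ⊕ z ⊝ (y ⊕ y) ⊝ x) ≡ 1ℤ → y ≡ z) →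
        T 0g ≤ m * m
      T-zero free = begin
        ∑ (λ t → (a ⋆ D) t * v a (0g ⊝ t))
          ≡⟨ ∑-cong (λ t → sym (∑-product (λ x → a x * D (t ⊝ x)) (λ g → a (half g) * a (⊖ third (0g ⊝ t ⊝ g))))) ⟩
        ∑ (λ t → ∑ (λ x → ∑ (λ g → a x * D (t ⊝ x) * (a (half g) * a (⊖ third (0g ⊝ t ⊝ g))))))
          ≤⟨ ∑-mono (λ t → ∑-mono (λ x → ∑-mono (λ g → termwise t x g))) ⟩
        ∑ (λ t → ∑ (λ x → ∑ (λ g → a x * (indicator (t ≟ half g) * a (half g)))))
          ≡⟨ ∑-cong (λ t → ∑-product a (λ g → indicator (t ≟ half g) * a (half g))) ⟩
        ∑ (λ t → m * ∑ (λ g → indicator (t ≟ half g) * a (half g)))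
          ≡⟨ trans (∑-*ˡ m (λ t → ∑ (λ g → indicator (t ≟ half g) * a (half g))))
               (cong (λ u → m * u) (trans (∑-comm (λ t g → indicator (t ≟ half g) * a (half g)))
                 (trans (∑-cong (λ g → ∑-δ (λ _ → a (half g)) (half g))) (∑-dilate halving a)))) ⟩
        m * m ∎
        where
        open ≤-Reasoning
        bits : ∀ {x d y z i} → x ≡ 0ℤ ⊎ x ≡ 1ℤ → d ≡ 0ℤ ⊎ d ≡ 1ℤ → y ≡ 0ℤ ⊎ y ≡ 1ℤ → z ≡ 0ℤ ⊎ z ≡ 1ℤ → i ≡ 0ℤ ⊎ i ≡ 1ℤ →
          (x ≡ 1ℤ → d ≡ 1ℤ → y ≡ 1ℤ → z ≡ 1ℤ → i ≡ 1ℤ) → x * d * (y * z) ≤ x * (i * y)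
        bits {x} {d} {y} {z} {i} x01 d01 y01 z01 i01 h = cases (bit-* (bit-* x01 d01) (bit-* y01 z01))
          where
          cases : x * d * (y * z) ≡ 0ℤ ⊎ x * d * (y * z) ≡ 1ℤ → x * d * (y * z) ≤ x * (i * y)
          cases (inj₁ e) = subst (_≤ x * (i * y)) (sym e) (0≤bit (bit-* x01 (bit-* i01 y01)))
          cases (inj₂ e) = ≤-reflexive (trans e (sym (cong₂ _*_ x≡1 (cong₂ _*_ (h x≡1 d≡1 y≡1 z≡1) y≡1))))
            where
            xd = bit-*≡1 (bit-* x01 d01) (bit-* y01 z01) e
            x≡1 = proj₁ (bit-*≡1 x01 d01 (proj₁ xd))
            d≡1 = proj₂ (bit-*≡1 x01 d01 (proj₁ xd))
            y≡1 = proj₁ (bit-*≡1 y01 z01 (proj₂ xd))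
            z≡1 = proj₂ (bit-*≡1 y01 z01 (proj₂ xd))
        termwise : ∀ t x g → a x * D (t ⊝ x) * (a (half g) * a (⊖ third (0g ⊝ t ⊝ g)))
          ≤ a x * (indicator (t ≟ half g) * a (half g))
        termwise t x g = bits (a01 x) (D01 (t ⊝ x)) (a01 y) (a01 z) (ind-indicator (λ t → t ≟ half g) t)
          (λ ex ed ey ez → hit (t ≟ half g) (t≡ (free ex ey ez (trans (cong D point) ed))))
          where
          y = half g
          z = ⊖ third (0g ⊝ t ⊝ g)
          3z : z ⊕ z ⊕ z ≡ t ⊕ g
          3z = trans (solve 1 (λ q → (:⊖ q) :⊕ (:⊖ q) :⊕ (:⊖ q) ⊜ :⊖ (q :⊕ q :⊕ q)) refl (third (0g ⊝ t ⊝ g)))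
            (trans (cong ⊖_ (triple-third (0g ⊝ t ⊝ g))) (solve 2 (λ t g → :⊖ (:0 :⊝ t :⊝ g) ⊜ t :⊕ g) refl t g))
          point : z ⊕ z ⊕ z ⊝ (y ⊕ y) ⊝ x ≡ t ⊝ x
          point = trans (cong₂ (λ p q → p ⊝ q ⊝ x) 3z (double-half g))
            (solve 3 (λ t g x → t :⊕ g :⊝ g :⊝ x ⊜ t :⊝ x) refl t g x)
          t≡ : y ≡ z → t ≡ half g
          t≡ e = trans (solve 2 (λ t g → t ⊜ t :⊕ g :⊝ g) refl t g)
            (trans (cong₂ _⊝_ (trans (sym 3z) (cong (λ q → q ⊕ q ⊕ q) (sym e))) (sym (double-half g)))
              (solve 1 (λ y → y :⊕ y :⊕ y :⊝ (y :⊕ y) ⊜ y) refl y))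
          hit : ∀ {P : Set} (d : Dec P) → P → indicator d ≡ 1ℤ
          hit (yes _) _ = refl
          hit (no ¬p) p = ⊥-elim (¬p p)

    -- Smoothing a sparse set

    auto-scale : ∀ c f → auto (λ x → c * f x) ≗ λ t → c * (c * auto f t)
    auto-scale c f t = trans (⋆-*ˡ c f (λ x → c * reverse f x) t) (cong (λ u → c * u) (⋆-*ʳ c f (reverse f) t))

    w-scale : ∀ c f → w (λ x → c * f x) ≗ λ t → c * (c * (c * w f t))
    w-scale c f t = begin
      ((λ x → c * f x) ⋆ auto (λ x → c * f x)) t
        ≡⟨ ⋆-*ˡ c f (auto (λ x → c * f x)) t ⟩
      c * (f ⋆ auto (λ x → c * f x)) t
        ≡⟨ cong (λ u → c * u) (⋆-cong {f} (λ _ → refl) (auto-scale c f) t) ⟩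
      c * (f ⋆ (λ x → c * (c * auto f x))) t
        ≡⟨ cong (λ u → c * u) (trans (⋆-*ʳ c f (λ x → c * auto f x) t) (cong (λ u → c * u) (⋆-*ʳ c f (auto f) t))) ⟩
      c * (c * (c * w f t)) ∎
      where open ≡-Reasoning

    v-scale : ∀ c f → v (λ x → c * f x) ≗ λ t → c * (c * v f t)
    v-scale c f t = trans
      (⋆-*ˡ c (dilate halving f) (λ x → c * dilate thirding (reverse f) x) t)
      (cong (λ u → c * u) (⋆-*ʳ c (dilate halving f) (dilate thirding (reverse f)) t))

    solutions-scale : ∀ c f → solutions (λ x → c * f x) ≡ c * (c * (c * (c * (c * solutions f))))
    solutions-scale c f = begin
      ∑ (λ x → w (λ x → c * f x) x * v (λ x → c * f x) (0g ⊝ x))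
        ≡⟨ ∑-cong (λ x → trans (cong₂ _*_ (w-scale c f x) (v-scale c f (0g ⊝ x))) (ring c (w f x) (v f (0g ⊝ x)))) ⟩
      ∑ (λ x → c * (c * (c * (c * c))) * (w f x * v f (0g ⊝ x)))
        ≡⟨ ∑-*ˡ (c * (c * (c * (c * c)))) (λ x → w f x * v f (0g ⊝ x)) ⟩
      c * (c * (c * (c * c))) * solutions f
        ≡⟨ ring′ c (solutions f) ⟩
      c * (c * (c * (c * (c * solutions f)))) ∎
      where
      open ≡-Reasoning
      ring : ∀ c x y → c * (c * (c * x)) * (c * (c * y)) ≡ c * (c * (c * (c * c))) * (x * y)
      ring = solve-∀
      ring′ : ∀ c x → c * (c * (c * (c * c))) * x ≡ c * (c * (c * (c * (c * x))))
      ring′ = solve-∀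

    solutions-mono : ∀ {f g} → (∀ x → 0ℤ ≤ f x) → (∀ x → f x ≤ g x) → solutions f ≤ solutions g
    solutions-mono {f} {g} 0≤f f≤g = ⋆-mono {w f} {w g} {v f} {v g}
      (⋆-nonneg 0≤f 0≤auto-f) (0≤v 0≤f) (⋆-mono 0≤f 0≤auto-f f≤g auto-f≤g)
      (⋆-mono (λ x → 0≤f (half x)) (λ x → 0≤f (⊖ third x)) (λ x → f≤g (half x)) (λ x → f≤g (⊖ third x))) 0g
      where
      0≤auto-f : ∀ t → 0ℤ ≤ auto f t
      0≤auto-f = ⋆-nonneg 0≤f (λ x → 0≤f (⊖ x))
      auto-f≤g : ∀ t → auto f t ≤ auto g t
      auto-f≤g = ⋆-mono 0≤f (λ x → 0≤f (⊖ x)) f≤g (λ x → f≤g (⊖ x))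

    0≤solutions : ∀ {f} → (∀ x → 0ℤ ≤ f x) → 0ℤ ≤ solutions f
    0≤solutions {f} 0≤f = ⋆-nonneg {w f} {v f} (⋆-nonneg 0≤f (⋆-nonneg 0≤f (λ x → 0≤f (⊖ x)))) (0≤v 0≤f) 0g

    -- The points where the smoothing of a by H is at least half of its mean value.
    dense-model : (G → ℤ) → (G → ℤ) → G → ℤ
    dense-model a H u = indicator (∑ a * ∑ H ≤? + 2 * N * (a ⋆ H) u)

    module DenseModel {a H : G → ℤ} (a01 : Ind a) (a-sidon : Sidon a) (H01 : Ind H)
      (0<η : 0ℤ < ∑ H) (m≤η : ∑ a ≤ ∑ H) where

      m η : ℤ
      m = ∑ a
      η = ∑ H
      F S : G → ℤ
      F = a ⋆ H
      S = dense-model a H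

      0≤mη : 0ℤ ≤ m * η
      0≤mη = 0≤* (∑-nonneg (λ x → 0≤bit (a01 x))) (<⇒≤ 0<η)
      0≤F : ∀ u → 0ℤ ≤ F u
      0≤F = ⋆-nonneg (λ x → 0≤bit (a01 x)) (λ x → 0≤bit (H01 x))
      large? : ∀ u → Dec (m * η ≤ + 2 * N * F u)
      large? u = m * η ≤? + 2 * N * F u
      S01 : Ind S
      S01 = ind-indicator large?

      mass : m * η ≤ + 2 * ∑ (λ u → S u * F u)
      mass = cancel-half 0<N (begin
        + 2 * N * (m * η)
          ≡⟨ cong (λ z → + 2 * N * z) (sym (∑-⋆ a H)) ⟩
        + 2 * N * ∑ F
          ≡⟨ sym (∑-*ˡ (+ 2 * N) F) ⟩
        ∑ (λ u → + 2 * N * F u)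
          ≤⟨ ∑-mono (λ u → split {m * η} {F u} {+ 2 * N} (large? u) 0≤mη) ⟩
        ∑ (λ u → + 2 * N * (S u * F u) + m * η)
          ≡⟨ trans (∑-distrib-+ (λ u → + 2 * N * (S u * F u)) (λ _ → m * η))
               (cong₂ _+_ (∑-*ˡ (+ 2 * N) (λ u → S u * F u)) (∑-const order (m * η))) ⟩
        + 2 * N * ∑ (λ u → S u * F u) + N * (m * η) ∎)
        where
        open ≤-Reasoning
        split : ∀ {c x n} (d : Dec (c ≤ n * x)) → 0ℤ ≤ c → n * x ≤ n * (indicator d * x) + c
        split {c} {x} {n} (yes _) 0≤c = ≤-slack c 0≤c (cong (λ z → n * z + c) (sym (*-identityˡ x)))
        split {c} {x} {n} (no ¬p) 0≤c = ≤-trans (<⇒≤ (≰⇒> ¬p)) (≤-reflexive (ring n x c))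
          where
          ring : ∀ n x c → c ≡ n * (0ℤ * x) + c
          ring = solve-∀

      -- Cauchy-Schwarz on `S` compares `mass` with the square sum of `F`, which is at most
      -- `m η + η² ≤ 2 η²` by the Sidon property. The size of `H` cancels, so the density of `S`
      -- does not deteriorate when finer almost periods make `H` smaller.
      dense : m * m ≤ + 8 * ∑ S
      dense = combine {m} {η} {∑ S} {∑ (λ u → S u * F u)} {∑ (λ u → F u * F u)} 0<η m≤η
        (∑-nonneg (λ u → 0≤bit (S01 u))) 0≤mη mass
        (subst (λ z → ∑ (λ u → S u * F u) * ∑ (λ u → S u * F u) ≤ z * ∑ (λ u → F u * F u))
          (ind-squares S01) (cauchy-schwarz S F))
        (sidon-⋆-ind a01 a-sidon H01)
        where
        combine : ∀ {m η σ x y} → 0ℤ < η → m ≤ η → 0ℤ ≤ σ → 0ℤ ≤ m * η → m * η ≤ + 2 * x → x * x ≤ σ * y →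
          y ≤ m * η + η * η → m * m ≤ + 8 * σ
        combine {m} {η} {σ} {x} {y} 0<η m≤η 0≤σ 0≤mη h₁ h₂ h₃ = cancelˡ (η * η) (0<* 0<η 0<η) (begin
          η * η * (m * m)                  ≡⟨ ring₁ η m ⟩
          m * η * (m * η)                  ≤⟨ *-mono (≤-trans 0≤mη h₁) 0≤mη h₁ h₁ ⟩
          + 2 * x * (+ 2 * x)              ≡⟨ ring₂ x ⟩
          + 4 * (x * x)                    ≤⟨ *-monoˡ (+ 4) (+≤+ z≤n) h₂ ⟩
          + 4 * (σ * y)                    ≤⟨ *-monoˡ (+ 4) (+≤+ z≤n) (*-monoˡ σ 0≤σ h₃) ⟩
          + 4 * (σ * (m * η + η * η))      ≤⟨ *-monoˡ (+ 4) (+≤+ z≤n) (*-monoˡ σ 0≤σ (+-monoˡ-≤ (η * η) (*-monoʳ η (<⇒≤ 0<η) m≤η))) ⟩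
          + 4 * (σ * (η * η + η * η))      ≡⟨ ring₃ σ η ⟩
          η * η * (+ 8 * σ)                ∎)
          where
          open ≤-Reasoning
          ring₁ : ∀ η m → η * η * (m * m) ≡ m * η * (m * η)
          ring₁ = solve-∀
          ring₂ : ∀ x → + 2 * x * (+ 2 * x) ≡ + 4 * (x * x)
          ring₂ = solve-∀
          ring₃ : ∀ σ η → + 4 * (σ * (η * η + η * η)) ≡ η * η * (+ 8 * σ)
          ring₃ = solve-∀

      -- `m * η * S` lies below `2 * N * F` pointwise, and `solutions` is monotone and homogeneous
      -- of degree 5.
      solutions-model : fifth (m * η) (solutions S) ≤ fifth (+ 2 * N) (solutions F)
      solutions-model = begin
        fifth (m * η) (solutions S)             ≡⟨ sym (solutions-scale (m * η) S) ⟩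
        solutions (λ u → m * η * S u)           ≤⟨ solutions-mono (λ u → 0≤* 0≤mη (0≤bit (S01 u)))
          (λ u → below (large? u) (0≤* (0≤* {+ 2} (+≤+ z≤n) (<⇒≤ 0<N)) (0≤F u))) ⟩
        solutions (λ u → + 2 * N * F u)         ≡⟨ solutions-scale (+ 2 * N) F ⟩
        fifth (+ 2 * N) (solutions F)           ∎
        where
        open ≤-Reasoning
        below : ∀ {c x} (d : Dec (c ≤ x)) → 0ℤ ≤ x → c * indicator d ≤ x
        below {c} (yes p) _ = ≤-trans (≤-reflexive (*-identityʳ c)) p
        below {c} (no _) 0≤x = ≤-trans (≤-reflexive (*-zeroʳ c)) 0≤x

    module Smoothing {a : G → ℤ} (a01 : Ind a) (a-sidon : Sidon a)
      (free : ∀ {x y z} → a x ≡ 1ℤ → a y ≡ 1ℤ → a z ≡ 1ℤ → differences a (z ⊕ z ⊕ z ⊝ (y ⊕ y) ⊝ x) ≡ 1ℤ → y ≡ z)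
      (λ₀ : ℤ) (0≤λ : 0ℤ ≤ λ₀) {H : G → ℤ} (H01 : Ind H)
      (T-step : ∀ {p p′} → H p ≡ 1ℤ → H p′ ≡ 1ℤ → ∀ s →
        λ₀ * Transfer.T a01 a-sidon (s ⊕ (p ⊝ p′)) ≤ λ₀ * Transfer.T a01 a-sidon s + ∑ a * (∑ a * ∑ a)) where

      open Transfer a01 a-sidon

      m³ η : ℤ
      m³ = m * (m * m)
      η = ∑ H
      W : G → ℤ
      W = w H ⋆ v H
      B : ℤ
      B = λ₀ * (m * m) + + 4 * m³

      -- A point of the support is `s = h₁ + h₂ + 2 h₃ - h₄ - 3 h₅` with all `hᵢ` in `H`. Since the
      -- coefficients sum to zero, `- s = (h₄ - h₁) + (h₅ - h₂) + 2 (h₅ -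
      -- h₃)`, so four steps by differences from `H` lead from `0g` to `- s`.
      on-support : ∀ s → W s ≢ 0ℤ → λ₀ * T (0g ⊝ s) ≤ B
      on-support s Ws≢0 = begin
        λ₀ * T (0g ⊝ s)                   ≡⟨ cong (λ z → λ₀ * T z) point ⟩
        λ₀ * T s₄                         ≤⟨ T-step H5 H3 s₃ ⟩
        λ₀ * T s₃ + m³                    ≤⟨ +-monoˡ-≤ m³ (T-step H5 H3 s₂) ⟩
        λ₀ * T s₂ + m³ + m³               ≤⟨ +-monoˡ-≤ m³ (+-monoˡ-≤ m³ (T-step H5 H2 s₁)) ⟩
        λ₀ * T s₁ + m³ + m³ + m³          ≤⟨ +-monoˡ-≤ m³ (+-monoˡ-≤ m³ (+-monoˡ-≤ m³ (T-step H4 H1 0g))) ⟩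
        λ₀ * T 0g + m³ + m³ + m³ + m³     ≤⟨ +-monoˡ-≤ m³ (+-monoˡ-≤ m³ (+-monoˡ-≤ m³ (+-monoˡ-≤ m³ (*-monoˡ λ₀ 0≤λ (T-zero free))))) ⟩
        λ₀ * (m * m) + m³ + m³ + m³ + m³  ≡⟨ ring (λ₀ * (m * m)) m³ ⟩
        B                                 ∎
        where
        open ≤-Reasoning
        split₁ = ⋆-support (w H) (v H) s Ws≢0
        x = proj₁ split₁
        split₂ = ⋆-support H (auto H) x (proj₁ (proj₂ split₁))
        h₁ = proj₁ split₂
        split₃ = ⋆-support H (reverse H) (x ⊝ h₁) (proj₂ (proj₂ split₂))
        h₂ = proj₁ split₃
        h₄ = ⊖ (x ⊝ h₁ ⊝ h₂)
        split₄ = ⋆-support (dilate halving H) (dilate thirding (reverse H)) (s ⊝ x) (proj₂ (proj₂ split₁))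
        g = proj₁ split₄
        h₃ = half g
        q = third (s ⊝ x ⊝ g)
        h₅ = ⊖ q
        H1 = nonzero-bit (H01 h₁) (proj₁ (proj₂ split₂))
        H2 = nonzero-bit (H01 h₂) (proj₁ (proj₂ split₃))
        H3 = nonzero-bit (H01 h₃) (proj₁ (proj₂ split₄))
        H4 = nonzero-bit (H01 h₄) (proj₂ (proj₂ split₃))
        H5 = nonzero-bit (H01 h₅) (proj₂ (proj₂ split₄))
        s₁ s₂ s₃ s₄ : G
        s₁ = 0g ⊕ (h₄ ⊝ h₁)
        s₂ = s₁ ⊕ (h₅ ⊝ h₂)
        s₃ = s₂ ⊕ (h₅ ⊝ h₃)
        s₄ = s₃ ⊕ (h₅ ⊝ h₃)
        point : 0g ⊝ s ≡ s₄
        point = sym (trans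
          (solve 5 (λ x h₁ h₂ y q →
              :0 :⊕ ((:⊖ (x :⊝ h₁ :⊝ h₂)) :⊝ h₁) :⊕ ((:⊖ q) :⊝ h₂) :⊕ ((:⊖ q) :⊝ y) :⊕ ((:⊖ q) :⊝ y)
                ⊜ :⊖ x :⊝ (q :⊕ q :⊕ q) :⊝ (y :⊕ y))
            refl x h₁ h₂ (half g) q)
          (trans (cong₂ (λ b c → ⊖ x ⊝ b ⊝ c) (triple-third (s ⊝ x ⊝ g)) (double-half g))
            (solve 3 (λ s x g → :⊖ x :⊝ (s :⊝ x :⊝ g) :⊝ g ⊜ :0 :⊝ s) refl s x g)))
        ring : ∀ a b → a + b + b + b + b ≡ a + + 4 * b
        ring = solve-∀

      0≤H : ∀ x → 0ℤ ≤ H x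
      0≤H x = 0≤bit (H01 x)
      0≤W : ∀ s → 0ℤ ≤ W s
      0≤W = ⋆-nonneg {w H} {v H} (0≤w H01) (0≤v 0≤H)

      -- Four of the five elements of `H` determine the last one.
      W≤ : ∀ s → W s ≤ η * (η * η) * η
      W≤ s = ≤-trans (⋆-≤ {w H} {v H} (0≤w H01) v≤η s) (≤-reflexive (cong (_* η) (∑-w H)))
        where
        v≤η : ∀ x → v H x ≤ η
        v≤η x = ≤-trans (⋆-≤ {dilate halving H} {dilate thirding (reverse H)} (λ x → 0≤H (half x)) (λ x → bit≤1 (H01 (⊖ third x))) x)
          (≤-reflexive (trans (*-identityʳ (∑ (dilate halving H))) (∑-dilate halving H)))

      ∑-W : ∑ W ≡ η * (η * η) * (η * η)
      ∑-W = trans (∑-⋆ (w H) (v H)) (cong₂ _*_ (∑-w H) (∑-v H))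

      -- The first term comes from `T` by `on-support`, the second from the diagonal error in
      -- `w⋆v≤`, for which the trivial bound `W≤` is good enough.
      smoothed-solutions : λ₀ * solutions (a ⋆ H)
        ≤ η * (η * η) * (η * η) * B + λ₀ * m * (η * (η * η) * η) * m³
      smoothed-solutions = begin
        λ₀ * solutions (a ⋆ H)
          ≡⟨ trans (cong (λ z → λ₀ * z) (solutions-⋆ a H)) (sym (∑-*ˡ λ₀ (λ s → W s * (w a ⋆ v a) (0g ⊝ s)))) ⟩
        ∑ (λ s → λ₀ * (W s * (w a ⋆ v a) (0g ⊝ s)))
          ≤⟨ ∑-mono (λ s → termwise (0≤W s) (W≤ s) (w⋆v≤ (0g ⊝ s)) (0≤rest (0g ⊝ s)) (on-support s)) ⟩
        ∑ (λ s → W s * B + λ₀ * m * (η * (η * η) * η) * (a ⋆ v a) (0g ⊝ s))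
          ≡⟨ trans (∑-distrib-+ (λ s → W s * B) (λ s → λ₀ * m * (η * (η * η) * η) * (a ⋆ v a) (0g ⊝ s)))
               (cong₂ _+_ (trans (∑-*ʳ W B) (cong (_* B) ∑-W))
                 (trans (∑-*ˡ (λ₀ * m * (η * (η * η) * η)) (λ s → (a ⋆ v a) (0g ⊝ s)))
                   (cong (λ z → λ₀ * m * (η * (η * η) * η) * z)
                     (trans (∑-reflect (a ⋆ v a) 0g) (trans (∑-⋆ a (v a)) (cong (λ z → m * z) (∑-v a))))))) ⟩
        η * (η * η) * (η * η) * B + λ₀ * m * (η * (η * η) * η) * m³ ∎
        where
        open ≤-Reasoning
        0≤rest : ∀ u → 0ℤ ≤ (a ⋆ v a) u
        0≤rest = ⋆-nonneg {a} {v a} 0≤a (0≤v 0≤a)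
        termwise : ∀ {ω u t r e} → 0ℤ ≤ ω → ω ≤ e → u ≤ t + m * r → 0ℤ ≤ r → (ω ≢ 0ℤ → λ₀ * t ≤ B) →
          λ₀ * (ω * u) ≤ ω * B + λ₀ * m * e * r
        termwise {ω} {u} {t} {r} {e} 0≤ω ω≤e u≤ 0≤r bound = begin
          λ₀ * (ω * u)                          ≤⟨ *-monoˡ λ₀ 0≤λ (*-monoˡ ω 0≤ω u≤) ⟩
          λ₀ * (ω * (t + m * r))                ≡⟨ ring₁ λ₀ ω t m r ⟩
          ω * (λ₀ * t) + λ₀ * m * ω * r         ≤⟨ +-mono-≤ (main (ω ℤₚ.≟ 0ℤ)) (*-monoʳ r 0≤r (*-monoˡ (λ₀ * m) (0≤* 0≤λ 0≤m) ω≤e)) ⟩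
          ω * B + λ₀ * m * e * r                ∎
          where
          ring₁ : ∀ l ω t m r → l * (ω * (t + m * r)) ≡ ω * (l * t) + l * m * ω * r
          ring₁ = solve-∀
          main : Dec (ω ≡ 0ℤ) → ω * (λ₀ * t) ≤ ω * B
          main (yes refl) = ≤-reflexive (trans (*-zeroˡ (λ₀ * t)) (sym (*-zeroˡ B)))
          main (no ω≢0) = *-monoˡ ω 0≤ω (bound ω≢0)

    -- Choice of the shifts and the contradiction

    module Sparse {κ : ℕ} (0<κ : 0ℤ < + κ) (constants : Constants κ) (Θ≤N : + Constants.Θ constants ≤ N)
      {a : G → ℤ} (a01 : Ind a) (a-sidon : Sidon a)
      (free : ∀ {x y z} → a x ≡ 1ℤ → a y ≡ 1ℤ → a z ≡ 1ℤ → differences a (z ⊕ z ⊕ z ⊝ (y ⊕ y) ⊝ x) ≡ 1ℤ → y ≡ z)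
      (N≤κm² : N ≤ + κ * (∑ a * ∑ a)) where

      open Transfer a01 a-sidon
      open Constants constants

      K l : ℤ
      K = + period-loss L
      l = + 16 * + A
      0≤l : 0ℤ ≤ l
      0≤l = 0≤* {+ 16} (+≤+ z≤n) (<⇒≤ 0<A)

      m²≤2N : m * m ≤ + 2 * N
      m²≤2N = ≤-trans m²≤m+N (≤-trans (+-monoˡ-≤ N (∑-ind≤N a01)) (≤-reflexive (double N)))
        where
        double : ∀ x → x + x ≡ + 2 * x
        double = solve-∀

      -- As `m` is of order `√N`, a constant multiple of it is below `N` once `N` is large.
      below-N : ∀ {c} → + 2 * (c * c) ≤ N → c * m ≤ N
      below-N {c} 2c²≤N = sq-cancel-≤ (<⇒≤ 0<N) (begin
        c * m * (c * m)          ≡⟨ ring₁ c m ⟩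
        c * c * (m * m)          ≤⟨ *-monoˡ (c * c) (0≤sq c) m²≤2N ⟩
        c * c * (+ 2 * N)        ≡⟨ ring₂ (c * c) N ⟩
        + 2 * (c * c) * N        ≤⟨ *-monoʳ N (<⇒≤ 0<N) 2c²≤N ⟩
        N * N                    ∎)
        where
        open ≤-Reasoning
        ring₁ : ∀ c m → c * m * (c * m) ≡ c * c * (m * m)
        ring₁ = solve-∀
        ring₂ : ∀ c n → c * (+ 2 * n) ≡ + 2 * c * n
        ring₂ = solve-∀

      4A≤m : + 4 * + A ≤ m
      4A≤m = from (+ 4 * + A ≤? m)
        where
        small : m < + 4 * + A → N ≤ + 16 * + κ * (+ A * + A)
        small m<4A = begin
          N                                    ≤⟨ N≤κm² ⟩
          + κ * (m * m)                        ≤⟨ *-monoˡ (+ κ) (<⇒≤ 0<κ)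
            (*-mono {m} {+ 4 * + A} {m} {+ 4 * + A} (≤-trans 0≤m (<⇒≤ m<4A)) 0≤m (<⇒≤ m<4A) (<⇒≤ m<4A)) ⟩
          + κ * (+ 4 * + A * (+ 4 * + A))      ≡⟨ ring (+ κ) (+ A) ⟩
          + 16 * + κ * (+ A * + A)             ∎
          where
          open ≤-Reasoning
          ring : ∀ k a → k * (+ 4 * a * (+ 4 * a)) ≡ + 16 * k * (a * a)
          ring = solve-∀
        from : Dec (+ 4 * + A ≤ m) → + 4 * + A ≤ m
        from (yes p) = p
        from (no ¬p) = ⊥-elim (<⇒≱ (<-≤-trans 16κA²<Θ Θ≤N) (small (≰⇒> ¬p)))

      0<m : 0ℤ < m
      0<m = <-≤-trans (0<* {+ 4} (+<+ (ℕ.s≤s z≤n)) 0<A) 4A≤m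

      periods = almost-periods L {D} {λ _ → 1ℤ} D01 (λ _ → inj₂ refl)

      H : G → ℤ
      H = proj₁ periods
      H01 : Ind H
      H01 = proj₁ (proj₂ periods)
      η : ℤ
      η = ∑ H

      N≤Kη : N ≤ K * η
      N≤Kη = subst (_≤ K * η) (trans (∑-const order 1ℤ) (*-identityʳ N)) (proj₁ (proj₂ (proj₂ (proj₂ periods))))

      distance : ∀ {p p′} → H p ≡ 1ℤ → H p′ ≡ 1ℤ → + L * auto-distance D (p ⊝ p′) ≤ N * N
      distance {p} {p′} e e′ = ≤-trans
        (*-monoʳ (auto-distance D (p ⊝ p′)) (∑-nonneg (λ t → 0≤abs (auto D (t ⊕ (p ⊝ p′)) - auto D t)))
          (+≤+ (ℕₚ.n≤1+n L)))
        (proj₂ (proj₂ (proj₂ (proj₂ periods))) e e′)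

      4Am≤η : + 4 * + A * m ≤ η
      4Am≤η = cancelˡ K (0<period-loss L) (begin
        K * (+ 4 * + A * m)        ≡⟨ ring₁ K (+ 4 * + A) m ⟩
        + 4 * + A * K * m          ≤⟨ below-N {+ 4 * + A * K} (≤-trans (≤-reflexive (ring₂ (+ A) K)) (≤-trans 32A²K²≤Θ Θ≤N)) ⟩
        N                          ≤⟨ N≤Kη ⟩
        K * η                      ∎)
        where
        open ≤-Reasoning
        ring₁ : ∀ k a m → k * (a * m) ≡ a * k * m
        ring₁ = solve-∀
        ring₂ : ∀ a k → + 2 * (+ 4 * a * k * (+ 4 * a * k)) ≡ + 32 * (a * a) * (k * k)
        ring₂ = solve-∀

      m≤η : m ≤ η
      m≤η = ≤-trans (≤-trans (≤-reflexive (sym (*-identityˡ m)))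
        (*-monoʳ m 0≤m (i<j⇒suc[i]≤j (0<* {+ 4} (+<+ (ℕ.s≤s z≤n)) 0<A)))) 4Am≤η

      0<η : 0ℤ < η
      0<η = <-≤-trans 0<m m≤η

      T-step : ∀ {p p′} → H p ≡ 1ℤ → H p′ ≡ 1ℤ → ∀ s → l * T (s ⊕ (p ⊝ p′)) ≤ l * T s + m * (m * m)
      T-step {p} {p′} e e′ s = ≤-trans (≤-reflexive (add-sub l (T (s ⊕ (p ⊝ p′))) (T s)))
        (+-monoʳ-≤ (l * T s) (bound {T (s ⊕ (p ⊝ p′)) - T s} {auto-distance D (p ⊝ p′)} {m} {N} {+ κ} {l} {+ L}
          (T-difference (p ⊝ p′) s) (distance e e′) (below-N {+ L} (≤-trans 2L²≤Θ Θ≤N)) N≤κm² L≡ 0<κ 0≤m (<⇒≤ 0<N)))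
        where
        add-sub : ∀ l x y → l * x ≡ l * y + l * (x - y)
        add-sub = solve-∀
        -- After multiplication by `L` both parts of `T-difference` are of order `N²`, in total
        -- `6 m² N² ≤ 6 κ² m⁶`. The choice `L = 6 κ² l²` cancels the constant and leaves
        -- `(l x)² ≤ m⁶`.
        bound : ∀ {x d m n κ l L} → x * x ≤ + 2 * (m * m) * (m * n + + 2 * d) → L * d ≤ n * n → L * m ≤ n →
          n ≤ κ * (m * m) → + 6 * (κ * κ) * (l * l) ≡ L → 0ℤ < κ → 0ℤ ≤ m → 0ℤ ≤ n → l * x ≤ m * (m * m)
        bound {x} {d} {m} {n} {κ} {l} {L} x²≤ Ld≤ Lm≤ n≤ refl 0<κ 0≤m 0≤n = sq-cancel-≤ (0≤* 0≤m (0≤sq m))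
          (cancelˡ (+ 6 * (κ * κ)) (0<* {+ 6} (+<+ (ℕ.s≤s z≤n)) (0<* 0<κ 0<κ)) (begin
            + 6 * (κ * κ) * (l * x * (l * x))
              ≡⟨ ring₁ (+ 6 * (κ * κ)) l x ⟩
            L * (x * x)
              ≤⟨ *-monoˡ L (0≤* (0≤* {+ 6} (+≤+ z≤n) (0≤sq κ)) (0≤sq l)) x²≤ ⟩
            L * (+ 2 * (m * m) * (m * n + + 2 * d))
              ≡⟨ ring₂ L m n d ⟩
            + 2 * (m * m) * (L * m * n + + 2 * (L * d))
              ≤⟨ *-monoˡ (+ 2 * (m * m)) (0≤* {+ 2} (+≤+ z≤n) (0≤sq m)) (+-mono-≤ (*-monoʳ n 0≤n Lm≤) (*-monoˡ (+ 2) (+≤+ z≤n) Ld≤)) ⟩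
            + 2 * (m * m) * (n * n + + 2 * (n * n))
              ≡⟨ ring₃ m (n * n) ⟩
            + 6 * (m * m) * (n * n)
              ≤⟨ *-monoˡ (+ 6 * (m * m)) (0≤* {+ 6} (+≤+ z≤n) (0≤sq m)) (*-mono {n} {κ * (m * m)} {n} {κ * (m * m)} (≤-trans 0≤n n≤) 0≤n n≤ n≤) ⟩
            + 6 * (m * m) * (κ * (m * m) * (κ * (m * m)))
              ≡⟨ ring₄ κ m ⟩
            + 6 * (κ * κ) * (m * (m * m) * (m * (m * m))) ∎))
          where
          open ≤-Reasoning
          ring₁ : ∀ c l x → c * (l * x * (l * x)) ≡ c * (l * l) * (x * x)
          ring₁ = solve-∀
          ring₂ : ∀ L m n d → L * (+ 2 * (m * m) * (m * n + + 2 * d)) ≡ + 2 * (m * m) * (L * m * n + + 2 * (L * d))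
          ring₂ = solve-∀
          ring₃ : ∀ m n → + 2 * (m * m) * (n + + 2 * n) ≡ + 6 * (m * m) * n
          ring₃ = solve-∀
          ring₄ : ∀ k m → + 6 * (m * m) * (k * (m * m) * (k * (m * m))) ≡ + 6 * (k * k) * (m * (m * m) * (m * (m * m)))
          ring₄ = solve-∀

      open DenseModel a01 a-sidon H01 0<η m≤η using (F; S; S01; dense; solutions-model; 0≤F)

      S-dense : N ≤ + (8 ℕ.* κ) * ∑ S
      S-dense = begin
        N                          ≤⟨ N≤κm² ⟩
        + κ * (m * m)              ≤⟨ *-monoˡ (+ κ) (<⇒≤ 0<κ) dense ⟩
        + κ * (+ 8 * ∑ S)          ≡⟨ ring (+ κ) (∑ S) ⟩
        + 8 * + κ * ∑ S            ≡⟨ cong (_* ∑ S) (sym (pos-* 8 κ)) ⟩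
        + (8 ℕ.* κ) * ∑ S          ∎
        where
        open ≤-Reasoning
        ring : ∀ k s → k * (+ 8 * s) ≡ + 8 * k * s
        ring = solve-∀

      absurd : ⊥
      absurd = Endgame.impossible {κ = + κ} 0<N 0<m 0<η 0<A (0≤dense-loss J) (0≤solutions 0≤F) refl
        (DenseSolutions.dense-solutions J S01
          (subst (λ z → N * (N * N) ≤ z * ∑ (λ x → S x * w S x)) J≡ (energy-large (8 ℕ.* κ) S-dense)))
        solutions-model
        (Smoothing.smoothed-solutions a01 a-sidon free l 0≤l H01 T-step)
        N≤κm² 32Cκ≤A 4A≤m 4Am≤η

    -- Solution-free sets

    SolutionFreeIn : (G → ℤ) → Set
    SolutionFreeIn a = ∀ {x₁ x₂ x₃ x₄ x₅} → a x₁ ≡ 1ℤ → a x₂ ≡ 1ℤ → a x₃ ≡ 1ℤ → a x₄ ≡ 1ℤ → a x₅ ≡ 1ℤ →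
      x₁ ⊕ x₂ ⊕ (x₃ ⊕ x₃) ≡ x₄ ⊕ (x₅ ⊕ x₅ ⊕ x₅) →
      (x₁ ≡ x₄ × x₂ ≡ x₃ × x₅ ≡ x₃) ⊎ (x₂ ≡ x₄ × x₁ ≡ x₃ × x₅ ≡ x₃)

    module _ {a : G → ℤ} (a01 : Ind a) (solution-free : SolutionFreeIn a) where

      -- For x₃ = x₅ the equation reads x₁ + x₂ = x₄ + x₃.
      solution-free⇒sidon : Sidon a
      solution-free⇒sidon t t≢0 = subst (_≤ 1ℤ) (sym (auto-expand a t))
        (∑-ind≤1 (λ x → bit-* (a01 x) (a01 (x ⊝ t))) unique)
        where
        unique : ∀ {x y} → a x * a (x ⊝ t) ≡ 1ℤ → a y * a (y ⊝ t) ≡ 1ℤ → x ≡ y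
        unique {x} {y} ex ey = cases (solution-free (proj₁ px) (proj₂ py) (proj₂ px) (proj₁ py) (proj₂ px)
          (solve 3 (λ x y t → x :⊕ (y :⊝ t) :⊕ (x :⊝ t :⊕ (x :⊝ t)) ⊜ y :⊕ (x :⊝ t :⊕ (x :⊝ t) :⊕ (x :⊝ t))) refl x y t))
          where
          px = bit-*≡1 (a01 x) (a01 (x ⊝ t)) ex
          py = bit-*≡1 (a01 y) (a01 (y ⊝ t)) ey
          cases : (x ≡ y × y ⊝ t ≡ x ⊝ t × x ⊝ t ≡ x ⊝ t) ⊎ (y ⊝ t ≡ y × x ≡ x ⊝ t × x ⊝ t ≡ x ⊝ t) → x ≡ y
          cases (inj₁ (x≡y , _)) = x≡y
          cases (inj₂ (y-t≡y , _)) = ⊥-elim (t≢0 (trans (solve 2 (λ y t → t ⊜ y :⊝ (y :⊝ t)) refl y t)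
            (trans (cong (λ z → y ⊝ z) y-t≡y) (solve 1 (λ y → y :⊝ y ⊜ :0) refl y))))

      -- A representation `u - (u - t)` of the difference provides `x₂` and `x₄` of a solution, and
      -- either kind of triviality forces `x₅ = x₃`.
      no-differences : ∀ {x y z} → a x ≡ 1ℤ → a y ≡ 1ℤ → a z ≡ 1ℤ →
        differences a (z ⊕ z ⊕ z ⊝ (y ⊕ y) ⊝ x) ≡ 1ℤ → y ≡ z
      no-differences {x} {y} {z} ax ay az d = sym (cases (solution-free ax (proj₁ p) ay (proj₂ p) az
        (solve 4 (λ x y z u → x :⊕ u :⊕ (y :⊕ y) ⊜ u :⊝ (z :⊕ z :⊕ z :⊝ (y :⊕ y) :⊝ x) :⊕ (z :⊕ z :⊕ z)) refl x y z u)))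
        where
        t = z ⊕ z ⊕ z ⊝ (y ⊕ y) ⊝ x
        positive-auto : (d : Dec (1ℤ ≤ auto a t)) → indicator d ≡ 1ℤ → ∑ (λ u → a u * a (u ⊝ t)) ≢ 0ℤ
        positive-auto (yes 1≤) _ ∑≡0 with subst (1ℤ ≤_) (trans (auto-expand a t) ∑≡0) 1≤
        ... | +≤+ ()
        positive-auto (no _) ()
        found = ∑-support (positive-auto (1ℤ ≤? auto a t) d)
        u = proj₁ found
        p = bit-*≡1 (a01 u) (a01 (u ⊝ t)) (nonzero-bit (bit-* (a01 u) (a01 (u ⊝ t))) (proj₂ found))
        cases : ∀ {A B : Set} → (A × u ≡ y × z ≡ y) ⊎ (B × x ≡ y × z ≡ y) → z ≡ y
        cases (inj₁ (_ , _ , e)) = e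
        cases (inj₂ (_ , _ , e)) = e

      solution-free-sparse : ∀ {κ} → 0ℤ < + κ → (c : Constants κ) → + Constants.Θ c ≤ N → ¬ (N ≤ + κ * (∑ a * ∑ a))
      solution-free-sparse 0<κ c Θ≤N = Sparse.absurd 0<κ c Θ≤N a01 solution-free⇒sidon no-differences

open Counting

-- The cyclic group of order 6n + 1

module Cyclic (n : ℕ) where

  open import Data.Nat using (_+_; _*_; _∸_; _<_; _≤_; _%_)
  open import Data.Nat.Properties using (+-assoc; +-comm; m∸n+n≡m; <⇒≤)
  open import Data.Nat.DivMod using (_mod_; m%n<n; m<n⇒m%n≡m; m%n%n≡m%n; n%n≡0; [m+kn]%n≡m%n; %-distribˡ-+; %-distribˡ-*)
  open ℕ-Solver using (solve-∀)

  modulus : ℕ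
  modulus = ℕ.suc (6 * n)

  infixl 6 _⊕_
  infixl 7 _⊙_

  [_] : ℕ → Fin modulus
  [ a ] = a mod modulus

  _⊕_ : Fin modulus → Fin modulus → Fin modulus
  x ⊕ y = [ toℕ x + toℕ y ]

  ⊖_ : Fin modulus → Fin modulus
  ⊖ x = [ modulus ∸ toℕ x ]

  _⊙_ : ℕ → Fin modulus → Fin modulus
  c ⊙ x = [ c * toℕ x ]

  toℕ-[] : ∀ a → toℕ [ a ] ≡ a % modulus
  toℕ-[] a = toℕ-fromℕ< (m%n<n a modulus)

  []-cong : ∀ a b → a % modulus ≡ b % modulus → [ a ] ≡ [ b ]
  []-cong a b e = toℕ-injective (trans (toℕ-[] a) (trans e (sym (toℕ-[] b))))

  []-injective : ∀ {a b} → a < modulus → b < modulus → [ a ] ≡ [ b ] → a ≡ b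
  []-injective {a} {b} a< b< e = trans (sym (m<n⇒m%n≡m a<))
    (trans (sym (toℕ-[] a)) (trans (cong toℕ e) (trans (toℕ-[] b) (m<n⇒m%n≡m b<))))

  [toℕ] : ∀ x → [ toℕ x ] ≡ x
  [toℕ] x = toℕ-injective (trans (toℕ-[] (toℕ x)) (m<n⇒m%n≡m (toℕ<n x)))

  []-⊕ : ∀ a b → [ a ] ⊕ [ b ] ≡ [ a + b ]
  []-⊕ a b = []-cong (toℕ [ a ] + toℕ [ b ]) (a + b)
    (trans (cong₂ (λ u v → (u + v) % modulus) (toℕ-[] a) (toℕ-[] b)) (sym (%-distribˡ-+ a b modulus)))

  ⊙-[] : ∀ c a → c ⊙ [ a ] ≡ [ c * a ]
  ⊙-[] c a = []-cong (c * toℕ [ a ]) (c * a) (begin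
    (c * toℕ [ a ]) % modulus                          ≡⟨ cong (λ u → (c * u) % modulus) (toℕ-[] a) ⟩
    (c * (a % modulus)) % modulus                      ≡⟨ %-distribˡ-* c (a % modulus) modulus ⟩
    (c % modulus * (a % modulus % modulus)) % modulus  ≡⟨ cong (λ u → (c % modulus * u) % modulus) (m%n%n≡m%n a modulus) ⟩
    (c % modulus * (a % modulus)) % modulus            ≡⟨ sym (%-distribˡ-* c a modulus) ⟩
    (c * a) % modulus                                  ∎)
    where open ≡-Reasoning

  ⊕-assoc : ∀ x y z → (x ⊕ y) ⊕ z ≡ x ⊕ (y ⊕ z)
  ⊕-assoc x y z = begin
    [ toℕ x + toℕ y ] ⊕ z              ≡⟨ cong (λ u → [ toℕ x + toℕ y ] ⊕ u) (sym ([toℕ] z)) ⟩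
    [ toℕ x + toℕ y ] ⊕ [ toℕ z ]      ≡⟨ []-⊕ (toℕ x + toℕ y) (toℕ z) ⟩
    [ toℕ x + toℕ y + toℕ z ]          ≡⟨ cong [_] (+-assoc (toℕ x) (toℕ y) (toℕ z)) ⟩
    [ toℕ x + (toℕ y + toℕ z) ]        ≡⟨ sym ([]-⊕ (toℕ x) (toℕ y + toℕ z)) ⟩
    [ toℕ x ] ⊕ [ toℕ y + toℕ z ]      ≡⟨ cong (_⊕ [ toℕ y + toℕ z ]) ([toℕ] x) ⟩
    x ⊕ [ toℕ y + toℕ z ]              ∎
    where open ≡-Reasoning

  ⊕-comm : ∀ x y → x ⊕ y ≡ y ⊕ x
  ⊕-comm x y = cong [_] (+-comm (toℕ x) (toℕ y))

  ⊕-identityˡ : ∀ x → [ 0 ] ⊕ x ≡ x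
  ⊕-identityˡ x = [toℕ] x

  ⊕-inverseˡ : ∀ x → ⊖ x ⊕ x ≡ [ 0 ]
  ⊕-inverseˡ x = begin
    [ modulus ∸ toℕ x ] ⊕ x              ≡⟨ cong (λ u → [ modulus ∸ toℕ x ] ⊕ u) (sym ([toℕ] x)) ⟩
    [ modulus ∸ toℕ x ] ⊕ [ toℕ x ]      ≡⟨ []-⊕ (modulus ∸ toℕ x) (toℕ x) ⟩
    [ modulus ∸ toℕ x + toℕ x ]          ≡⟨ cong [_] (m∸n+n≡m (<⇒≤ (toℕ<n x))) ⟩
    [ modulus ]                          ≡⟨ []-cong modulus 0 (n%n≡0 modulus) ⟩
    [ 0 ]                                ∎
    where open ≡-Reasoning

  isAbelianGroup : IsAbelianGroup _≡_ _⊕_ [ 0 ] ⊖_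
  isAbelianGroup = record
    { isGroup = record
      { isMonoid = record
        { isSemigroup = record
          { isMagma = record { isEquivalence = isEquivalence ; ∙-cong = cong₂ _⊕_ }
          ; assoc = ⊕-assoc }
        ; identity = ⊕-identityˡ , λ x → trans (⊕-comm x [ 0 ]) (⊕-identityˡ x) }
      ; inverse = ⊕-inverseˡ , λ x → trans (⊕-comm x (⊖ x)) (⊕-inverseˡ x)
      ; ⁻¹-cong = cong ⊖_ }
    ; comm = ⊕-comm }

  wrap : ∀ {a} k x → a ≡ toℕ x + k * modulus → [ a ] ≡ x
  wrap {a} k x e = trans ([]-cong a (toℕ x) (trans (cong (_% modulus) e) ([m+kn]%n≡m%n (toℕ x) k modulus))) ([toℕ] x)

  -- 2 (3 n + 1) = modulus + 1 and 3 (4 n + 1) = 2 modulus + 1.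
  half third : Fin modulus → Fin modulus
  half x = (3 * n + 1) ⊙ x
  third x = (4 * n + 1) ⊙ x

  double-half : ∀ x → half x ⊕ half x ≡ x
  double-half x = trans ([]-⊕ ((3 * n + 1) * toℕ x) ((3 * n + 1) * toℕ x)) (wrap (toℕ x) x (ring n (toℕ x)))
    where
    ring : ∀ n t → (3 * n + 1) * t + (3 * n + 1) * t ≡ t + t * (1 + 6 * n)
    ring = solve-∀

  half-double : ∀ x → half (x ⊕ x) ≡ x
  half-double x = trans (⊙-[] (3 * n + 1) (toℕ x + toℕ x)) (wrap (toℕ x) x (ring n (toℕ x)))
    where
    ring : ∀ n t → (3 * n + 1) * (t + t) ≡ t + t * (1 + 6 * n)
    ring = solve-∀

  triple-third : ∀ x → third x ⊕ third x ⊕ third x ≡ x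
  triple-third x = trans (cong (_⊕ third x) ([]-⊕ ((4 * n + 1) * toℕ x) ((4 * n + 1) * toℕ x)))
    (trans ([]-⊕ ((4 * n + 1) * toℕ x + (4 * n + 1) * toℕ x) ((4 * n + 1) * toℕ x)) (wrap (2 * toℕ x) x (ring n (toℕ x))))
    where
    ring : ∀ n t → (4 * n + 1) * t + (4 * n + 1) * t + (4 * n + 1) * t ≡ t + 2 * t * (1 + 6 * n)
    ring = solve-∀

  third-triple : ∀ x → third (x ⊕ x ⊕ x) ≡ x
  third-triple x = trans (cong third (trans (cong ([ toℕ x + toℕ x ] ⊕_) (sym ([toℕ] x))) ([]-⊕ (toℕ x + toℕ x) (toℕ x))))
    (trans (⊙-[] (4 * n + 1) (toℕ x + toℕ x + toℕ x)) (wrap (2 * toℕ x) x (ring n (toℕ x))))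
    where
    ring : ∀ n t → (4 * n + 1) * (t + t + t) ≡ t + 2 * t * (1 + 6 * n)
    ring = solve-∀

  group : Group₆
  group = record
    { order = modulus ; 0<order = ℤ.+<+ (ℕ.s≤s ℕ.z≤n)
    ; _⊕_ = _⊕_ ; 0g = [ 0 ] ; ⊖_ = ⊖_ ; isAbelianGroup = isAbelianGroup
    ; half = half ; double-half = double-half ; half-double = half-double
    ; third = third ; triple-third = triple-third ; third-triple = third-triple }

open import Data.Fin.Subset using (Subset; ∣_∣; _∈_; inside)

-- Transport of a solution-free set into the cyclic group

module Embedding {n} {A : Subset n} (solution-free : SolutionFree A) where

  open import Data.Integer using (ℤ; +_; 0ℤ; 1ℤ; _*_; _≤_; _<_; +≤+)
  open import Data.Integer.Properties using (module ≤-Reasoning)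
  open Cyclic n
  open Convolution group using (SolutionFreeIn)

  embed : Fin n → Fin modulus
  embed i = [ val i ]

  -- Either side of the equation is a sum of four values, at most `4 n`, so equality modulo
  -- `6 n + 1` is equality of natural numbers.
  sum<modulus : ∀ {a b c d} → a ℕ.≤ n → b ℕ.≤ n → c ℕ.≤ n → d ℕ.≤ n → a ℕ.+ b ℕ.+ (c ℕ.+ d) ℕ.< modulus
  sum<modulus a≤ b≤ c≤ d≤ = ℕ.s≤s (ℕₚ.≤-trans (ℕₚ.+-mono-≤ (ℕₚ.+-mono-≤ a≤ b≤) (ℕₚ.+-mono-≤ c≤ d≤))
    (ℕₚ.≤-trans (ℕₚ.m≤m+n (n ℕ.+ n ℕ.+ (n ℕ.+ n)) (2 ℕ.* n)) (ℕₚ.≤-reflexive (ring n))))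
    where
    ring : ∀ n → n ℕ.+ n ℕ.+ (n ℕ.+ n) ℕ.+ 2 ℕ.* n ≡ 6 ℕ.* n
    ring = ℕ-Solver.solve-∀

  val≤n : ∀ (i : Fin n) → val i ℕ.≤ n
  val≤n = toℕ<n

  val-injective : ∀ {i j : Fin n} → val i ≡ val j → i ≡ j
  val-injective e = toℕ-injective (ℕₚ.suc-injective e)

  embed-injective : ∀ {i j} → embed i ≡ embed j → i ≡ j
  embed-injective {i} {j} e = val-injective ([]-injective (below i) (below j) e)
    where
    below : ∀ i → val i ℕ.< modulus
    below i = ℕ.s≤s (ℕₚ.≤-trans (val≤n i) (ℕₚ.m≤m+n n (5 ℕ.* n)))

  member : Fin n → ℤ
  member i = indicator (lookup A i Bool.≟ inside)

  -- The indicator of the image of `A`, written as a sum over preimages: exchanging sums gives its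
  -- size, and injectivity of `embed` keeps its values in 0 and 1.
  a : Fin modulus → ℤ
  a x = ∑ (λ i → indicator (x ≟ embed i) * member i)

  member-ind : Ind member
  member-ind = ind-indicator (λ i → lookup A i Bool.≟ inside)

  term-ind : ∀ x → Ind (λ i → indicator (x ≟ embed i) * member i)
  term-ind x i = bit-* (ind-indicator (λ i → x ≟ embed i) i) (member-ind i)

  term≡1 : ∀ x {i} → indicator (x ≟ embed i) * member i ≡ 1ℤ → x ≡ embed i × i ∈ A
  term≡1 x {i} e = from-indicator (x ≟ embed i) (proj₁ p) , lookup⇒[]= i A (from-indicator (lookup A i Bool.≟ inside) (proj₂ p))
    where p = bit-*≡1 (ind-indicator (λ i → x ≟ embed i) i) (member-ind i) e

  a01 : Ind a
  a01 x = small (∑-nonneg (λ i → 0≤bit (term-ind x i)))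
    (∑-ind≤1 (term-ind x) (λ e e′ → embed-injective (trans (sym (proj₁ (term≡1 x e))) (proj₁ (term≡1 x e′)))))
    where
    small : ∀ {z} → 0ℤ ≤ z → z ≤ 1ℤ → z ≡ 0ℤ ⊎ z ≡ 1ℤ
    small {+ 0} _ _ = inj₁ refl
    small {+ 1} _ _ = inj₂ refl
    small {+ ℕ.suc (ℕ.suc _)} _ (+≤+ (ℕ.s≤s ()))

  preimage : ∀ {x} → a x ≡ 1ℤ → ∃ λ i → x ≡ embed i × i ∈ A
  preimage {x} e = proj₁ found , term≡1 x (nonzero-bit (term-ind x (proj₁ found)) (proj₂ found))
    where
    found : ∃ λ i → indicator (x ≟ embed i) * member i ≢ 0ℤ
    found = ∑-support (λ z → 1≢0 (trans (sym e) z))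
      where
      1≢0 : 1ℤ ≢ 0ℤ
      1≢0 ()

  ∑a : ∑ a ≡ + ∣ A ∣
  ∑a = begin
    ∑ (λ x → ∑ (λ i → indicator (x ≟ embed i) * member i))  ≡⟨ ∑-comm (λ x i → indicator (x ≟ embed i) * member i) ⟩
    ∑ (λ i → ∑ (λ x → indicator (x ≟ embed i) * member i))  ≡⟨ ∑-cong (λ i → ∑-δ (λ _ → member i) (embed i)) ⟩
    ∑ member                                                ≡⟨ count A ⟩
    + ∣ A ∣                                                 ∎
    where
    open ≡-Reasoning
    count : ∀ {n} (p : Subset n) → ∑ (λ i → indicator (lookup p i Bool.≟ inside)) ≡ + ∣ p ∣
    count [] = refl
    count (true ∷ p) = cong (λ u → 1ℤ ℤ.+ u) (count p)
    count (false ∷ p) = cong (λ u → 0ℤ ℤ.+ u) (count p)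

  solution-free-image : SolutionFreeIn a
  solution-free-image {x₁} {x₂} {x₃} {x₄} {x₅} e₁ e₂ e₃ e₄ e₅ equation =
    cases (solution-free i₁ i₂ i₃ i₄ i₅ (proj₂ (proj₂ p₁)) (proj₂ (proj₂ p₂)) (proj₂ (proj₂ p₃))
      (proj₂ (proj₂ p₄)) (proj₂ (proj₂ p₅)) ℕ-equation)
    where
    p₁ = preimage e₁
    p₂ = preimage e₂
    p₃ = preimage e₃
    p₄ = preimage e₄
    p₅ = preimage e₅
    i₁ = proj₁ p₁
    i₂ = proj₁ p₂
    i₃ = proj₁ p₃
    i₄ = proj₁ p₄
    i₅ = proj₁ p₅
    v₁ = val i₁
    v₂ = val i₂
    v₃ = val i₃
    v₄ = val i₄
    v₅ = val i₅

    lhs : x₁ ⊕ x₂ ⊕ (x₃ ⊕ x₃) ≡ [ v₁ ℕ.+ v₂ ℕ.+ (v₃ ℕ.+ v₃) ]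
    lhs = trans (cong₂ _⊕_
      (trans (cong₂ _⊕_ (proj₁ (proj₂ p₁)) (proj₁ (proj₂ p₂))) ([]-⊕ v₁ v₂))
      (trans (cong₂ _⊕_ (proj₁ (proj₂ p₃)) (proj₁ (proj₂ p₃))) ([]-⊕ v₃ v₃)))
      ([]-⊕ (v₁ ℕ.+ v₂) (v₃ ℕ.+ v₃))

    rhs : x₄ ⊕ (x₅ ⊕ x₅ ⊕ x₅) ≡ [ v₄ ℕ.+ v₅ ℕ.+ (v₅ ℕ.+ v₅) ]
    rhs = begin
      x₄ ⊕ (x₅ ⊕ x₅ ⊕ x₅)
        ≡⟨ cong₂ (λ x y → x ⊕ (y ⊕ y ⊕ y)) (proj₁ (proj₂ p₄)) (proj₁ (proj₂ p₅)) ⟩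
      [ v₄ ] ⊕ ([ v₅ ] ⊕ [ v₅ ] ⊕ [ v₅ ])
        ≡⟨ trans (cong ([ v₄ ] ⊕_) (⊕-assoc [ v₅ ] [ v₅ ] [ v₅ ])) (sym (⊕-assoc [ v₄ ] [ v₅ ] ([ v₅ ] ⊕ [ v₅ ]))) ⟩
      [ v₄ ] ⊕ [ v₅ ] ⊕ ([ v₅ ] ⊕ [ v₅ ])
        ≡⟨ cong₂ _⊕_ ([]-⊕ v₄ v₅) ([]-⊕ v₅ v₅) ⟩
      [ v₄ ℕ.+ v₅ ] ⊕ [ v₅ ℕ.+ v₅ ]
        ≡⟨ []-⊕ (v₄ ℕ.+ v₅) (v₅ ℕ.+ v₅) ⟩
      [ v₄ ℕ.+ v₅ ℕ.+ (v₅ ℕ.+ v₅) ] ∎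
      where open ≡-Reasoning

    ℕ-equation : v₁ ℕ.+ v₂ ℕ.+ 2 ℕ.* v₃ ≡ v₄ ℕ.+ 3 ℕ.* v₅
    ℕ-equation = trans (ring₁ v₁ v₂ v₃) (trans
      ([]-injective (sum<modulus (val≤n i₁) (val≤n i₂) (val≤n i₃) (val≤n i₃))
                    (sum<modulus (val≤n i₄) (val≤n i₅) (val≤n i₅) (val≤n i₅))
                    (trans (sym lhs) (trans equation rhs)))
      (ring₂ v₄ v₅))
      where
      ring₁ : ∀ a b c → a ℕ.+ b ℕ.+ 2 ℕ.* c ≡ a ℕ.+ b ℕ.+ (c ℕ.+ c)
      ring₁ = ℕ-Solver.solve-∀
      ring₂ : ∀ a b → a ℕ.+ b ℕ.+ (b ℕ.+ b) ≡ a ℕ.+ 3 ℕ.* b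
      ring₂ = ℕ-Solver.solve-∀

    lift : ∀ {x y i j} → x ≡ embed i → y ≡ embed j → val i ≡ val j → x ≡ y
    lift x≡ y≡ e = trans x≡ (trans (cong [_] e) (sym y≡))

    cases : Trivial v₁ v₂ v₃ v₄ v₅ → (x₁ ≡ x₄ × x₂ ≡ x₃ × x₅ ≡ x₃) ⊎ (x₂ ≡ x₄ × x₁ ≡ x₃ × x₅ ≡ x₃)
    cases (inj₁ (e , f , g)) = inj₁
      (lift (proj₁ (proj₂ p₁)) (proj₁ (proj₂ p₄)) e , lift (proj₁ (proj₂ p₂)) (proj₁ (proj₂ p₃)) f , lift (proj₁ (proj₂ p₅)) (proj₁ (proj₂ p₃)) g)
    cases (inj₂ (e , f , g)) = inj₂
      (lift (proj₁ (proj₂ p₂)) (proj₁ (proj₂ p₄)) e , lift (proj₁ (proj₂ p₁)) (proj₁ (proj₂ p₃)) f , lift (proj₁ (proj₂ p₅)) (proj₁ (proj₂ p₃)) g)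

  -- The factor 6 in `κ` compensates for the passage to the larger group:
  -- `6 n + 1 ≤ 6 (n + 1) ≤ 6 k² s²` with `s` the size of `A`.
  not-dense : ∀ k κ → κ ≡ 6 ℕ.* (k ℕ.* k) → 0ℤ < + κ → (c : Constants κ) → Constants.Θ c ℕ.≤ n →
    ¬ (n ℕ.< (k ℕ.* k) ℕ.* (∣ A ∣ ℕ.* ∣ A ∣))
  not-dense k κ κ≡ 0<κ c Θ≤n n<k²s² = Convolution.solution-free-sparse group a01 solution-free-image 0<κ c
    (+≤+ (ℕₚ.≤-trans Θ≤n (ℕₚ.≤-trans (ℕₚ.m≤m+n n (5 ℕ.* n)) (ℕₚ.n≤1+n (6 ℕ.* n)))))
    (subst (λ u → + modulus ≤ + κ * (u * u)) (sym ∑a) (begin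
      + modulus               ≤⟨ +≤+ bound ⟩
      + (κ ℕ.* (s ℕ.* s))     ≡⟨ ℤₚ.pos-* κ (s ℕ.* s) ⟩
      + κ * + (s ℕ.* s)       ≡⟨ cong (λ u → + κ * u) (ℤₚ.pos-* s s) ⟩
      + κ * (+ s * + s)       ∎))
    where
    open ≤-Reasoning
    s = ∣ A ∣
    bound : modulus ℕ.≤ κ ℕ.* (s ℕ.* s)
    bound = subst (λ u → modulus ℕ.≤ u ℕ.* (s ℕ.* s)) (sym κ≡)
      (ℕₚ.≤-trans (ℕₚ.m≤n+m modulus 5)
        (ℕₚ.≤-trans (ℕₚ.≤-reflexive (ring₁ n))
          (ℕₚ.≤-trans (ℕₚ.*-monoʳ-≤ 6 n<k²s²) (ℕₚ.≤-reflexive (ring₂ k s)))))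
      where
      ring₁ : ∀ n → 5 ℕ.+ (1 ℕ.+ 6 ℕ.* n) ≡ 6 ℕ.* (1 ℕ.+ n)
      ring₁ = ℕ-Solver.solve-∀
      ring₂ : ∀ k s → 6 ℕ.* ((k ℕ.* k) ℕ.* (s ℕ.* s)) ≡ 6 ℕ.* (k ℕ.* k) ℕ.* (s ℕ.* s)
      ring₂ = ℕ-Solver.solve-∀

open import Data.Nat using (_*_; _≤_; _<_)

-- Size `o(√n)` means that for each `k` the size is eventually at most `√n / k`; squaring keeps this
-- within the natural numbers.
eventually-sparse : ∀ k κ → κ ≡ 6 * (k * k) → 0 < κ → Constants κ →
  ∃[ N ] ((n : ℕ) → N ≤ n → (A : Subset n) → SolutionFree A → (k * k) * (∣ A ∣ * ∣ A ∣) ≤ n)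
eventually-sparse k κ κ≡ 0<κ c = Constants.Θ c , λ n Θ≤n A solution-free →
  ℕₚ.≮⇒≥ (Embedding.not-dense solution-free k κ κ≡ (ℤ.+<+ 0<κ) c Θ≤n)

theorem1p13 : (k : ℕ) → ∃[ N ] ((n : ℕ) → N ≤ n → (A : Subset n) → SolutionFree A →
    (k * k) * (∣ A ∣ * ∣ A ∣) ≤ n)
-- Here `κ = 6 k²` would vanish, while the argument needs it positive; the inequality is trivial.
theorem1p13 ℕ.zero = 0 , λ _ _ _ _ → ℕ.z≤n
theorem1p13 (ℕ.suc k) = eventually-sparse (ℕ.suc k) (6 * (ℕ.suc k * ℕ.suc k)) refl (ℕ.s≤s ℕ.z≤n)
  (constants (6 * (ℕ.suc k * ℕ.suc k)))
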